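{- Let $d$ be a prime and let $m\geq 2$ and $n\geq 1$ be integers. Then the number of irreducible factors of the Misiurewicz polynomial $G_{d,m,n}(c)\in\mathbb{Z}[c]$ over $\mathbb{Q}$ is bounded from above by the number of irreducible factors of the reduction $\overline{G_{d,0,n}}(c)\in\mathbb{F}_d[c]$ of $G_{d,0,n}(c)$ modulo $d$. In particular, if $\overline{G_{d,0,n}}(c)$ is irreducible over $\mathbb{F}_d$, then $G_{d,m,n}(c)$ is irreducible over $\mathbb{Q}$.
   Context: For an integer $d\geq 2$ let $f_{c,d}(x)=x^d+c$, and write $f_{c,d}^k$ for the $k$-th iterate ($f_{c,d}^0(x)=x$); $f_{c,d}^k(0)$ is a polynomial in $c$ with integer coefficients. Let $\mu$ denote the Möbius function. Define $G_{d,0,n}(c)=\prod_{k\mid n}\big(f_{c,d}^k(0)\big)^{\mu(n/k)}$. For $m\geq 1$ set $$F_{d,m,n}(c)=\prod_{k\mid n}\left(\frac{f_{c,d}^{m+k}(0)-f_{c,d}^m(0)}{f_{c,d}^{m-1+k}(0)-f_{c,d}^{m-1}(0)}\right)^{\mu(n/k)},$$ and for $m\geq 2$ define $G_{d,m,n}(c)=F_{d,m,n}(c)$ if $n\nmid m-1$, and $G_{d,m,n}(c)=F_{d,m,n}(c)/F_{d,1,n}(c)$ if $n\mid m-1$. These $G_{d,m,n}(c)$ (for $m=0$ or $m\ge 2$) are polynomials with integer coefficients; $\overline{G}$ denotes reduction of coefficients modulo $d$. -}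

module Defs where

open import Level using (0ℓ)
open import Algebra.Bundles.Raw using (RawRing)
open import Data.Nat as ℕ using (ℕ; zero; suc; _≤_)
open import Data.Nat.Divisibility as ℕD using (_∣?_)
open import Data.Nat.Primality using (prime?)
open import Data.Integer as ℤ using (ℤ; +_)
import Data.Integer.Divisibility as ℤD
open import Data.Rational as ℚ using (ℚ)
open import Data.List as L using (List; []; _∷_; length; filter; map; concatMap; upTo)
open import Data.List.Relation.Unary.All using (All)
open import Data.Product using (_×_; _,_; Σ; ∃; ∃-syntax; proj₁; proj₂)
open import Data.Empty using (⊥)
open import Relation.Nullary using (¬_; Dec; yes; no)
open import Relation.Nullary.Decidable using (_×-dec_; ¬?)
open import Relation.Binary.PropositionalEquality using (_≡_)

-- Univariate polynomials over a (raw) commutative ring R, represented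
-- by coefficient lists, lowest degree first.  Equality is coefficientwise
-- (w.r.t. the ring's equality), with missing coefficients read as 0.

module Poly (R : RawRing 0ℓ 0ℓ) where
  open RawRing R

  Pol : Set
  Pol = List Carrier

  coeff : Pol → ℕ → Carrier
  coeff []       _       = 0#
  coeff (a ∷ p)  zero    = a
  coeff (a ∷ p)  (suc i) = coeff p i

  infix 4 _≈ₚ_
  _≈ₚ_ : Pol → Pol → Set
  p ≈ₚ q = ∀ i → coeff p i ≈ coeff q i

  infixl 6 _+ₚ_
  _+ₚ_ : Pol → Pol → Pol
  []      +ₚ q       = q
  (a ∷ p) +ₚ []      = a ∷ p
  (a ∷ p) +ₚ (b ∷ q) = (a + b) ∷ (p +ₚ q)

  -ₚ_ : Pol → Pol
  -ₚ p = map -_ p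

  infixl 6 _-ₚ_
  _-ₚ_ : Pol → Pol → Pol
  p -ₚ q = p +ₚ (-ₚ q)

  scale : Carrier → Pol → Pol
  scale a p = map (a *_) p

  infixl 7 _*ₚ_
  _*ₚ_ : Pol → Pol → Pol
  []      *ₚ q = []
  (a ∷ p) *ₚ q = scale a q +ₚ (0# ∷ (p *ₚ q))

  const : Carrier → Pol
  const a = a ∷ []

  oneₚ : Pol
  oneₚ = const 1#

  X : Pol
  X = 0# ∷ 1# ∷ []

  infixr 8 _^ₚ_
  _^ₚ_ : Pol → ℕ → Pol
  p ^ₚ zero  = oneₚ
  p ^ₚ suc k = p *ₚ (p ^ₚ k)

  prodₚ : List Pol → Pol
  prodₚ []       = oneₚ
  prodₚ (p ∷ ps) = p *ₚ prodₚ ps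

  NonConstant : Pol → Set
  NonConstant p = ∃[ i ] (1 ≤ i × ¬ (coeff p i ≈ 0#))

  -- irreducible element of K[c] (K a field): nonconstant (i.e. a nonzero
  -- non-unit) and not a product of two nonconstant polynomials
  Irreducible : Pol → Set
  Irreducible p = NonConstant p × (∀ a b → a *ₚ b ≈ₚ p → ¬ (NonConstant a × NonConstant b))

  HasIrreducibleFactorCount : Pol → ℕ → Set
  HasIrreducibleFactorCount p k =
    Σ Carrier λ u → Σ (List Pol) λ qs →
      ¬ (u ≈ 0#) × All Irreducible qs × length qs ≡ k × (const u *ₚ prodₚ qs ≈ₚ p)

ℤring : RawRing 0ℓ 0ℓ
ℤring = ℤ.+-*-rawRing

ℚring : RawRing 0ℓ 0ℓ
ℚring = ℚ.+-*-rawRing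

𝔽ring : ℕ → RawRing 0ℓ 0ℓ
𝔽ring d = record
  { Carrier = ℤ
  ; _≈_     = λ x y → (+ d) ℤD.∣ (x ℤ.- y)
  ; _+_     = ℤ._+_
  ; _*_     = ℤ._*_
  ; -_      = ℤ.-_
  ; 0#      = + 0
  ; 1#      = + 1
  }

module ℤ[c] = Poly ℤring
module ℚ[c] = Poly ℚring
module 𝔽[c] (d : ℕ) = Poly (𝔽ring d)

toℚ[c] : ℤ[c].Pol → ℚ[c].Pol
toℚ[c] = map (λ z → z ℚ./ 1)

-- reduction modulo d (the carrier of 𝔽ring d is ℤ, read mod d)
reduce : (d : ℕ) → ℤ[c].Pol → 𝔽[c].Pol d
reduce d p = p

-- Möbius function (μ 0 is irrelevant and set to 0)

squarefree? : (n : ℕ) → Dec (All (λ k → ¬ (k ℕ.* k ℕD.∣ n)) (filter (λ k → 2 ℕ.≤? k) (upTo (suc n))))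
squarefree? n = Data.List.Relation.Unary.All.all? (λ k → ¬? ((k ℕ.* k) ∣? n)) _
  where import Data.List.Relation.Unary.All

numPrimeDivisors : ℕ → ℕ
numPrimeDivisors n = length (filter (λ p → prime? p ×-dec (p ∣? n)) (upTo (suc n)))

μ : ℕ → ℤ
μ zero = + 0
μ n@(suc _) with squarefree? n
... | yes _ = (ℤ.- (+ 1)) ℤ.^ numPrimeDivisors n
... | no  _ = + 0

divisorPairs : ℕ → List (ℕ × ℕ)
divisorPairs n =
  filter (λ kj → (proj₁ kj ℕ.* proj₂ kj) ℕ.≟ n)
         (concatMap (λ k → map (λ j → (k , j)) (upTo (suc n))) (upTo (suc n)))

divisorsμ+ divisorsμ- : ℕ → List ℕ
divisorsμ+ n = map proj₁ (filter (λ kj → μ (proj₂ kj) ℤ.≟ + 1) (divisorPairs n))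
divisorsμ- n = map proj₁ (filter (λ kj → μ (proj₂ kj) ℤ.≟ ℤ.- (+ 1)) (divisorPairs n))

orbit : (d k : ℕ) → ℤ[c].Pol
orbit d zero    = []
orbit d (suc k) = ℤ[c]._+ₚ_ (ℤ[c]._^ₚ_ (orbit d k) d) ℤ[c].X

Aₖ Bₖ : (d m k : ℕ) → ℤ[c].Pol
Aₖ d m k = ℤ[c]._-ₚ_ (orbit d (m ℕ.+ k)) (orbit d m)
Bₖ d m k = ℤ[c]._-ₚ_ (orbit d (m ℕ.∸ 1 ℕ.+ k)) (orbit d (m ℕ.∸ 1))

numF denF : (d m n : ℕ) → ℤ[c].Pol
numF d m n = ℤ[c]._*ₚ_ (ℤ[c].prodₚ (map (Aₖ d m) (divisorsμ+ n)))
                         (ℤ[c].prodₚ (map (Bₖ d m) (divisorsμ- n)))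
denF d m n = ℤ[c]._*ₚ_ (ℤ[c].prodₚ (map (Bₖ d m) (divisorsμ+ n)))
                         (ℤ[c].prodₚ (map (Aₖ d m) (divisorsμ- n)))

-- G is (the integer polynomial equal to) G_{d,m,n}; defined by clearing
-- the denominators of the defining products of rational functions
-- (ℤ[c] is a domain and the denominators are nonzero, so G is unique).
IsG : (d m n : ℕ) → ℤ[c].Pol → Set
IsG d zero n G =
  ℤ[c]._≈ₚ_ (ℤ[c]._*ₚ_ G (ℤ[c].prodₚ (map (orbit d) (divisorsμ- n))))
            (ℤ[c].prodₚ (map (orbit d) (divisorsμ+ n)))
IsG d (suc m′) n G with n ℕD.∣? m′
... | no  _ = ℤ[c]._≈ₚ_ (ℤ[c]._*ₚ_ G (denF d (suc m′) n)) (numF d (suc m′) n)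
... | yes _ = ℤ[c]._≈ₚ_ (ℤ[c]._*ₚ_ (ℤ[c]._*ₚ_ G (denF d (suc m′) n)) (numF d 1 n))
                       (ℤ[c]._*ₚ_ (numF d (suc m′) n) (denF d 1 n))

{-# OPTIONS --safe #-}
module Submission where

-- Write a_k for the k-th iterate f^k(0) and A_k, B_k for the differences in F_{d,m,n}.  Then A_k = B_k Q_k
-- with Q_k ≡ B_k^{d-1} and B_k ≡ a_k^{d^{m-1}} modulo the prime d, so that G_{d,m,n} ≡ G_{d,0,n}^N mod d.
-- Let q be an irreducible factor of G_{d,0,n} mod d and 𝔭 = (q, d) ⊂ ℤ[c].  Möbius inversion shows that
-- 0 has exact period n modulo 𝔭: a_j ∈ 𝔭 iff n ∣ j.  Hence among the Q_k only Q_n lies in 𝔭, and by the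
-- expansion of (y + b)^d it is d times a unit modulo 𝔭² (if n ∣ m - 1, after division by a_n^{d-1}, which
-- is its share of F_{d,1,n}).  So G_{d,m,n} ∉ 𝔭², as in the criteria of Eisenstein and Schönemann: two
-- factors of G_{d,m,n} never share q modulo d.  By Gauss's lemma a factorisation over ℚ can be made
-- integral at d, and each factor then has some q all to itself.

-- Throughout, `j` stands for m - 1 and d = 2 + `e`. Nothing is localised: a unit at 𝔭 is an element
-- outside 𝔭, and quotients are replaced by cross-multiplied equations. The obstacle is the last
-- summand of h(y, b) = ((y + b)^d - y^d) / b = d y^{d-1} + d b M + b^{d-1}: only d y^{d-1} may
-- survive modulo 𝔭². If n does not divide m - 1, then y = a_{m-1} is a unit at 𝔭, and b = B_n lies
-- in 𝔭² because m ≥ 2. If n divides m - 1, both arguments are multiples of a_n, and homogeneity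
-- gives Q_n = a_n^{d-1} h(t, b) with t ≡ 1 modulo 𝔭. Now b is only known to lie in 𝔭, which
-- suffices for d ≥ 3; for d = 2 it has to lie in 𝔭², which it does once m ≥ 3. There remains d = m
-- = 2, n = 1, where G_{d,m,n} is linear. That every factor meets some q rests on G_{d,m,n} being
-- monic: once the factorisation is integral at d, the leading coefficient of each factor is prime
-- to d, so the factor stays nonconstant modulo d.

open import Defs
open import Level using (0ℓ)
open import Algebra.Bundles using (CommutativeRing; CommutativeMonoid)
import Algebra.Properties.CommutativeSemigroup as CommutativeSemigroupProperties
import Algebra.Properties.Ring as RingProperties
import Algebra.Solver.Ring.NaturalCoefficients.Default as NatSolver
open import Data.Empty using (⊥; ⊥-elim)
open import Data.Fin as Fin using (Fin; toℕ; inject₁; fromℕ)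
import Data.Fin.Properties as Fin
open import Data.Integer as ℤ using (ℤ; +_)
import Data.Integer.Properties as ℤ
import Data.Integer.Divisibility as ℤ
open import Data.List using (List; []; _∷_; _++_; map; filter; length; lookup; concatMap; upTo; cartesianProduct)
open import Data.List.Membership.Propositional using (_∈_)
open import Data.List.Membership.Propositional.Properties
open import Data.List.Properties using (map-++)
open import Data.List.Relation.Unary.All as All using (All; []; _∷_)
import Data.List.Relation.Unary.All.Properties as All
open import Data.List.Relation.Unary.AllPairs using ([]; _∷_)
open import Data.List.Relation.Unary.Any as Any using (Any; here; there)
open import Data.List.Relation.Unary.Any.Properties using (lookup-index)
open import Data.List.Relation.Unary.Unique.Propositional using (Unique)
import Data.List.Relation.Unary.Unique.Propositional.Properties as Unique
open import Data.Nat as ℕ using (ℕ; zero; suc; _≤_; _<_; z≤n; s≤s; _!)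
open import Data.Nat.Combinatorics using (_C_; nCk≡n!/k![n-k]!; k![n∸k]!∣n!; nCn≡1; nC1≡n)
open import Data.Nat.Coprimality as Coprime using (coprime-divisor; coprime-Bézout)
open import Data.Nat.Divisibility as ℕ using (_∣_; _∣?_; divides; ∣⇒≤; ∣-trans; m∣m*n; n∣m*n; ∣m⇒∣m*n; *-cancelʳ-∣; *-pres-∣; ∣1⇒≡1; 0∣⇒≡0)
open import Data.Nat.DivMod using (_%_; _/_; m≡m%n+[m/n]*n; m%n<n; m/n*n≡m)
open import Data.Nat.GCD using (module Bézout)
open import Data.Nat.ListAction using (product)
open import Data.Nat.Primality using (Prime; euclidsLemma; prime⇒nonTrivial; prime⇒nonZero; prime⇒irreducible; prime?; ¬prime[0]; ¬prime[1])
open import Data.Nat.Primality.Factorisation using (factorise)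
import Data.Nat.Properties as ℕ
open import Data.Product using (_×_; _,_; ∃; ∃₂; proj₁; proj₂)
open import Data.Rational as ℚ using (ℚ; toℚᵘ; ↥_; ↧_)
import Data.Rational.Properties as ℚ
open import Data.Rational.Unnormalised as ℚᵘ using (mkℚᵘ; *≡*)
import Data.Rational.Unnormalised.Properties as ℚᵘ
open import Data.Sum as Sum using (_⊎_; inj₁; inj₂; [_,_]′)
open import Function using (_∘_)
open import Relation.Binary.Bundles using (Setoid)
open import Relation.Binary.Core using (Rel)
open import Relation.Binary.Definitions using (tri<; tri≈; tri>)
open import Relation.Binary.PropositionalEquality as ≡ using (_≡_; _≢_)
import Relation.Binary.Reasoning.Setoid as SetoidReasoning
open import Relation.Binary.Structures using (IsEquivalence)
open import Relation.Nullary using (¬_; Dec; yes; no)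
open import Relation.Nullary.Decidable using (_×-dec_)
open import Relation.Nullary.Negation using (contradiction)
open import Relation.Unary using (Pred; Decidable)

-- Polynomials

module PolyRing (R : CommutativeRing 0ℓ 0ℓ) where
  open CommutativeRing R
  open Poly rawRing public
  open RingProperties ring using (-0#≈0#)

  coeff-+ : ∀ p q i → coeff (p +ₚ q) i ≈ coeff p i + coeff q i
  coeff-+ []      q       i       = sym (+-identityˡ _)
  coeff-+ (a ∷ p) []      i       = sym (+-identityʳ _)
  coeff-+ (a ∷ p) (b ∷ q) zero    = refl
  coeff-+ (a ∷ p) (b ∷ q) (suc i) = coeff-+ p q i

  coeff-scale : ∀ a p i → coeff (scale a p) i ≈ a * coeff p i
  coeff-scale a []      i       = sym (zeroʳ a)
  coeff-scale a (b ∷ p) zero    = refl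
  coeff-scale a (b ∷ p) (suc i) = coeff-scale a p i

  coeff-neg : ∀ p i → coeff (-ₚ p) i ≈ - coeff p i
  coeff-neg []      i       = sym -0#≈0#
  coeff-neg (b ∷ p) zero    = refl
  coeff-neg (b ∷ p) (suc i) = coeff-neg p i

  -- ≈ₚ unfolds to a function type, from which the two polynomials cannot be inferred.
  infix 4 _≋_
  record _≋_ (p q : Pol) : Set where
    constructor mk
    field at : p ≈ₚ q
  open _≋_ public

  ≋-setoid : Setoid 0ℓ 0ℓ
  ≋-setoid = record
    { Carrier = Pol ; _≈_ = _≋_
    ; isEquivalence = record
      { refl  = mk λ i → refl
      ; sym   = λ e → mk λ i → sym (at e i)
      ; trans = λ e f → mk λ i → trans (at e i) (at f i) } }

  open Setoid ≋-setoid public using () renaming (refl to ≋-refl; sym to ≋-sym; trans to ≋-trans)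

  ∷-cong : ∀ {a b p q} → a ≈ b → p ≋ q → a ∷ p ≋ b ∷ q
  ∷-cong e f = mk λ { zero → e ; (suc i) → at f i }

  +ₚ-cong : ∀ {p p′ q q′} → p ≋ p′ → q ≋ q′ → p +ₚ q ≋ p′ +ₚ q′
  +ₚ-cong {p} {p′} {q} {q′} e f = mk λ i →
    trans (coeff-+ p q i) (trans (+-cong (at e i) (at f i)) (sym (coeff-+ p′ q′ i)))

  +ₚ-assoc : ∀ p q r → (p +ₚ q) +ₚ r ≋ p +ₚ (q +ₚ r)
  +ₚ-assoc p q r = mk λ i → begin
    coeff ((p +ₚ q) +ₚ r) i              ≈⟨ coeff-+ (p +ₚ q) r i ⟩
    coeff (p +ₚ q) i + coeff r i         ≈⟨ +-congʳ (coeff-+ p q i) ⟩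
    coeff p i + coeff q i + coeff r i    ≈⟨ +-assoc _ _ _ ⟩
    coeff p i + (coeff q i + coeff r i)  ≈⟨ +-congˡ (coeff-+ q r i) ⟨
    coeff p i + coeff (q +ₚ r) i         ≈⟨ coeff-+ p (q +ₚ r) i ⟨
    coeff (p +ₚ (q +ₚ r)) i              ∎
    where open SetoidReasoning setoid

  +ₚ-comm : ∀ p q → p +ₚ q ≋ q +ₚ p
  +ₚ-comm p q = mk λ i → trans (coeff-+ p q i) (trans (+-comm _ _) (sym (coeff-+ q p i)))

  +ₚ-identityʳ : ∀ p → p +ₚ [] ≋ p
  +ₚ-identityʳ p = mk λ i → trans (coeff-+ p [] i) (+-identityʳ _)

  -ₚ-cong : ∀ {p q} → p ≋ q → -ₚ p ≋ -ₚ q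
  -ₚ-cong {p} {q} e = mk λ i → trans (coeff-neg p i) (trans (-‿cong (at e i)) (sym (coeff-neg q i)))

  -ₚ-inverseˡ : ∀ p → (-ₚ p) +ₚ p ≋ []
  -ₚ-inverseˡ p = mk λ i →
    trans (coeff-+ (-ₚ p) p i) (trans (+-congʳ (coeff-neg p i)) (-‿inverseˡ _))

  +ₚ-commutativeMonoid : CommutativeMonoid 0ℓ 0ℓ
  +ₚ-commutativeMonoid = record
    { Carrier = Pol ; _≈_ = _≋_ ; _∙_ = _+ₚ_ ; ε = []
    ; isCommutativeMonoid = record
      { isMonoid = record
        { isSemigroup = record
          { isMagma = record { isEquivalence = Setoid.isEquivalence ≋-setoid ; ∙-cong = +ₚ-cong }
          ; assoc = +ₚ-assoc }
        ; identity = (λ p → ≋-refl) , +ₚ-identityʳ }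
      ; comm = +ₚ-comm } }

  open CommutativeSemigroupProperties (CommutativeMonoid.commutativeSemigroup +ₚ-commutativeMonoid)
    using (interchange; x∙yz≈y∙xz)

  scale-cong : ∀ {a b p q} → a ≈ b → p ≋ q → scale a p ≋ scale b q
  scale-cong {a} {b} {p} {q} e f = mk λ i →
    trans (coeff-scale a p i) (trans (*-cong e (at f i)) (sym (coeff-scale b q i)))

  scale-+ₚ : ∀ a p q → scale a (p +ₚ q) ≋ scale a p +ₚ scale a q
  scale-+ₚ a p q = mk λ i → begin
    coeff (scale a (p +ₚ q)) i                  ≈⟨ coeff-scale a (p +ₚ q) i ⟩
    a * coeff (p +ₚ q) i                        ≈⟨ *-congˡ (coeff-+ p q i) ⟩
    a * (coeff p i + coeff q i)                 ≈⟨ distribˡ _ _ _ ⟩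
    a * coeff p i + a * coeff q i               ≈⟨ +-cong (coeff-scale a p i) (coeff-scale a q i) ⟨
    coeff (scale a p) i + coeff (scale a q) i   ≈⟨ coeff-+ (scale a p) (scale a q) i ⟨
    coeff (scale a p +ₚ scale a q) i            ∎
    where open SetoidReasoning setoid

  scale-scale : ∀ a b p → scale (a * b) p ≋ scale a (scale b p)
  scale-scale a b p = mk λ i → begin
    coeff (scale (a * b) p) i      ≈⟨ coeff-scale (a * b) p i ⟩
    a * b * coeff p i              ≈⟨ *-assoc _ _ _ ⟩
    a * (b * coeff p i)            ≈⟨ *-congˡ (coeff-scale b p i) ⟨
    a * coeff (scale b p) i        ≈⟨ coeff-scale a (scale b p) i ⟨
    coeff (scale a (scale b p)) i  ∎
    where open SetoidReasoning setoid

  scale-one : ∀ p → scale 1# p ≋ p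
  scale-one p = mk λ i → trans (coeff-scale 1# p i) (*-identityˡ _)

  scale-zero : ∀ p → scale 0# p ≋ []
  scale-zero p = mk λ i → trans (coeff-scale 0# p i) (zeroˡ _)

  const≋[] : ∀ {a} → a ≈ 0# → const a ≋ []
  const≋[] e = mk λ { zero → e ; (suc i) → refl }

  *ₚ-zeroʳ : ∀ p → p *ₚ [] ≋ []
  *ₚ-zeroʳ []      = ≋-refl
  *ₚ-zeroʳ (a ∷ p) = ≋-trans (∷-cong refl (*ₚ-zeroʳ p)) (const≋[] refl)

  *ₚ-congˡ : ∀ p {q q′} → q ≋ q′ → p *ₚ q ≋ p *ₚ q′
  *ₚ-congˡ []      e = ≋-refl
  *ₚ-congˡ (a ∷ p) e = +ₚ-cong (scale-cong refl e) (∷-cong refl (*ₚ-congˡ p e))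

  -- Multiplication recurses on its left argument. Unfolding the right one instead is what lets
  -- commutativity go by induction on the left factor.
  *ₚ-∷ : ∀ p b q → p *ₚ (b ∷ q) ≋ scale b p +ₚ (0# ∷ (p *ₚ q))
  *ₚ-∷ []      b q = ≋-sym (const≋[] refl)
  *ₚ-∷ (a ∷ p) b q = ∷-cong (+-congʳ (*-comm a b))
    (≋-trans (+ₚ-cong ≋-refl (*ₚ-∷ p b q)) (x∙yz≈y∙xz (scale a q) (scale b p) _))

  *ₚ-comm : ∀ p q → p *ₚ q ≋ q *ₚ p
  *ₚ-comm []      q = ≋-sym (*ₚ-zeroʳ q)
  *ₚ-comm (a ∷ p) q =
    ≋-trans (+ₚ-cong ≋-refl (∷-cong refl (*ₚ-comm p q))) (≋-sym (*ₚ-∷ q a p))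

  *ₚ-cong : ∀ {p p′ q q′} → p ≋ p′ → q ≋ q′ → p *ₚ q ≋ p′ *ₚ q′
  *ₚ-cong {p} {p′} {q} {q′} e f =
    ≋-trans (*ₚ-comm p q) (≋-trans (*ₚ-congˡ q e) (≋-trans (*ₚ-comm q p′) (*ₚ-congˡ p′ f)))

  *ₚ-distribˡ : ∀ p q r → p *ₚ (q +ₚ r) ≋ p *ₚ q +ₚ p *ₚ r
  *ₚ-distribˡ []      q r = ≋-refl
  *ₚ-distribˡ (a ∷ p) q r = ≋-trans
    (+ₚ-cong (scale-+ₚ a q r) (∷-cong (sym (+-identityˡ 0#)) (*ₚ-distribˡ p q r)))
    (interchange (scale a q) (scale a r) (0# ∷ (p *ₚ q)) (0# ∷ (p *ₚ r)))

  *ₚ-distribʳ : ∀ r p q → (p +ₚ q) *ₚ r ≋ p *ₚ r +ₚ q *ₚ r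
  *ₚ-distribʳ r p q = ≋-trans (*ₚ-comm (p +ₚ q) r)
    (≋-trans (*ₚ-distribˡ r p q) (+ₚ-cong (*ₚ-comm r p) (*ₚ-comm r q)))

  0∷-*ₚ : ∀ p r → (0# ∷ p) *ₚ r ≋ 0# ∷ (p *ₚ r)
  0∷-*ₚ p r = +ₚ-cong (scale-zero r) ≋-refl

  scale-*ₚ : ∀ a p r → scale a p *ₚ r ≋ scale a (p *ₚ r)
  scale-*ₚ a []      r = ≋-refl
  scale-*ₚ a (b ∷ p) r = ≋-trans
    (+ₚ-cong (scale-scale a b r) (∷-cong (sym (zeroʳ a)) (scale-*ₚ a p r)))
    (≋-sym (scale-+ₚ a (scale b r) (0# ∷ (p *ₚ r))))

  *ₚ-assoc : ∀ p q r → (p *ₚ q) *ₚ r ≋ p *ₚ (q *ₚ r)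
  *ₚ-assoc []      q r = ≋-refl
  *ₚ-assoc (a ∷ p) q r = ≋-trans (*ₚ-distribʳ r (scale a q) (0# ∷ (p *ₚ q)))
    (+ₚ-cong (scale-*ₚ a q r) (≋-trans (0∷-*ₚ (p *ₚ q) r) (∷-cong refl (*ₚ-assoc p q r))))

  const-*ₚ : ∀ a p → const a *ₚ p ≋ scale a p
  const-*ₚ a p = ≋-trans (+ₚ-cong ≋-refl (const≋[] refl)) (+ₚ-identityʳ (scale a p))

  *ₚ-identityˡ : ∀ p → oneₚ *ₚ p ≋ p
  *ₚ-identityˡ p = ≋-trans (const-*ₚ 1# p) (scale-one p)

  polyRing : CommutativeRing 0ℓ 0ℓ
  polyRing = record
    { Carrier = Pol ; _≈_ = _≋_ ; _+_ = _+ₚ_ ; _*_ = _*ₚ_ ; -_ = -ₚ_ ; 0# = [] ; 1# = oneₚ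
    ; isCommutativeRing = record
      { isRing = record
        { +-isAbelianGroup = record
          { isGroup = record
            { isMonoid = CommutativeMonoid.isMonoid +ₚ-commutativeMonoid
            ; inverse = -ₚ-inverseˡ , λ p → ≋-trans (+ₚ-comm p (-ₚ p)) (-ₚ-inverseˡ p)
            ; ⁻¹-cong = -ₚ-cong }
          ; comm = +ₚ-comm }
        ; *-cong = *ₚ-cong
        ; *-assoc = *ₚ-assoc
        ; *-identity = *ₚ-identityˡ , λ p → ≋-trans (*ₚ-comm p oneₚ) (*ₚ-identityˡ p)
        ; distrib = *ₚ-distribˡ , *ₚ-distribʳ }
      ; *-comm = *ₚ-comm } }

  private module P = CommutativeRing polyRing
  open CommutativeSemigroupProperties P.*-commutativeSemigroup public using ()
    renaming (x∙yz≈y∙xz to P-x∙yz≈y∙xz; interchange to P-interchange)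

  const-interchange : ∀ a b p q → const (a * b) *ₚ (p *ₚ q) ≋ (const a *ₚ p) *ₚ (const b *ₚ q)
  const-interchange a b p q =
    ≋-trans (*ₚ-cong (≋-sym (const-*ₚ a (const b))) ≋-refl) (P-interchange (const a) (const b) p q)

  const-assoc : ∀ a b p → const (a * b) *ₚ p ≋ const a *ₚ (const b *ₚ p)
  const-assoc a b p =
    ≋-trans (*ₚ-cong (≋-sym (const-*ₚ a (const b))) ≋-refl) (*ₚ-assoc (const a) (const b) p)

  const-cong : ∀ {a b} → a ≈ b → const a ≋ const b
  const-cong e = ∷-cong e ≋-refl

  -- Degree bounds and leading coefficients

  Deg< : Pol → ℕ → Set
  Deg< p n = ∀ i → n ≤ i → coeff p i ≈ 0#

  Deg<-mono : ∀ {p m n} → m ≤ n → Deg< p m → Deg< p n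
  Deg<-mono m≤n h i n≤i = h i (ℕ.≤-trans m≤n n≤i)

  Deg<-resp : ∀ {p q n} → p ≋ q → Deg< p n → Deg< q n
  Deg<-resp e h i n≤i = trans (sym (at e i)) (h i n≤i)

  Deg<-tail : ∀ {a p n} → Deg< (a ∷ p) (suc n) → Deg< p n
  Deg<-tail h i n≤i = h (suc i) (s≤s n≤i)

  Deg<-∷ : ∀ {a p n} → Deg< p n → Deg< (a ∷ p) (suc n)
  Deg<-∷ h (suc i) (s≤s n≤i) = h i n≤i

  Deg<-+ : ∀ {p q n} → Deg< p n → Deg< q n → Deg< (p +ₚ q) n
  Deg<-+ {p} {q} h k i n≤i =
    trans (coeff-+ p q i) (trans (+-cong (h i n≤i) (k i n≤i)) (+-identityˡ 0#))

  Deg<-neg : ∀ {p n} → Deg< p n → Deg< (-ₚ p) n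
  Deg<-neg {p} h i n≤i = trans (coeff-neg p i) (trans (-‿cong (h i n≤i)) -0#≈0#)

  Deg<0⇒≋[] : ∀ {p} → Deg< p 0 → p ≋ []
  Deg<0⇒≋[] h = mk λ i → h i z≤n

  Deg<1⇒≋const : ∀ {p} → Deg< p 1 → p ≋ const (coeff p 0)
  Deg<1⇒≋const h = mk λ { zero → refl ; (suc i) → h (suc i) (s≤s z≤n) }

  coeff-∷-* : ∀ a p q i → coeff ((a ∷ p) *ₚ q) (suc i) ≈ a * coeff q (suc i) + coeff (p *ₚ q) i
  coeff-∷-* a p q i =
    trans (coeff-+ (scale a q) (0# ∷ (p *ₚ q)) (suc i)) (+-congʳ (coeff-scale a q (suc i)))

  coeff-const-* : ∀ a q i → coeff (const a *ₚ q) i ≈ a * coeff q i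
  coeff-const-* a q i = trans (at (const-*ₚ a q) i) (coeff-scale a q i)

  ∷[]-* : ∀ a p q → p ≋ [] → (a ∷ p) *ₚ q ≋ scale a q
  ∷[]-* a p q e = ≋-trans (*ₚ-cong (∷-cong refl e) ≋-refl) (const-*ₚ a q)

  -- `a` may be zero, in which case `n` merely bounds the degree. This makes `Lead` multiplicative
  -- over every commutative ring.
  record Lead (p : Pol) (n : ℕ) (a : Carrier) : Set where
    constructor lead
    field
      top   : coeff p n ≈ a
      above : Deg< p (suc n)
  open Lead public

  Lead-resp : ∀ {p q n a} → p ≋ q → Lead p n a → Lead q n a
  Lead-resp e (lead t h) = lead (trans (sym (at e _)) t) (Deg<-resp e h)

  Lead-const : ∀ a → Lead (const a) 0 a
  Lead-const a = lead refl λ { (suc i) _ → refl }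

  Lead-X : Lead X 1 1#
  Lead-X = lead refl λ { (suc zero) (s≤s ()) ; (suc (suc i)) _ → refl }

  Lead-+ : ∀ {p q n a} → Lead p n a → Deg< q n → Lead (p +ₚ q) n a
  Lead-+ {p} {q} {n} (lead t h) k = lead
    (trans (coeff-+ p q n) (trans (+-cong t (k n ℕ.≤-refl)) (+-identityʳ _)))
    (Deg<-+ {p} {q} h (Deg<-mono {q} (ℕ.n≤1+n n) k))

  Lead-*′ : ∀ p q n m → Deg< p (suc n) → Deg< q (suc m) →
            Lead (p *ₚ q) (n ℕ.+ m) (coeff p n * coeff q m)
  Lead-*′ []      q n       m h k = lead (sym (zeroˡ _)) λ _ _ → refl
  Lead-*′ (a ∷ p) q zero    m h k = Lead-resp (≋-sym (∷[]-* a p q (Deg<0⇒≋[] (Deg<-tail {a} {p} h))))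
    (lead (coeff-scale a q m) λ i m<i → trans (coeff-scale a q i) (trans (*-congˡ (k i m<i)) (zeroʳ a)))
  Lead-*′ (a ∷ p) q (suc n) m h k = lead
    (trans (step (n ℕ.+ m) (s≤s (ℕ.m≤n+m m n))) (top IH))
    λ { (suc i) (s≤s le) → trans (step i (s≤s (ℕ.≤-trans (ℕ.m≤n+m m n) (ℕ.<⇒≤ le)))) (above IH i le) }
    where
    IH = Lead-*′ p q n m (Deg<-tail {a} {p} h) k
    -- At an index above the bound `m` for `q`, the head `a` of the left factor contributes nothing.
    step : ∀ i → suc m ≤ suc i → coeff ((a ∷ p) *ₚ q) (suc i) ≈ coeff (p *ₚ q) i
    step i le = trans (coeff-∷-* a p q i)
      (trans (+-congʳ (trans (*-congˡ (k (suc i) le)) (zeroʳ a))) (+-identityˡ _))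

  Lead-* : ∀ {p q n m a b} → Lead p n a → Lead q m b → Lead (p *ₚ q) (n ℕ.+ m) (a * b)
  Lead-* {p} {q} {n} {m} (lead t h) (lead u k) with Lead-*′ p q n m h k
  ... | lead v l = lead (trans v (*-cong t u)) l

  Monic : Pol → ℕ → Set
  Monic p n = Lead p n 1#

  Monic-* : ∀ {p q n m} → Monic p n → Monic q m → Monic (p *ₚ q) (n ℕ.+ m)
  Monic-* l k with Lead-* l k
  ... | lead t h = lead (trans t (*-identityˡ 1#)) h

  Monic-^ : ∀ {p n} k → Monic p n → Monic (p ^ₚ k) (k ℕ.* n)
  Monic-^ zero    l = Lead-const 1#
  Monic-^ (suc k) l = Monic-* l (Monic-^ k l)

  Lead⇒NonConstant : ∀ {p n a} → 1 ≤ n → ¬ a ≈ 0# → Lead p n a → NonConstant p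
  Lead⇒NonConstant 1≤n ne l = _ , 1≤n , λ z → ne (trans (sym (top l)) z)

  prodₚ-pick : ∀ ps i → ∃ λ r → prodₚ ps ≋ lookup ps i *ₚ r
  prodₚ-pick (p ∷ ps) Fin.zero    = prodₚ ps , ≋-refl
  prodₚ-pick (p ∷ ps) (Fin.suc i) with prodₚ-pick ps i
  ... | r , e = p *ₚ r , ≋-trans (*ₚ-congˡ p e) (P-x∙yz≈y∙xz p (lookup ps i) r)

  -- The positions differ, not necessarily the entries: a repeated factor counts with its
  -- multiplicity.
  prodₚ-pick₂ : ∀ ps i j → ¬ i ≡ j → ∃ λ r → prodₚ ps ≋ lookup ps i *ₚ (lookup ps j *ₚ r)
  prodₚ-pick₂ (p ∷ ps) Fin.zero    Fin.zero    i≢j = contradiction ≡.refl i≢j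
  prodₚ-pick₂ (p ∷ ps) Fin.zero    (Fin.suc j) i≢j with prodₚ-pick ps j
  ... | r , e = r , *ₚ-congˡ p e
  prodₚ-pick₂ (p ∷ ps) (Fin.suc i) Fin.zero    i≢j with prodₚ-pick ps i
  ... | r , e = r , ≋-trans (*ₚ-congˡ p e) (P-x∙yz≈y∙xz p (lookup ps i) r)
  prodₚ-pick₂ (p ∷ ps) (Fin.suc i) (Fin.suc j) i≢j with prodₚ-pick₂ ps i j (i≢j ∘ ≡.cong Fin.suc)
  ... | r , e = p *ₚ r , ≋-trans (*ₚ-congˡ p e) (≋-trans (P-x∙yz≈y∙xz p (lookup ps i) _)
    (*ₚ-congˡ (lookup ps i) (P-x∙yz≈y∙xz p (lookup ps j) r)))

  -- Degrees over an integral domain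

  module Domain (_≈0? : ∀ a → Dec (a ≈ 0#))
                (integral : ∀ {a b} → a * b ≈ 0# → a ≈ 0# ⊎ b ≈ 0#) where

    HasDegree : Pol → ℕ → Set
    HasDegree p n = ∃ λ a → ¬ a ≈ 0# × Lead p n a

    degree? : ∀ p → p ≋ [] ⊎ ∃ (HasDegree p)
    degree? []      = inj₁ ≋-refl
    degree? (a ∷ p) with degree? p
    ... | inj₂ (n , b , ne , lead t h) = inj₂ (suc n , b , ne , lead t (Deg<-∷ {a} {p} h))
    ... | inj₁ e with a ≈0?
    ...   | yes z  = inj₁ (≋-trans (∷-cong z e) (const≋[] refl))
    ...   | no  ne = inj₂ (0 , a , ne , Lead-resp (∷-cong refl (≋-sym e)) (Lead-const a))

    degree-* : ∀ {p q n m} → HasDegree p n → HasDegree q m → HasDegree (p *ₚ q) (n ℕ.+ m)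
    degree-* (a , a≉0 , l) (b , b≉0 , k) = a * b , ab≉0 , Lead-* l k
      where
      ab≉0 : ¬ a * b ≈ 0#
      ab≉0 z with integral z
      ... | inj₁ e = a≉0 e
      ... | inj₂ e = b≉0 e

    degree-resp : ∀ {p q n} → p ≋ q → HasDegree p n → HasDegree q n
    degree-resp e (a , ne , l) = a , ne , Lead-resp e l

    degree≉[] : ∀ {p n} → HasDegree p n → ¬ p ≋ []
    degree≉[] (a , ne , l) e = ne (trans (sym (top l)) (at e _))

    degree-unique : ∀ {p n m} → HasDegree p n → HasDegree p m → n ≡ m
    degree-unique {p} {n} {m} (a , a≉0 , lead t h) (b , b≉0 , lead u k) with ℕ.<-cmp n m
    ... | tri< n<m _ _ = contradiction (trans (sym u) (h m n<m)) b≉0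
    ... | tri≈ _ n≡m _ = n≡m
    ... | tri> _ _ m<n = contradiction (trans (sym t) (k n m<n)) a≉0

    NonConstant⇒degree : ∀ {p} → NonConstant p → ∃ λ n → HasDegree p (suc n)
    NonConstant⇒degree {p} (i , 1≤i , ne) with degree? p
    ... | inj₁ e = contradiction (at e i) ne
    ... | inj₂ (suc n , x) = n , x
    ... | inj₂ (zero , a , _ , l) = contradiction (above l i 1≤i) ne

    noZeroDivisors : ∀ {p q} → p *ₚ q ≋ [] → p ≋ [] ⊎ q ≋ []
    noZeroDivisors {p} {q} e with degree? p | degree? q
    ... | inj₁ z | _ = inj₁ z
    ... | inj₂ _ | inj₁ z = inj₂ z
    ... | inj₂ (n , x) | inj₂ (m , y) = contradiction e (degree≉[] (degree-* x y))

  -- Division, Bézout relations and irreducible polynomials over a field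

  module Euclid (_≈0? : ∀ a → Dec (a ≈ 0#))
                (inverse : ∀ a → ¬ a ≈ 0# → ∃ λ b → b * a ≈ 1#)
                (0≉1 : ¬ 1# ≈ 0#) where

    private
      integral : ∀ {a b} → a * b ≈ 0# → a ≈ 0# ⊎ b ≈ 0#
      integral {a} {b} e with a ≈0?
      ... | yes z = inj₁ z
      ... | no ne with inverse a ne
      ...   | i , ia≈1 = inj₂ (begin
        b            ≈⟨ *-identityˡ b ⟨
        1# * b       ≈⟨ *-congʳ ia≈1 ⟨
        i * a * b    ≈⟨ *-assoc i a b ⟩
        i * (a * b)  ≈⟨ *-congˡ e ⟩
        i * 0#       ≈⟨ zeroʳ i ⟩
        0#           ∎)
        where open SetoidReasoning setoid

    open Domain _≈0? integral public

    private module S = NatSolver (CommutativeRing.commutativeSemiring polyRing)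

    -- Horner's scheme: p = h q + r gives b + X p = h (X q) + (b + X r), and as b + X r has degree
    -- at most n, one constant multiple of h repairs the remainder. The recursion is on the
    -- coefficient list and needs no measure.
    divide : ∀ {h n} → HasDegree h n → ∀ p → ∃ λ q → ∃ λ r → p ≋ h *ₚ q +ₚ r × Deg< r n
    divide {h} {n} (a , a≉0 , l) = go
      where
      a⁻¹ = proj₁ (inverse a a≉0)
      cancel : ∀ b → b * a⁻¹ * a ≈ b
      cancel b = trans (*-assoc b a⁻¹ a) (trans (*-congˡ (proj₂ (inverse a a≉0))) (*-identityʳ b))
      go : ∀ p → ∃ λ q → ∃ λ r → p ≋ h *ₚ q +ₚ r × Deg< r n
      go []      = [] , [] , ≋-sym (≋-trans (+ₚ-identityʳ _) (*ₚ-zeroʳ h)) , λ _ _ → refl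
      go (b ∷ p) with go p
      ... | q , r , e , dr = (0# ∷ q) +ₚ const u , (b ∷ r) -ₚ uh , eq , deg
        where
        u = coeff (b ∷ r) n * a⁻¹
        uh = const u *ₚ h
        eq : b ∷ p ≋ h *ₚ ((0# ∷ q) +ₚ const u) +ₚ ((b ∷ r) -ₚ uh)
        eq = begin
          b ∷ p
            ≈⟨ ∷-cong (sym (+-identityˡ b)) e ⟩
          (0# ∷ (h *ₚ q)) +ₚ (b ∷ r)
            ≈⟨ +ₚ-cong (≋-trans (∷-cong refl (*ₚ-comm h q)) (≋-sym (0∷-*ₚ q h))) ≋-refl ⟩
          (0# ∷ q) *ₚ h +ₚ (b ∷ r)
            ≈⟨ +ₚ-identityʳ _ ⟨
          (0# ∷ q) *ₚ h +ₚ (b ∷ r) +ₚ []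
            ≈⟨ +ₚ-cong ≋-refl (P.-‿inverseʳ uh) ⟨
          (0# ∷ q) *ₚ h +ₚ (b ∷ r) +ₚ (uh +ₚ -ₚ uh)
            ≈⟨ S.solve 5 (λ x y z w v → x S.:* y S.:+ z S.:+ (w S.:* y S.:+ v) S.:= y S.:* (x S.:+ w) S.:+ (z S.:+ v))
                       ≋-refl (0# ∷ q) h (b ∷ r) (const u) (-ₚ uh) ⟩
          h *ₚ ((0# ∷ q) +ₚ const u) +ₚ ((b ∷ r) -ₚ uh) ∎
          where open SetoidReasoning ≋-setoid
        deg : Deg< ((b ∷ r) -ₚ uh) n
        deg i n≤i with ℕ.m≤n⇒m<n∨m≡n n≤i
        ... | inj₂ ≡.refl = begin
          coeff ((b ∷ r) -ₚ uh) n             ≈⟨ coeff-+ (b ∷ r) (-ₚ uh) n ⟩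
          coeff (b ∷ r) n + coeff (-ₚ uh) n   ≈⟨ +-congˡ (coeff-neg uh n) ⟩
          coeff (b ∷ r) n - coeff uh n        ≈⟨ +-congˡ (-‿cong (coeff-const-* u h n)) ⟩
          coeff (b ∷ r) n - u * coeff h n     ≈⟨ +-congˡ (-‿cong (*-congˡ (top l))) ⟩
          coeff (b ∷ r) n - u * a             ≈⟨ +-congˡ (-‿cong (cancel _)) ⟩
          coeff (b ∷ r) n - coeff (b ∷ r) n   ≈⟨ -‿inverseʳ _ ⟩
          0#                                  ∎
          where open SetoidReasoning setoid
        ... | inj₁ n<i = Deg<-+ {b ∷ r} { -ₚ uh} (Deg<-∷ {b} {r} dr)
          (Deg<-neg {uh} λ j n<j → trans (coeff-const-* u h j) (trans (*-congˡ (above l j n<j)) (zeroʳ u)))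
          i n<i

    record GCD (p q : Pol) : Set where
      field
        g s t a b : Pol
        bezout : s *ₚ p +ₚ t *ₚ q ≋ g
        p≋ : p ≋ g *ₚ a
        q≋ : q ≋ g *ₚ b

    -- The Euclidean algorithm made structural: `n` is only a bound. Either the coefficient just
    -- below it vanishes and the bound drops, or `q` has exactly that degree and division produces a
    -- remainder within the smaller bound.
    gcd : ∀ n p q → Deg< q n → GCD p q
    gcd zero p q dq = record
      { g = p ; s = oneₚ ; t = [] ; a = oneₚ ; b = []
      ; bezout = ≋-trans (+ₚ-identityʳ _) (*ₚ-identityˡ p)
      ; p≋ = ≋-sym (P.*-identityʳ p)
      ; q≋ = ≋-trans (Deg<0⇒≋[] dq) (≋-sym (*ₚ-zeroʳ p)) }
    gcd (suc n) p q dq with coeff q n ≈0?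
    ... | yes z = gcd n p q λ i n≤i → case-≤ i (ℕ.m≤n⇒m<n∨m≡n n≤i)
      where
      case-≤ : ∀ i → n < i ⊎ n ≡ i → coeff q i ≈ 0#
      case-≤ i (inj₁ n<i)    = dq i n<i
      case-≤ i (inj₂ ≡.refl) = z
    ... | no ne with divide {q} (coeff q n , ne , lead refl dq) p
    ... | u , r , e , dr = record
      { g = g ; s = t ; t = s -ₚ u *ₚ t ; a = a *ₚ u +ₚ b ; b = a
      ; bezout = begin
          t *ₚ p +ₚ (s -ₚ u *ₚ t) *ₚ q
            ≈⟨ +ₚ-cong (*ₚ-congˡ t e) ≋-refl ⟩
          t *ₚ (q *ₚ u +ₚ r) +ₚ (s -ₚ u *ₚ t) *ₚ q
            ≈⟨ S.solve 6 (λ t q u r s m → t S.:* (q S.:* u S.:+ r) S.:+ (s S.:+ m) S.:* q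
                         S.:= s S.:* q S.:+ t S.:* r S.:+ (u S.:* t S.:+ m) S.:* q) ≋-refl t q u r s (-ₚ (u *ₚ t)) ⟩
          s *ₚ q +ₚ t *ₚ r +ₚ (u *ₚ t -ₚ u *ₚ t) *ₚ q
            ≈⟨ +ₚ-cong ≋-refl (*ₚ-cong (P.-‿inverseʳ (u *ₚ t)) ≋-refl) ⟩
          s *ₚ q +ₚ t *ₚ r +ₚ []
            ≈⟨ +ₚ-identityʳ _ ⟩
          s *ₚ q +ₚ t *ₚ r
            ≈⟨ bezout ⟩
          g ∎
      ; p≋ = begin
          p                              ≈⟨ e ⟩
          q *ₚ u +ₚ r                    ≈⟨ +ₚ-cong (*ₚ-cong p≋ ≋-refl) q≋ ⟩
          g *ₚ a *ₚ u +ₚ g *ₚ b          ≈⟨ S.solve 4 (λ g a u b → g S.:* a S.:* u S.:+ g S.:* b S.:= g S.:* (a S.:* u S.:+ b)) ≋-refl g a u b ⟩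
          g *ₚ (a *ₚ u +ₚ b)             ∎
      ; q≋ = p≋ }
      where
      open GCD (gcd n q r dr)
      open SetoidReasoning ≋-setoid

    infix 4 _∣ₚ_
    _∣ₚ_ : Pol → Pol → Set
    p ∣ₚ q = ∃ λ s → q ≋ p *ₚ s

    Coprimeₚ : Pol → Pol → Set
    Coprimeₚ p q = ∃ λ s → ∃ λ t → s *ₚ p +ₚ t *ₚ q ≋ oneₚ

    degree0⇒unit : ∀ {p} → HasDegree p 0 → ∃ λ b → b *ₚ p ≋ oneₚ
    degree0⇒unit {p} (a , ne , l) with inverse a ne
    ... | b , e = const b , ≋-trans (*ₚ-congˡ (const b) (Deg<1⇒≋const (above l)))
      (≋-trans (const-*ₚ b _) (∷-cong (trans (*-congˡ (top l)) e) ≋-refl))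

    degree-one : HasDegree oneₚ 0
    degree-one = 1# , 0≉1 , Lead-const 1#

    NonConstant⇒¬unit : ∀ {p} → NonConstant p → ∀ s → ¬ s *ₚ p ≋ oneₚ
    NonConstant⇒¬unit {p} nc s e with NonConstant⇒degree nc | degree? s
    ... | n , dp | inj₁ z = degree≉[] degree-one (≋-trans (≋-sym e) (*ₚ-cong z ≋-refl))
    ... | n , dp | inj₂ (m , ds)
      with degree-unique (degree-resp e (degree-* ds dp)) degree-one
    ... | m+1+n≡0 = contradiction (≡.trans (≡.sym (ℕ.+-suc m n)) m+1+n≡0) λ ()

    -- With g the gcd of q and h and q = g a, irreducibility makes g or a constant. A constant g
    -- normalises to a Bézout relation; a constant a makes q an associate of g, which divides h.
    Irreducible⇒∣⊎coprime : ∀ {q} → Irreducible q → ∀ h → q ∣ₚ h ⊎ Coprimeₚ q h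
    Irreducible⇒∣⊎coprime {q} (nc , irr) h = split (degree? g) (degree? a)
      where
      open SetoidReasoning ≋-setoid
      bound : ∃ (Deg< h)
      bound with degree? h
      ... | inj₁ e = 0 , λ i _ → at e i
      ... | inj₂ (n , _ , _ , l) = suc n , above l
      open GCD (gcd (proj₁ bound) q h (proj₂ bound))
      q≉[] : ¬ q ≋ []
      q≉[] e = proj₂ (proj₂ nc) (at e (proj₁ nc))
      split : g ≋ [] ⊎ ∃ (HasDegree g) → a ≋ [] ⊎ ∃ (HasDegree a) → q ∣ₚ h ⊎ Coprimeₚ q h
      split (inj₁ z) _ = contradiction (≋-trans p≋ (*ₚ-cong z ≋-refl)) q≉[]
      split _ (inj₁ z) = contradiction (≋-trans p≋ (≋-trans (*ₚ-congˡ g z) (*ₚ-zeroʳ g))) q≉[]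
      split (inj₂ (zero , dg)) _ with degree0⇒unit dg
      ... | i , ig≋1 = inj₂ (i *ₚ s , i *ₚ t , (begin
        i *ₚ s *ₚ q +ₚ i *ₚ t *ₚ h
          ≈⟨ S.solve 5 (λ i s q t h → i S.:* s S.:* q S.:+ i S.:* t S.:* h S.:= i S.:* (s S.:* q S.:+ t S.:* h))
                     ≋-refl i s q t h ⟩
        i *ₚ (s *ₚ q +ₚ t *ₚ h)  ≈⟨ *ₚ-congˡ i bezout ⟩
        i *ₚ g                   ≈⟨ ig≋1 ⟩
        oneₚ                     ∎))
      split (inj₂ (suc _ , _ , ne , lg)) (inj₂ (suc _ , _ , ne′ , la)) = contradiction
        (Lead⇒NonConstant (s≤s z≤n) ne lg , Lead⇒NonConstant (s≤s z≤n) ne′ la)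
        (irr g a (at (≋-sym p≋)))
      split (inj₂ (suc _ , _)) (inj₂ (zero , da)) with degree0⇒unit da
      ... | i , ia≋1 = inj₁ (i *ₚ b , (begin
        h                   ≈⟨ q≋ ⟩
        g *ₚ b              ≈⟨ *ₚ-identityˡ _ ⟨
        oneₚ *ₚ (g *ₚ b)    ≈⟨ *ₚ-cong ia≋1 ≋-refl ⟨
        i *ₚ a *ₚ (g *ₚ b)
          ≈⟨ S.solve 4 (λ i a g b → i S.:* a S.:* (g S.:* b) S.:= g S.:* a S.:* (i S.:* b)) ≋-refl i a g b ⟩
        g *ₚ a *ₚ (i *ₚ b)  ≈⟨ *ₚ-cong p≋ ≋-refl ⟨
        q *ₚ (i *ₚ b)       ∎))

    -- Excludes the overlap of the two alternatives above, so that divisibility by an irreducible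
    -- polynomial becomes decidable.
    ∣⇒¬coprime : ∀ {q h} → NonConstant q → q ∣ₚ h → ¬ Coprimeₚ q h
    ∣⇒¬coprime {q} {h} nc (k , e) (s , t , f) = NonConstant⇒¬unit nc (s +ₚ t *ₚ k) (begin
      (s +ₚ t *ₚ k) *ₚ q
        ≈⟨ S.solve 4 (λ s t k q → (s S.:+ t S.:* k) S.:* q S.:= s S.:* q S.:+ t S.:* (q S.:* k)) ≋-refl s t k q ⟩
      s *ₚ q +ₚ t *ₚ (q *ₚ k)  ≈⟨ +ₚ-cong ≋-refl (*ₚ-congˡ t e) ⟨
      s *ₚ q +ₚ t *ₚ h         ≈⟨ f ⟩
      oneₚ                     ∎)
      where open SetoidReasoning ≋-setoid

    Irreducible⇒prime : ∀ {q} → Irreducible q → ∀ {x y} → q ∣ₚ x *ₚ y → q ∣ₚ x ⊎ q ∣ₚ y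
    Irreducible⇒prime {q} irr {x} {y} (k , e) with Irreducible⇒∣⊎coprime {q} irr x
    ... | inj₁ q∣x = inj₁ q∣x
    ... | inj₂ (s , t , f) = inj₂ (s *ₚ y +ₚ t *ₚ k , (begin
      y                           ≈⟨ *ₚ-identityˡ y ⟨
      oneₚ *ₚ y                   ≈⟨ *ₚ-cong f ≋-refl ⟨
      (s *ₚ q +ₚ t *ₚ x) *ₚ y
        ≈⟨ S.solve 5 (λ s q t x y → (s S.:* q S.:+ t S.:* x) S.:* y S.:= q S.:* (s S.:* y) S.:+ t S.:* (x S.:* y))
                   ≋-refl s q t x y ⟩
      q *ₚ (s *ₚ y) +ₚ t *ₚ (x *ₚ y)  ≈⟨ +ₚ-cong ≋-refl (*ₚ-congˡ t e) ⟩
      q *ₚ (s *ₚ y) +ₚ t *ₚ (q *ₚ k)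
        ≈⟨ S.solve 5 (λ s q t k y → q S.:* (s S.:* y) S.:+ t S.:* (q S.:* k) S.:= q S.:* (s S.:* y S.:+ t S.:* k))
                   ≋-refl s q t k y ⟩
      q *ₚ (s *ₚ y +ₚ t *ₚ k)     ∎))
      where open SetoidReasoning ≋-setoid

    coprime-sym : ∀ {x y} → Coprimeₚ x y → Coprimeₚ y x
    coprime-sym {x} {y} (s , t , e) = t , s , ≋-trans (+ₚ-comm (t *ₚ y) (s *ₚ x)) e

    coprime-resp : ∀ {x y h} → x ≋ y → Coprimeₚ x h → Coprimeₚ y h
    coprime-resp e (s , t , f) = s , t , ≋-trans (+ₚ-cong (*ₚ-congˡ s (≋-sym e)) ≋-refl) f

    unit⇒coprime : ∀ b x h → b *ₚ x ≋ oneₚ → Coprimeₚ x h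
    unit⇒coprime b x h e = b , [] , ≋-trans (+ₚ-identityʳ _) e

    const-coprime : ∀ {w h} → ¬ w ≈ 0# → Coprimeₚ (const w) h
    const-coprime {w} {h} ne with degree0⇒unit (w , ne , Lead-const w)
    ... | b , e = unit⇒coprime b (const w) h e

    coprime-* : ∀ {x y h} → Coprimeₚ x h → Coprimeₚ y h → Coprimeₚ (x *ₚ y) h
    coprime-* {x} {y} {h} (s , t , e) (s′ , t′ , f) =
      s *ₚ s′ , s *ₚ x *ₚ t′ +ₚ t *ₚ (s′ *ₚ y +ₚ t′ *ₚ h) , (begin
      s *ₚ s′ *ₚ (x *ₚ y) +ₚ (s *ₚ x *ₚ t′ +ₚ t *ₚ (s′ *ₚ y +ₚ t′ *ₚ h)) *ₚ h
        ≈⟨ S.solve 7 (λ s s′ x y t t′ h →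
             s S.:* s′ S.:* (x S.:* y) S.:+ (s S.:* x S.:* t′ S.:+ t S.:* (s′ S.:* y S.:+ t′ S.:* h)) S.:* h
             S.:= (s S.:* x S.:+ t S.:* h) S.:* (s′ S.:* y S.:+ t′ S.:* h)) ≋-refl s s′ x y t t′ h ⟩
      (s *ₚ x +ₚ t *ₚ h) *ₚ (s′ *ₚ y +ₚ t′ *ₚ h)  ≈⟨ *ₚ-cong e f ⟩
      oneₚ *ₚ oneₚ                                ≈⟨ *ₚ-identityˡ oneₚ ⟩
      oneₚ                                        ∎)
      where open SetoidReasoning ≋-setoid

    coprime-^ : ∀ {x h} k → Coprimeₚ x h → Coprimeₚ (x ^ₚ k) h
    coprime-^ {h = h} zero    c = unit⇒coprime oneₚ oneₚ h (*ₚ-identityˡ oneₚ)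
    coprime-^ (suc k) c = coprime-* c (coprime-^ k c)

    -- Coprimality is multiplicative, so a polynomial with no divisor among the irreducible `qs` is
    -- coprime to their product. This is how a rational factor finds its q.
    factor⊎coprime : ∀ {qs} → All Irreducible qs → ∀ h → Any (_∣ₚ h) qs ⊎ Coprimeₚ (prodₚ qs) h
    factor⊎coprime [] h = inj₂ (unit⇒coprime oneₚ oneₚ h (*ₚ-identityˡ oneₚ))
    factor⊎coprime {q ∷ _} (irr ∷ irrs) h with Irreducible⇒∣⊎coprime {q} irr h | factor⊎coprime irrs h
    ... | inj₁ q∣h | _        = inj₁ (here q∣h)
    ... | inj₂ _   | inj₁ any = inj₁ (there any)
    ... | inj₂ c   | inj₂ c′  = inj₂ (coprime-* c c′)

-- The power of a sum with a prime exponent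

prime∤! : ∀ {p} → Prime p → ∀ {k} → k < p → ¬ p ∣ k !
prime∤! {p} pp {zero}  k<p p∣1 = ℕ.<⇒≱ (ℕ.nonTrivial⇒n>1 p {{prime⇒nonTrivial pp}}) (∣⇒≤ p∣1)
prime∤! {p} pp {suc k} k<p p∣ with euclidsLemma (suc k) (k !) pp p∣
... | inj₁ p∣1+k = ℕ.<⇒≱ k<p (∣⇒≤ p∣1+k)
... | inj₂ p∣k!  = prime∤! pp (ℕ.<-trans (ℕ.n<1+n k) k<p) p∣k!

-- The prime divides p! = C(p,k) k! (p-k)! but neither of the two factorials.
prime∣C : ∀ {p} → Prime p → ∀ {k} → 0 < k → k < p → p ∣ p C k
prime∣C {p} pp {k} 0<k k<p with euclidsLemma (p C k) (k ! ℕ.* (p ℕ.∸ k) !) pp p∣C*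
  where
  instance _ = k ℕ.!* (p ℕ.∸ k) !≢0
  p∣p! : ∀ {p} → Prime p → p ∣ p !
  p∣p! {suc p} _ = m∣m*n (p !)
  p∣C* : p ∣ (p C k) ℕ.* (k ! ℕ.* (p ℕ.∸ k) !)
  p∣C* rewrite nCk≡n!/k![n-k]! (ℕ.<⇒≤ k<p) | m/n*n≡m (k![n∸k]!∣n! (ℕ.<⇒≤ k<p)) = p∣p! pp
... | inj₁ p∣C = p∣C
... | inj₂ p∣k![p-k]! with euclidsLemma (k !) ((p ℕ.∸ k) !) pp p∣k![p-k]!
...   | inj₁ p∣k!     = contradiction p∣k! (prime∤! pp k<p)
...   | inj₂ p∣[p-k]! = contradiction p∣[p-k]! (prime∤! pp (ℕ.∸-monoʳ-< 0<k (ℕ.<⇒≤ k<p)))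

module PowerOfSum (P : CommutativeRing 0ℓ 0ℓ) {e : ℕ} (prime : Prime (2 ℕ.+ e)) where
  open CommutativeRing P
  open import Algebra.Properties.Semiring.Exp semiring using (_^_; ^-congʳ; ^-congˡ)
  open import Algebra.Properties.Semiring.Mult semiring
    using (×-assoc-*; ×-assocˡ; ×-congʳ; ×-congˡ; ×-homo-1) renaming (_×_ to _·_)
  open import Algebra.Properties.Semiring.Sum semiring using (sum; *-distribˡ-sum; sum-init-last; sum-cong-≋)
  import Algebra.Properties.CommutativeSemiring.Binomial commutativeSemiring as Binomial
  import Algebra.Solver.Ring.NaturalCoefficients.Default commutativeSemiring as S
  open import Relation.Binary.Reasoning.Setoid setoid

  private
    d = 2 ℕ.+ e

  D : Carrier
  D = d · 1#

  d·≈D* : ∀ x → d · x ≈ D * x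
  d·≈D* x = sym (trans (×-assoc-* d 1# x) (×-congʳ d (*-identityˡ x)))

  private
    quotient : Fin e → ℕ
    quotient i = ℕ.quotient (prime∣C prime {2 ℕ.+ toℕ i} (s≤s z≤n) (s≤s (s≤s (Fin.toℕ<n i))))

    C≡ : ∀ i → d C (2 ℕ.+ toℕ i) ≡ d ℕ.* quotient i
    C≡ i = ≡.trans
      (_∣_.equality (prime∣C prime {2 ℕ.+ toℕ i} (s≤s z≤n) (s≤s (s≤s (Fin.toℕ<n i)))))
      (ℕ.*-comm (quotient i) d)

    middleTerm : Carrier → Carrier → Fin e → Carrier
    middleTerm y b i = quotient i · (b ^ toℕ i * y ^ (e ℕ.∸ toℕ i))

  -- M y b = ∑_{2 ≤ k < d} (C(d,k)/d) b^{k-2} y^{d-k}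
  M : Carrier → Carrier → Carrier
  M y b = sum (middleTerm y b)

  -- The difference quotient ((y + b)^d - y^d) / b.
  h : Carrier → Carrier → Carrier
  h y b = D * y ^ suc e + D * b * M y b + b ^ suc e

  -- The binomial terms of exponent 0, 1 and d in b are split off, and the others share the factor
  -- `D` b². Isolating the linear term is the point: `D` y^{d-1} is what later survives modulo 𝔭².
  ^-expand : ∀ y b → (y + b) ^ d ≈ y ^ d + b * h y b
  ^-expand y b = begin
    (y + b) ^ d                           ≈⟨ ^-congˡ d (+-comm y b) ⟩
    (b + y) ^ d                           ≈⟨ Binomial.theorem d b y ⟩
    t₀ + (t₁ + sum rest)                  ≈⟨ +-cong term₀ (+-cong term₁ (trans (sum-init-last rest) (+-cong middle term-last))) ⟩
    y ^ d + (D * (b * y ^ suc e) + (D * (b * (b * M y b)) + b * b ^ suc e))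
      ≈⟨ S.solve 6 (λ yd D b y M be →
           yd S.:+ (D S.:* (b S.:* y) S.:+ (D S.:* (b S.:* (b S.:* M)) S.:+ b S.:* be))
           S.:= yd S.:+ b S.:* (D S.:* y S.:+ D S.:* b S.:* M S.:+ be)) refl (y ^ d) D b (y ^ suc e) (M y b) (b ^ suc e) ⟩
    y ^ d + b * h y b                     ∎
    where
    t : Fin (suc d) → Carrier
    t = Binomial.binomialTerm b y d
    t₀ = t Fin.zero
    t₁ = t (Fin.suc Fin.zero)
    rest : Fin (suc e) → Carrier
    rest i = t (Fin.suc (Fin.suc i))
    term₀ : t₀ ≈ y ^ d
    term₀ = trans (×-homo-1 _) (*-identityˡ _)
    term₁ : t₁ ≈ D * (b * y ^ suc e)
    term₁ = begin
      (d C 1) · (b ^ 1 * y ^ suc e)  ≈⟨ ×-congˡ (nC1≡n d) ⟩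
      d · (b ^ 1 * y ^ suc e)        ≈⟨ d·≈D* _ ⟩
      D * (b ^ 1 * y ^ suc e)        ≈⟨ *-congˡ (*-congʳ (*-identityʳ b)) ⟩
      D * (b * y ^ suc e)            ∎
    term-last : rest (fromℕ e) ≈ b * b ^ suc e
    term-last = begin
      (d C (2 ℕ.+ toℕ (fromℕ e))) · (b ^ (2 ℕ.+ toℕ (fromℕ e)) * y ^ (e ℕ.∸ toℕ (fromℕ e)))
        ≡⟨ ≡.cong (λ z → (d C (2 ℕ.+ z)) · (b ^ (2 ℕ.+ z) * y ^ (e ℕ.∸ z))) (Fin.toℕ-fromℕ e) ⟩
      (d C d) · (b ^ d * y ^ (e ℕ.∸ e))  ≈⟨ ×-congˡ (nCn≡1 d) ⟩
      1 · (b ^ d * y ^ (e ℕ.∸ e))        ≈⟨ ×-homo-1 _ ⟩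
      b ^ d * y ^ (e ℕ.∸ e)              ≈⟨ *-congˡ (^-congʳ y (ℕ.n∸n≡0 e)) ⟩
      b ^ d * 1#                         ≈⟨ *-identityʳ _ ⟩
      b ^ d                              ∎
    term : ∀ i → rest (inject₁ i) ≈ (D * (b * b)) * middleTerm y b i
    term i = begin
      rest (inject₁ i)
        ≡⟨ ≡.cong (λ z → (d C (2 ℕ.+ z)) · (b ^ (2 ℕ.+ z) * y ^ (e ℕ.∸ z))) (Fin.toℕ-inject₁ i) ⟩
      (d C (2 ℕ.+ toℕ i)) · (b ^ (2 ℕ.+ toℕ i) * Y)  ≈⟨ ×-congˡ (C≡ i) ⟩
      (d ℕ.* quotient i) · (b ^ (2 ℕ.+ toℕ i) * Y)   ≈⟨ ×-assocˡ _ d (quotient i) ⟨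
      d · (quotient i · (b ^ (2 ℕ.+ toℕ i) * Y))     ≈⟨ d·≈D* _ ⟩
      D * (quotient i · (b ^ (2 ℕ.+ toℕ i) * Y))     ≈⟨ *-congˡ (·≈* (quotient i) _) ⟩
      D * (q * (b * (b * B) * Y))
        ≈⟨ S.solve 5 (λ D q b B Y → D S.:* (q S.:* (b S.:* (b S.:* B) S.:* Y)) S.:= (D S.:* (b S.:* b)) S.:* (q S.:* (B S.:* Y))) refl D q b B Y ⟩
      (D * (b * b)) * (q * (B * Y))                  ≈⟨ *-congˡ (·≈* (quotient i) _) ⟨
      (D * (b * b)) * (quotient i · (B * Y))         ∎
      where
      B = b ^ toℕ i
      Y = y ^ (e ℕ.∸ toℕ i)
      q = quotient i · 1#
      ·≈* : ∀ n x → n · x ≈ (n · 1#) * x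
      ·≈* n x = sym (trans (×-assoc-* n 1# x) (×-congʳ n (*-identityˡ x)))
    middle : sum (λ i → rest (inject₁ i)) ≈ D * (b * (b * M y b))
    middle = begin
      sum (λ i → rest (inject₁ i))     ≈⟨ sum-cong-≋ term ⟩
      sum (λ i → (D * (b * b)) * middleTerm y b i)  ≈⟨ *-distribˡ-sum (D * (b * b)) (middleTerm y b) ⟨
      (D * (b * b)) * M y b            ≈⟨ S.solve 3 (λ D b M → (D S.:* (b S.:* b)) S.:* M S.:= D S.:* (b S.:* (b S.:* M))) refl D b (M y b) ⟩
      D * (b * (b * M y b))            ∎

-- The orbit of 0 in a commutative ring

module Products (P : CommutativeRing 0ℓ 0ℓ) where
  open CommutativeRing P
  open import Algebra.Properties.Semiring.Exp semiring using (_^_; ^-congˡ)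
  import Algebra.Solver.Ring.NaturalCoefficients.Default commutativeSemiring as S
  open import Relation.Binary.Reasoning.Setoid setoid

  Π : (ℕ → Carrier) → List ℕ → Carrier
  Π f []       = 1#
  Π f (k ∷ ks) = f k * Π f ks

  Π-* : ∀ f g ks → Π (λ k → f k * g k) ks ≈ Π f ks * Π g ks
  Π-* f g []       = sym (*-identityˡ 1#)
  Π-* f g (k ∷ ks) = trans (*-congˡ (Π-* f g ks))
    (S.solve 4 (λ a b c d → (a S.:* b) S.:* (c S.:* d) S.:= (a S.:* c) S.:* (b S.:* d)) refl _ _ _ _)

  1^ : ∀ n → 1# ^ n ≈ 1#
  1^ zero    = refl
  1^ (suc n) = trans (*-identityˡ _) (1^ n)

  ^-distrib-* : ∀ n x y → (x * y) ^ n ≈ x ^ n * y ^ n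
  ^-distrib-* zero    x y = sym (*-identityˡ 1#)
  ^-distrib-* (suc n) x y = trans (*-congˡ (^-distrib-* n x y))
    (S.solve 4 (λ a b c d → (a S.:* b) S.:* (c S.:* d) S.:= (a S.:* c) S.:* (b S.:* d)) refl _ _ _ _)

  Π-^ : ∀ f n ks → Π (λ k → f k ^ n) ks ≈ Π f ks ^ n
  Π-^ f n []       = sym (1^ n)
  Π-^ f n (k ∷ ks) = trans (*-congˡ (Π-^ f n ks)) (sym (^-distrib-* n (f k) (Π f ks)))

  Π-extract : ∀ f ys n zs → Π f (ys ++ n ∷ zs) ≈ f n * Π f (ys ++ zs)
  Π-extract f []       n zs = refl
  Π-extract f (k ∷ ys) n zs = trans (*-congˡ (Π-extract f ys n zs))
    (S.solve 3 (λ a b c → a S.:* (b S.:* c) S.:= b S.:* (a S.:* c)) refl _ _ _)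

  -- Cancellation modulo a multiplicative congruence; used for ≈ itself and for ≈ modulo D.
  module Cancellation (_~_ : Rel Carrier 0ℓ) (isEquivalence~ : IsEquivalence _~_)
                      (≈⇒~ : ∀ {x y} → x ≈ y → x ~ y)
                      (*-cong~ : ∀ {x y u v} → x ~ y → u ~ v → (x * u) ~ (y * v)) where
    open IsEquivalence isEquivalence~ renaming (refl to ~-refl; sym to ~-sym; trans to ~-trans)

    ^-cong~ : ∀ {x y} n → x ~ y → (x ^ n) ~ (y ^ n)
    ^-cong~ zero    e = ~-refl
    ^-cong~ (suc n) e = *-cong~ e (^-cong~ n e)

    Π-cong~ : ∀ {f g} → (∀ k → f k ~ g k) → ∀ ks → Π f ks ~ Π g ks
    Π-cong~ e []       = ~-refl
    Π-cong~ e (k ∷ ks) = *-cong~ (e k) (Π-cong~ e ks)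

    Π-congᴬ~ : ∀ {f g ks} → All (λ k → f k ~ g k) ks → Π f ks ~ Π g ks
    Π-congᴬ~ []       = ~-refl
    Π-congᴬ~ (e ∷ es) = *-cong~ e (Π-congᴬ~ es)

    Cancel : Carrier → Set
    Cancel x = ∀ {y z} → (x * y) ~ (x * z) → y ~ z

    cancel-resp : ∀ {x y} → x ~ y → Cancel x → Cancel y
    cancel-resp e c f = c (~-trans (*-cong~ e ~-refl) (~-trans f (*-cong~ (~-sym e) ~-refl)))

    cancel-1 : Cancel 1#
    cancel-1 f = ~-trans (≈⇒~ (sym (*-identityˡ _))) (~-trans f (≈⇒~ (*-identityˡ _)))

    cancel-* : ∀ {x y} → Cancel x → Cancel y → Cancel (x * y)
    cancel-* c c′ f = c′ (c (~-trans (≈⇒~ (sym (*-assoc _ _ _))) (~-trans f (≈⇒~ (*-assoc _ _ _)))))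

    -- Serves G_{d,0,n}, which is known only through its product with other orbit elements.
    cancel-factor : ∀ {x y} → Cancel (x * y) → Cancel x
    cancel-factor {x} {y} c f = c (~-trans (≈⇒~ (comm _)) (~-trans (*-cong~ ~-refl f) (≈⇒~ (sym (comm _)))))
      where
      comm : ∀ z → x * y * z ≈ y * (x * z)
      comm z = S.solve 3 (λ x y z → x S.:* y S.:* z S.:= y S.:* (x S.:* z)) refl x y z

    cancel-^ : ∀ {x} n → Cancel x → Cancel (x ^ n)
    cancel-^ zero    c = cancel-1
    cancel-^ (suc n) c = cancel-* c (cancel-^ n c)

    cancel-Π : ∀ {f ks} → All (λ k → Cancel (f k)) ks → Cancel (Π f ks)
    cancel-Π []       = cancel-1
    cancel-Π (c ∷ cs) = cancel-* c (cancel-Π cs)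

module Orbit (P : CommutativeRing 0ℓ 0ℓ) {e : ℕ} (prime : Prime (2 ℕ.+ e))
             (c : CommutativeRing.Carrier P) where
  open CommutativeRing P
  open import Algebra.Properties.Semiring.Exp semiring using (_^_; ^-congˡ; ^-congʳ; ^-homo-*; ^-assocʳ)
  import Algebra.Solver.Ring.NaturalCoefficients.Default commutativeSemiring as S
  import Algebra.Properties.Ring ring as Ring
  open import Relation.Binary.Reasoning.Setoid setoid
  open PowerOfSum P prime public
  open Products P public
  private
    d = 2 ℕ.+ e

  a : ℕ → Carrier
  a zero    = 0#
  a (suc k) = a k ^ d + c

  -- ε k j = a (j + k) - a j
  ε : ℕ → ℕ → Carrier
  ε k zero    = a k
  ε k (suc j) = ε k j * h (a j) (ε k j)

  -- The ratio A_k / B_k in F_{d,m,n} for m = `j` + 1. Since `ε` is built by multiplying with it,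
  -- the divisibility of A_k by B_k holds by definition.
  Q : ℕ → ℕ → Carrier
  Q j k = h (a j) (ε k j)

  a-shift : ∀ k j → a (j ℕ.+ k) ≈ a j + ε k j
  a-shift k zero    = sym (+-identityˡ _)
  a-shift k (suc j) = begin
    a (j ℕ.+ k) ^ d + c                ≈⟨ +-congʳ (^-congˡ d (a-shift k j)) ⟩
    (a j + ε k j) ^ d + c              ≈⟨ +-congʳ (^-expand (a j) (ε k j)) ⟩
    a j ^ d + ε k j * Q j k + c        ≈⟨ S.solve 3 (λ x y z → x S.:+ y S.:+ z S.:= x S.:+ z S.:+ y) refl _ _ _ ⟩
    a j ^ d + c + ε k j * Q j k        ∎

  infix 4 _≡ᴰ_
  record _≡ᴰ_ (x y : Carrier) : Set where
    constructor mod
    field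
      quot : Carrier
      eq   : x ≈ y + D * quot

  ≈⇒≡ᴰ : ∀ {x y} → x ≈ y → x ≡ᴰ y
  ≈⇒≡ᴰ e = mod 0# (trans e (sym (trans (+-congˡ (zeroʳ D)) (+-identityʳ _))))

  ≡ᴰ-isEquivalence : IsEquivalence _≡ᴰ_
  ≡ᴰ-isEquivalence = record
    { refl  = ≈⇒≡ᴰ refl
    ; sym   = λ { {x} {y} (mod z e) → mod (- z) (begin
        y                          ≈⟨ +-identityʳ y ⟨
        y + 0#                     ≈⟨ +-congˡ (zeroʳ D) ⟨
        y + D * 0#                 ≈⟨ +-congˡ (*-congˡ (-‿inverseʳ z)) ⟨
        y + D * (z - z)            ≈⟨ S.solve 4 (λ y D z w → y S.:+ D S.:* (z S.:+ w) S.:= y S.:+ D S.:* z S.:+ D S.:* w) refl y D z (- z) ⟩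
        y + D * z + D * - z        ≈⟨ +-congʳ e ⟨
        x + D * - z                ∎) }
    ; trans = λ { {x} {y} {w} (mod z e) (mod z′ e′) → mod (z + z′) (begin
        x                          ≈⟨ e ⟩
        y + D * z                  ≈⟨ +-congʳ e′ ⟩
        w + D * z′ + D * z         ≈⟨ S.solve 4 (λ w D z z′ → w S.:+ D S.:* z′ S.:+ D S.:* z S.:= w S.:+ D S.:* (z S.:+ z′)) refl w D z z′ ⟩
        w + D * (z + z′)           ∎) } }

  *-cong≡ᴰ : ∀ {x y u v} → x ≡ᴰ y → u ≡ᴰ v → x * u ≡ᴰ y * v
  *-cong≡ᴰ {x} {y} {u} {v} (mod z f) (mod w g) = mod (y * w + z * v + D * z * w) (begin
    x * u                      ≈⟨ *-cong f g ⟩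
    (y + D * z) * (v + D * w)
      ≈⟨ S.solve 5 (λ y D z v w → (y S.:+ D S.:* z) S.:* (v S.:+ D S.:* w)
           S.:= y S.:* v S.:+ D S.:* (y S.:* w S.:+ z S.:* v S.:+ D S.:* z S.:* w)) refl y D z v w ⟩
    y * v + D * (y * w + z * v + D * z * w) ∎)

  module D = Cancellation _≡ᴰ_ ≡ᴰ-isEquivalence ≈⇒≡ᴰ *-cong≡ᴰ
  module E = Cancellation _≈_ isEquivalence (λ e → e) *-cong
  open IsEquivalence ≡ᴰ-isEquivalence public using () renaming (refl to ≡ᴰ-refl; sym to ≡ᴰ-sym; trans to ≡ᴰ-trans)

  h-modD : ∀ y b → h y b ≡ᴰ b ^ suc e
  h-modD y b = mod (y ^ suc e + b * M y b)
    (S.solve 5 (λ D y b M be → D S.:* y S.:+ D S.:* b S.:* M S.:+ be S.:= be S.:+ D S.:* (y S.:+ b S.:* M))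
      refl D (y ^ suc e) b (M y b) (b ^ suc e))

  -- Each step multiplies `ε` by `h`, which is the power d - 1 of `ε` modulo `D`; so a step is a
  -- d-th power.
  ε-modD : ∀ k j → ε k j ≡ᴰ a k ^ (d ℕ.^ j)
  ε-modD k zero    = ≈⇒≡ᴰ (sym (*-identityʳ _))
  ε-modD k (suc j) = ≡ᴰ-trans (*-cong≡ᴰ ≡ᴰ-refl (h-modD (a j) (ε k j)))
    (≡ᴰ-trans (D.^-cong~ d (ε-modD k j))
      (≈⇒≡ᴰ (trans (^-assocʳ (a k) (d ℕ.^ j) d) (^-congʳ (a k) (ℕ.*-comm (d ℕ.^ j) d)))))

  Q-modD : ∀ j k → Q j k ≡ᴰ a k ^ (d ℕ.^ j ℕ.* suc e)
  Q-modD j k = ≡ᴰ-trans (h-modD (a j) (ε k j))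
    (≡ᴰ-trans (D.^-cong~ (suc e) (ε-modD k j)) (≈⇒≡ᴰ (^-assocʳ (a k) (d ℕ.^ j) (suc e))))

  +-cancel : ∀ {x y z} → x + y ≈ x + z → y ≈ z
  +-cancel {x} {y} {z} = Ring.+-cancelˡ x y z

  0^ : ∀ n → 0# ^ suc n ≈ 0#
  0^ n = zeroˡ _

  ε1≈ : ∀ k → ε k 1 ≈ a k ^ d
  ε1≈ k = +-cancel {0# ^ d} (trans (sym (^-expand 0# (a k))) (trans (^-congˡ d (+-identityˡ _))
            (sym (trans (+-congʳ (0^ (suc e))) (+-identityˡ _)))))

  -- An exact equality, not just one modulo `D`: because a_0 = 0, the ratios in F_{d,1,n} are pure
  -- powers a_k^{d-1}.
  Q0≈ : ∀ k → E.Cancel (a k) → Q 0 k ≈ a k ^ suc e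
  Q0≈ k c = c (ε1≈ k)

  ≈+[-] : ∀ y z → y ≈ z + (y - z)
  ≈+[-] y z = begin
    y              ≈⟨ +-identityʳ y ⟨
    y + 0#         ≈⟨ +-congˡ (-‿inverseʳ z) ⟨
    y + (z - z)    ≈⟨ S.solve 3 (λ p q r → p S.:+ (q S.:+ r) S.:= q S.:+ (p S.:+ r)) refl y z (- z) ⟩
    z + (y - z)    ∎

  *-difference : ∀ {x y z w} → x * y ≈ x * z + w → x * (y - z) ≈ w
  *-difference {x} {y} {z} {w} eq = begin
    x * (y - z)            ≈⟨ distribˡ x y (- z) ⟩
    x * y + x * - z        ≈⟨ +-congʳ eq ⟩
    x * z + w + x * - z    ≈⟨ S.solve 4 (λ x z w m → x S.:* z S.:+ w S.:+ x S.:* m S.:= w S.:+ x S.:* (z S.:+ m)) refl x z w (- z) ⟩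
    w + x * (z - z)        ≈⟨ +-congˡ (trans (*-congˡ (-‿inverseʳ z)) (zeroʳ x)) ⟩
    w + 0#                 ≈⟨ +-identityʳ w ⟩
    w                      ∎

  +-difference : ∀ {x y w} → x ≈ y + w → x - y ≈ w
  +-difference {x} {y} {w} eq = begin
    x - y          ≈⟨ +-congʳ eq ⟩
    y + w - y      ≈⟨ S.solve 3 (λ y w m → y S.:+ w S.:+ m S.:= w S.:+ (y S.:+ m)) refl y w (- y) ⟩
    w + (y - y)    ≈⟨ +-congˡ (-‿inverseʳ y) ⟩
    w + 0#         ≈⟨ +-identityʳ w ⟩
    w              ∎

  -- The elements of the square of the ideal (q, D).
  module Square (q : Carrier) where
    quadratic : Carrier → Carrier → Carrier → Carrier
    quadratic α β γ = q * q * α + q * D * β + D * D * γ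

    private
      form : ∀ {n} (q D α β γ : S.Polynomial n) → S.Polynomial n
      form q D α β γ = q S.:* q S.:* α S.:+ q S.:* D S.:* β S.:+ D S.:* D S.:* γ

    quadratic-+ : ∀ α β γ α′ β′ γ′ →
      quadratic α β γ + quadratic α′ β′ γ′ ≈ quadratic (α + α′) (β + β′) (γ + γ′)
    quadratic-+ = S.solve 8 (λ q D α β γ α′ β′ γ′ →
      form q D α β γ S.:+ form q D α′ β′ γ′ S.:= form q D (α S.:+ α′) (β S.:+ β′) (γ S.:+ γ′)) refl q D

    quadratic-* : ∀ α β γ y → quadratic α β γ * y ≈ quadratic (α * y) (β * y) (γ * y)
    quadratic-* = S.solve 6 (λ q D α β γ y →
      form q D α β γ S.:* y S.:= form q D (α S.:* y) (β S.:* y) (γ S.:* y)) refl q D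

    linear*linear : ∀ s t u v → (q * s + D * u) * (q * t + D * v) ≈ quadratic (s * t) (s * v + u * t) (u * v)
    linear*linear = S.solve 6 (λ q D s t u v →
      (q S.:* s S.:+ D S.:* u) S.:* (q S.:* t S.:+ D S.:* v)
      S.:= form q D (s S.:* t) (s S.:* v S.:+ u S.:* t) (u S.:* v)) refl q D

    quadratic-modD : ∀ α β γ → quadratic α β γ ≈ q * q * α + D * (q * β + D * γ)
    quadratic-modD = S.solve 5 (λ q D α β γ →
      form q D α β γ S.:= q S.:* q S.:* α S.:+ D S.:* (q S.:* β S.:+ D S.:* γ)) refl q D

    quadratic-D* : ∀ α β γ → quadratic (D * α) β γ ≈ D * (q * (q * α + β) + D * γ)
    quadratic-D* = S.solve 5 (λ q D α β γ →
      form q D (D S.:* α) β γ S.:= D S.:* (q S.:* (q S.:* α S.:+ β) S.:+ D S.:* γ)) refl q D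

  -- G_{d,m,n} as a product of the ratios Q_k, and its reduction modulo d

  module Quotients
    (ε-cancel : ∀ j {k} → 1 ≤ k → E.Cancel (ε k j))
    (a-cancelD : ∀ {k} → 1 ≤ k → D.Cancel (a k))
    {L⁺ L⁻ : List ℕ} (pos⁺ : All (1 ≤_) L⁺) (pos⁻ : All (1 ≤_) L⁻)
    {G₀ : Carrier} (G₀-eq : G₀ * Π a L⁻ ≈ Π a L⁺) where

    num den : ℕ → Carrier
    num j = Π (λ k → ε k (suc j)) L⁺ * Π (λ k → ε k j) L⁻
    den j = Π (λ k → ε k j) L⁺ * Π (λ k → ε k (suc j)) L⁻

    private
      -- The common factor of `num` and `den`; removing it leaves products of `Q` alone.
      β : ℕ → Carrier
      β j = Π (λ k → ε k j) L⁺ * Π (λ k → ε k j) L⁻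

      β-cancel : ∀ j → E.Cancel (β j)
      β-cancel j = E.cancel-* (E.cancel-Π (All.map (ε-cancel j) pos⁺)) (E.cancel-Π (All.map (ε-cancel j) pos⁻))

      num≈ : ∀ j → num j ≈ β j * Π (Q j) L⁺
      num≈ j = trans (*-congʳ (Π-* (λ k → ε k j) (Q j) L⁺))
        (S.solve 3 (λ x y z → x S.:* y S.:* z S.:= x S.:* z S.:* y) refl _ _ _)

      den≈ : ∀ j → den j ≈ β j * Π (Q j) L⁻
      den≈ j = trans (*-congˡ (Π-* (λ k → ε k j) (Q j) L⁻)) (sym (*-assoc _ _ _))

      Π-Q0 : ∀ {L} → All (1 ≤_) L → Π (Q 0) L ≈ Π (λ k → a k ^ suc e) L
      Π-Q0 pos = E.Π-congᴬ~ (All.map (λ {k} 1≤k → Q0≈ k (ε-cancel 0 1≤k)) pos)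

    cancel-ε : ∀ {G} j → G * den j ≈ num j → G * Π (Q j) L⁻ ≈ Π (Q j) L⁺
    cancel-ε {G} j eq = β-cancel j (begin
      β j * (G * Π (Q j) L⁻)  ≈⟨ S.solve 3 (λ x y z → x S.:* (y S.:* z) S.:= y S.:* (x S.:* z)) refl _ _ _ ⟩
      G * (β j * Π (Q j) L⁻)  ≈⟨ *-congˡ (den≈ j) ⟨
      G * den j               ≈⟨ eq ⟩
      num j                   ≈⟨ num≈ j ⟩
      β j * Π (Q j) L⁺        ∎)

    -- The case in which F_{d,1,n} is divided out. Its ratios enter as a_k^{d-1}, with the roles of
    -- `L⁺` and `L⁻` exchanged.
    cancel-ε² : ∀ {G} j → G * den j * num 0 ≈ num j * den 0 →
      G * Π (Q j) L⁻ * Π (λ k → a k ^ suc e) L⁺ ≈ Π (Q j) L⁺ * Π (λ k → a k ^ suc e) L⁻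
    cancel-ε² {G} j eq = E.cancel-* (β-cancel j) (β-cancel 0) (begin
      β j * β 0 * (G * R⁻ * S⁺)
        ≈⟨ S.solve 5 (λ b b′ G R S → b S.:* b′ S.:* (G S.:* R S.:* S) S.:= G S.:* (b S.:* R) S.:* (b′ S.:* S)) refl _ _ _ _ _ ⟩
      G * (β j * R⁻) * (β 0 * S⁺)             ≈⟨ *-congˡ (*-congˡ (Π-Q0 pos⁺)) ⟨
      G * (β j * R⁻) * (β 0 * Π (Q 0) L⁺)     ≈⟨ *-cong (*-congˡ (den≈ j)) (num≈ 0) ⟨
      G * den j * num 0                       ≈⟨ eq ⟩
      num j * den 0                           ≈⟨ *-cong (num≈ j) (den≈ 0) ⟩
      (β j * R⁺) * (β 0 * Π (Q 0) L⁻)         ≈⟨ *-congˡ (*-congˡ (Π-Q0 pos⁻)) ⟩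
      (β j * R⁺) * (β 0 * S⁻)
        ≈⟨ S.solve 4 (λ b b′ R S → (b S.:* R) S.:* (b′ S.:* S) S.:= b S.:* b′ S.:* (R S.:* S)) refl _ _ _ _ ⟩
      β j * β 0 * (R⁺ * S⁻)                   ∎)
      where
      R⁺ = Π (Q j) L⁺
      R⁻ = Π (Q j) L⁻
      S⁺ = Π (λ k → a k ^ suc e) L⁺
      S⁻ = Π (λ k → a k ^ suc e) L⁻

    private
      α⁻ = Π a L⁻

      α⁻-cancel : D.Cancel α⁻
      α⁻-cancel = D.cancel-Π (All.map a-cancelD pos⁻)

      G₀-cancel : D.Cancel G₀
      G₀-cancel = D.cancel-factor (D.cancel-resp (≈⇒≡ᴰ (sym G₀-eq)) (D.cancel-Π (All.map a-cancelD pos⁺)))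

      Π-Q≡ : ∀ j L → Π (Q j) L ≡ᴰ Π a L ^ (d ℕ.^ j ℕ.* suc e)
      Π-Q≡ j L = ≡ᴰ-trans (D.Π-cong~ (Q-modD j) L) (≈⇒≡ᴰ (Π-^ a (d ℕ.^ j ℕ.* suc e) L))

      α⁺^ : ∀ n → Π a L⁺ ^ n ≈ G₀ ^ n * α⁻ ^ n
      α⁺^ n = trans (^-congˡ n (sym G₀-eq)) (^-distrib-* n G₀ α⁻)

    -- Modulo `D` every `Q j k` is the same power of a_k, so the Möbius product turns into that
    -- power of G_{d,0,n}. The exponent d^j (d-1) is recorded as a successor because its positivity
    -- later makes G nonconstant.
    G≡G₀^ : ∀ {G} j → G * Π (Q j) L⁻ ≈ Π (Q j) L⁺ → ∃ λ f → G ≡ᴰ G₀ ^ suc f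
    G≡G₀^ {G} j eq = exponent (d ℕ.^ j) (ℕ.m^n>0 d j) (D.cancel-^ N α⁻-cancel (≡ᴰ-trans
      (≈⇒≡ᴰ (*-comm _ _)) (≡ᴰ-trans
      (*-cong≡ᴰ ≡ᴰ-refl (≡ᴰ-sym (Π-Q≡ j L⁻))) (≡ᴰ-trans
      (≈⇒≡ᴰ eq) (≡ᴰ-trans
      (Π-Q≡ j L⁺)
      (≈⇒≡ᴰ (trans (α⁺^ N) (*-comm _ _))))))))
      where
      N = d ℕ.^ j ℕ.* suc e
      exponent : ∀ x → 1 ≤ x → G ≡ᴰ G₀ ^ (x ℕ.* suc e) → ∃ λ f → G ≡ᴰ G₀ ^ suc f
      exponent (suc x) _ r = e ℕ.+ x ℕ.* suc e , r

    -- Dividing by F_{d,1,n}, which is the power d - 1 of G_{d,0,n}, lowers the exponent to (d^j -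
    -- 1)(d - 1). It stays positive because j ≥ 1 gives d^j ≥ 2.
    G≡G₀^′ : ∀ {G} i → let j = suc i in
      G * Π (Q j) L⁻ * Π (λ k → a k ^ suc e) L⁺ ≈ Π (Q j) L⁺ * Π (λ k → a k ^ suc e) L⁻ →
      ∃ λ f → G ≡ᴰ G₀ ^ suc f
    G≡G₀^′ {G} i eq = exponent (d ℕ.^ j) (ℕ.*-mono-≤ {2} {d} (s≤s (s≤s z≤n)) (ℕ.m^n>0 d i))
      (D.cancel-* (D.cancel-^ N α⁻-cancel) (D.cancel-^ (suc e) α⁻-cancel) (≡ᴰ-trans
      (≈⇒≡ᴰ (S.solve 4 (λ x y G z → x S.:* y S.:* (G S.:* z) S.:= G S.:* x S.:* (z S.:* y)) refl _ _ _ _)) (≡ᴰ-trans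
      (*-cong≡ᴰ (*-cong≡ᴰ ≡ᴰ-refl (≡ᴰ-sym (Π-Q≡ j L⁻)))
                (≈⇒≡ᴰ (trans (sym (α⁺^ (suc e))) (sym (Π-^ a (suc e) L⁺))))) (≡ᴰ-trans
      (≈⇒≡ᴰ eq) (≡ᴰ-trans
      (*-cong≡ᴰ (≡ᴰ-trans (Π-Q≡ j L⁺) (≈⇒≡ᴰ (α⁺^ N))) (≈⇒≡ᴰ (Π-^ a (suc e) L⁻)))
      (≈⇒≡ᴰ (S.solve 3 (λ x y z → z S.:* x S.:* y S.:= x S.:* y S.:* z) refl _ _ _)))))))
      where
      j = suc i
      N = d ℕ.^ j ℕ.* suc e
      exponent : ∀ x → 2 ≤ x → G * G₀ ^ suc e ≡ᴰ G₀ ^ (x ℕ.* suc e) → ∃ λ f → G ≡ᴰ G₀ ^ suc f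
      exponent (suc zero) (s≤s ()) _
      exponent (suc (suc x)) _ r = e ℕ.+ x ℕ.* suc e , D.cancel-^ (suc e) G₀-cancel
        (≡ᴰ-trans (≈⇒≡ᴰ (*-comm _ _)) (≡ᴰ-trans r (≈⇒≡ᴰ (^-homo-* G₀ (suc e) (suc x ℕ.* suc e)))))

  -- In the application 𝔭 is the prime (q, D) of ℤ[c] and 𝔮 its square.
  record PrimeWithSquare : Set₁ where
    field
      𝔭 𝔮 : Carrier → Set
      𝔭-resp   : ∀ {x y} → x ≈ y → 𝔭 x → 𝔭 y
      𝔭-+      : ∀ {x y} → 𝔭 x → 𝔭 y → 𝔭 (x + y)
      𝔭-*      : ∀ {x} y → 𝔭 x → 𝔭 (x * y)
      𝔭-prime  : ∀ {x y} → 𝔭 (x * y) → 𝔭 x ⊎ 𝔭 y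
      𝔭-proper : ¬ 𝔭 1#
      𝔭?       : ∀ x → Dec (𝔭 x)
      𝔭-D      : 𝔭 D
      𝔮-resp   : ∀ {x y} → x ≈ y → 𝔮 x → 𝔮 y
      𝔮-+      : ∀ {x y} → 𝔮 x → 𝔮 y → 𝔮 (x + y)
      𝔮-*      : ∀ {x} y → 𝔮 x → 𝔮 (x * y)
      𝔭𝔭⇒𝔮    : ∀ {x y} → 𝔭 x → 𝔭 y → 𝔮 (x * y)
      𝔮⇒𝔭     : ∀ {x} → 𝔮 x → 𝔭 x
      -- `D` has order exactly one at 𝔭. Taking 𝔭 itself for 𝔮 would satisfy all the other laws;
      -- this one carries the Eisenstein argument.
      𝔮-D*     : ∀ {x} → 𝔮 (D * x) → 𝔭 x

  -- The orbit of 0 modulo 𝔭 and 𝔭²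

  module AtPrime (prm : PrimeWithSquare) where
    open PrimeWithSquare prm

    private
      cancel-+ : ∀ {x y} → x ≈ x + y + y * (- 1#)
      cancel-+ {x} {y} = begin
        x                      ≈⟨ +-identityʳ x ⟨
        x + 0#                 ≈⟨ +-congˡ (zeroʳ y) ⟨
        x + y * 0#             ≈⟨ +-congˡ (*-congˡ (-‿inverseʳ 1#)) ⟨
        x + y * (1# - 1#)      ≈⟨ S.solve 3 (λ x y m → x S.:+ y S.:* (S.con 1 S.:+ m) S.:= x S.:+ y S.:+ y S.:* m) refl x y (- 1#) ⟩
        x + y + y * (- 1#)     ∎

    𝔭-∸ : ∀ {x y} → 𝔭 (x + y) → 𝔭 y → 𝔭 x
    𝔭-∸ h k = 𝔭-resp (sym cancel-+) (𝔭-+ h (𝔭-* (- 1#) k))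

    𝔮-∸ : ∀ {x y} → 𝔮 (x + y) → 𝔮 y → 𝔮 x
    𝔮-∸ h k = 𝔮-resp (sym cancel-+) (𝔮-+ h (𝔮-* (- 1#) k))

    𝔭-≡ᴰ : ∀ {x y} → x ≡ᴰ y → 𝔭 x → 𝔭 y
    𝔭-≡ᴰ (mod z eq) k = 𝔭-∸ (𝔭-resp eq k) (𝔭-* z 𝔭-D)

    𝔭-^⁻ : ∀ {x} n → 𝔭 (x ^ n) → 𝔭 x
    𝔭-^⁻ zero    k = contradiction k 𝔭-proper
    𝔭-^⁻ (suc n) k with 𝔭-prime k
    ... | inj₁ l = l
    ... | inj₂ l = 𝔭-^⁻ n l

    𝔭-Π⁻ : ∀ {f} ks → 𝔭 (Π f ks) → Any (λ k → 𝔭 (f k)) ks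
    𝔭-Π⁻ []       k = contradiction k 𝔭-proper
    𝔭-Π⁻ (_ ∷ ks) k with 𝔭-prime k
    ... | inj₁ l = here l
    ... | inj₂ l = there (𝔭-Π⁻ ks l)

    ∉-* : ∀ {x y} → ¬ 𝔭 x → ¬ 𝔭 y → ¬ 𝔭 (x * y)
    ∉-* ¬x ¬y k with 𝔭-prime k
    ... | inj₁ l = ¬x l
    ... | inj₂ l = ¬y l

    ∉-Π : ∀ {f ks} → All (λ k → ¬ 𝔭 (f k)) ks → ¬ 𝔭 (Π f ks)
    ∉-Π []       = 𝔭-proper
    ∉-Π (¬x ∷ ¬xs) = ∉-* ¬x (∉-Π ¬xs)

    ∉-Q : ∀ j {k} → ¬ 𝔭 (a k) → ¬ 𝔭 (Q j k)
    ∉-Q j {k} ¬x l = ¬x (𝔭-^⁻ (d ℕ.^ j ℕ.* suc e) (𝔭-≡ᴰ (Q-modD j k) l))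

    𝔭-h : ∀ y {b} → 𝔭 b → 𝔭 (h y b)
    𝔭-h y {b} k = 𝔭-≡ᴰ (≡ᴰ-sym (h-modD y b)) (𝔭-* (b ^ e) k)

    𝔭-ε : ∀ {k} j → 𝔭 (a k) → 𝔭 (ε k j)
    𝔭-ε zero    l = l
    𝔭-ε (suc j) l = 𝔭-* _ (𝔭-ε j l)

    -- The middle summand of `h` contains both `D` and `b`, two elements of 𝔭; the last summand is
    -- covered by hypothesis.
    h≈D+𝔮 : ∀ y {b} → 𝔭 b → 𝔮 (b ^ suc e) → ∃ λ z → 𝔮 z × h y b ≈ D * y ^ suc e + z
    h≈D+𝔮 y {b} k l = D * b * M y b + b ^ suc e , 𝔮-+ (𝔮-* (M y b) (𝔭𝔭⇒𝔮 𝔭-D k)) l , +-assoc _ _ _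

    -- The cofactor b is the product of `Q 0 k` up to `Q j k`, all of them in 𝔭. As soon as j ≥ 1
    -- there are at least two, which puts b into 𝔮.
    ε/a : ∀ {k} j → 𝔭 (a k) → ∃ λ b → ε k (suc j) ≈ a k * b × 𝔭 b × (1 ≤ j → 𝔮 b)
    ε/a {k} zero    l = Q 0 k , refl , 𝔭-h 0# l , λ ()
    ε/a {k} (suc j) l with ε/a j l
    ... | b , eq , 𝔭b , _ = b * Q (suc j) k , trans (*-congʳ eq) (*-assoc _ _ _) , 𝔭-* _ 𝔭b
                          , λ _ → 𝔭𝔭⇒𝔮 𝔭b (𝔭-h (a (suc j)) (𝔭-ε (suc j) l))

    -- Rigid divisibility. Raising the index by r adds `ε r m`, which is a_r times an element of 𝔭
    -- when m ≥ 1, so the quotient by a_r stays congruent to 1 modulo 𝔭.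
    a-multiple : ∀ {r} → 1 ≤ r → 𝔭 (a r) → ∀ q → ∃ λ t → a (suc q ℕ.* r) ≈ a r * t × ¬ 𝔭 t
    a-multiple {r} 1≤r l q with go q
      where
      go : ∀ q → ∃ λ u → a (suc q ℕ.* r) ≈ a r * (1# + u) × 𝔭 u
      go zero = 0# , trans (reflexive (≡.cong a (ℕ.+-identityʳ r)))
                       (sym (trans (*-congˡ (+-identityʳ 1#)) (*-identityʳ _)))
                   , 𝔭-resp (zeroʳ D) (𝔭-* 0# 𝔭-D)
      go (suc q) with go q
      ... | u , f , 𝔭u = step (suc q ℕ.* r) (ℕ.*-mono-≤ {1} {suc q} (s≤s z≤n) 1≤r) f
        where
        step : ∀ m → 1 ≤ m → a m ≈ a r * (1# + u) → ∃ λ u → a (r ℕ.+ m) ≈ a r * (1# + u) × 𝔭 u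
        step (suc j) _ f with ε/a j l
        ... | b , g , 𝔭b , _ = u + b , (begin
          a (r ℕ.+ suc j)             ≡⟨ ≡.cong a (ℕ.+-comm r (suc j)) ⟩
          a (suc j ℕ.+ r)             ≈⟨ a-shift r (suc j) ⟩
          a (suc j) + ε r (suc j)     ≈⟨ +-cong f g ⟩
          a r * (1# + u) + a r * b    ≈⟨ S.solve 3 (λ x u b → x S.:* (S.con 1 S.:+ u) S.:+ x S.:* b S.:= x S.:* (S.con 1 S.:+ (u S.:+ b))) refl (a r) u b ⟩
          a r * (1# + (u + b))        ∎) , 𝔭-+ 𝔭u 𝔭b
    ... | u , f , 𝔭u = 1# + u , f , λ k → 𝔭-proper (𝔭-∸ k 𝔭u)

    -- Modulo 𝔭 the orbit repeats after r steps, since a shift by r changes a value by some `ε r`, a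
    -- multiple of a_r.
    a-residue : ∀ {r} → 𝔭 (a r) → ∀ i q → 𝔭 (a (i ℕ.+ q ℕ.* r)) → 𝔭 (a i)
    a-residue {r} l i zero    k = ≡.subst (𝔭 ∘ a) (ℕ.+-identityʳ i) k
    a-residue {r} l i (suc q) k = a-residue l i q
      (𝔭-∸ (𝔭-resp (a-shift r (i ℕ.+ q ℕ.* r)) (≡.subst (𝔭 ∘ a) lem k)) (𝔭-ε (i ℕ.+ q ℕ.* r) l))
      where
      lem : i ℕ.+ (r ℕ.+ q ℕ.* r) ≡ i ℕ.+ q ℕ.* r ℕ.+ r
      lem = ≡.trans (≡.cong (i ℕ.+_) (ℕ.+-comm r (q ℕ.* r))) (≡.sym (ℕ.+-assoc i (q ℕ.* r) r))

    IsPeriod : ℕ → Set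
    IsPeriod r = 1 ≤ r × 𝔭 (a r) × (∀ j → 𝔭 (a j) → r ∣ j)

    -- For the least positive r with a_r in 𝔭, a nonzero remainder modulo r of another such index
    -- would be a smaller one.
    period : ∀ {n} → 1 ≤ n → 𝔭 (a n) → ∃ IsPeriod
    period {n} 1≤n l with search n
      where
      search : ∀ m → (∃ λ r → 1 ≤ r × 𝔭 (a r) × (∀ s → 1 ≤ s → s < r → ¬ 𝔭 (a s)))
                   ⊎ (∀ s → 1 ≤ s → s ≤ m → ¬ 𝔭 (a s))
      search zero    = inj₂ λ { (suc s) _ () }
      search (suc m) with search m
      ... | inj₁ found = inj₁ found
      ... | inj₂ none with 𝔭? (a (suc m))
      ...   | yes k = inj₁ (suc m , s≤s z≤n , k , λ { s 1≤s (s≤s s≤m) → none s 1≤s s≤m })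
      ...   | no ¬k = inj₂ λ s 1≤s s≤1+m → last s 1≤s (ℕ.m≤n⇒m<n∨m≡n s≤1+m)
        where
        last : ∀ s → 1 ≤ s → s < suc m ⊎ s ≡ suc m → ¬ 𝔭 (a s)
        last s 1≤s (inj₁ (s≤s s≤m)) = none s 1≤s s≤m
        last s 1≤s (inj₂ ≡.refl)    = ¬k
    ... | inj₂ none = contradiction l (none n 1≤n ℕ.≤-refl)
    ... | inj₁ (r@(suc _) , 1≤r , 𝔭r , least) = r , 1≤r , 𝔭r , λ j 𝔭j → divides (j / r) (quotient j 𝔭j)
      where
      quotient : ∀ j → 𝔭 (a j) → j ≡ j / r ℕ.* r
      quotient j 𝔭j with j % r | m≡m%n+[m/n]*n j r | m%n<n j r
      ... | zero  | eq | _ = eq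
      ... | suc i | eq | i<r = contradiction
        (a-residue 𝔭r (suc i) (j / r) (≡.subst (𝔭 ∘ a) eq 𝔭j)) (least (suc i) (s≤s z≤n) i<r)

    multiples : ℕ → List ℕ → ℕ
    multiples r = length ∘ filter (r ∣?_)

    -- By rigid divisibility each index divisible by r contributes exactly one a_r up to a unit at
    -- 𝔭, and the remaining indices contribute units. This replaces a valuation.
    Π-factor : ∀ {r} → IsPeriod r → ∀ {L} → All (1 ≤_) L →
               ∃ λ u → Π a L ≈ a r ^ multiples r L * u × ¬ 𝔭 u
    Π-factor _ [] = 1# , sym (*-identityˡ 1#) , 𝔭-proper
    Π-factor {r} per@(1≤r , 𝔭r , div) {k ∷ L} (1≤k ∷ pos) with Π-factor per pos | r ∣? k
    ... | u , eq , ¬𝔭u | no r∤k =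
      a k * u , trans (*-congˡ eq) (S.solve 3 (λ x y z → x S.:* (y S.:* z) S.:= y S.:* (x S.:* z)) refl _ _ _)
              , ∉-* (λ 𝔭k → r∤k (div k 𝔭k)) ¬𝔭u
    ... | u , eq , ¬𝔭u | yes (divides zero ≡.refl) = contradiction 1≤k λ ()
    ... | u , eq , ¬𝔭u | yes (divides (suc q) k≡)
      with a-multiple 1≤r 𝔭r q
    ... | t , f , ¬𝔭t = t * u
      , trans (*-cong (trans (reflexive (≡.cong a k≡)) f) eq)
              (S.solve 4 (λ x t y u → x S.:* t S.:* (y S.:* u) S.:= x S.:* y S.:* (t S.:* u)) refl _ _ _ _)
      , ∉-* ¬𝔭t ¬𝔭u

    module _
      (ε-cancel : ∀ j {k} → 1 ≤ k → E.Cancel (ε k j))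
      {n : ℕ} (1≤n : 1 ≤ n) {L⁺ L⁻ : List ℕ}
      (pos⁺ : All (1 ≤_) L⁺) (pos⁻ : All (1 ≤_) L⁻) (div⁺ : All (_∣ n) L⁺)
      (balanced : ∀ {r} → r ∣ n → r < n → multiples r L⁺ ≤ multiples r L⁻)
      {G₀ : Carrier} (G₀-eq : G₀ * Π a L⁻ ≈ Π a L⁺) (𝔭G₀ : 𝔭 G₀) where

      private
        find : ∀ {L} → All (1 ≤_) L → All (_∣ n) L → Any (λ k → 𝔭 (a k)) L → 𝔭 (a n)
        find (1≤k ∷ _) (divides zero eq ∷ _) (here 𝔭k) = contradiction (≡.subst (1 ≤_) eq 1≤n) λ ()
        find (1≤k ∷ _) (divides (suc q) eq ∷ _) (here 𝔭k) with a-multiple 1≤k 𝔭k q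
        ... | t , f , _ = ≡.subst (𝔭 ∘ a) (≡.sym eq) (𝔭-resp (sym f) (𝔭-* t 𝔭k))
        find (_ ∷ pos) (_ ∷ div) (there any) = find pos div any

      -- G_{d,0,n} divides the product over `L⁺`, so some a_k with k dividing n lies in 𝔭, and a_n
      -- is a multiple of that a_k.
      𝔭-aₙ : 𝔭 (a n)
      𝔭-aₙ = find pos⁺ div⁺ (𝔭-Π⁻ L⁺ (𝔭-resp G₀-eq (𝔭-* _ 𝔭G₀)))

      -- If the period r were a proper divisor of n, then a r would occur at least as often in
      -- ∏ a⁻ as in ∏ a⁺, and cancelling it would leave a multiple of G₀ outside 𝔭.
      period≡n : ∀ {r} → IsPeriod r → r ≡ n
      period≡n {r} per@(1≤r , 𝔭r , div) with ℕ.m≤n⇒m<n∨m≡n (∣⇒≤ {{ℕ.>-nonZero 1≤n}} (div n 𝔭-aₙ))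
      ... | inj₂ r≡n = r≡n
      ... | inj₁ r<n with Π-factor per pos⁺ | Π-factor per pos⁻ | ℕ.m≤n⇒∃[o]m+o≡n (balanced (div n 𝔭-aₙ) r<n)
      ... | u , f , ¬𝔭u | v , g , _ | δ , eq = contradiction
        (𝔭-resp (E.cancel-^ N (ε-cancel 0 1≤r) (begin
          x ^ N * (G₀ * (x ^ δ * v))     ≈⟨ S.solve 4 (λ x G y v → x S.:* (G S.:* (y S.:* v)) S.:= G S.:* (x S.:* y S.:* v)) refl _ _ _ _ ⟩
          G₀ * (x ^ N * x ^ δ * v)       ≈⟨ *-congˡ (*-congʳ (^-homo-* x N δ)) ⟨
          G₀ * (x ^ (N ℕ.+ δ) * v)       ≈⟨ *-congˡ (*-congʳ (^-congʳ x eq)) ⟩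
          G₀ * (x ^ multiples r L⁻ * v)  ≈⟨ *-congˡ g ⟨
          G₀ * Π a L⁻                    ≈⟨ G₀-eq ⟩
          Π a L⁺                         ≈⟨ f ⟩
          x ^ N * u                      ∎)) (𝔭-* _ 𝔭G₀)) ¬𝔭u
        where
        x = a r
        N = multiples r L⁺

      period-n : ∀ j → 𝔭 (a j) → n ∣ j
      period-n with period 1≤n 𝔭-aₙ
      ... | r , per with period≡n per
      ... | ≡.refl = proj₂ (proj₂ per)

    -- G_{d,m,n} avoids 𝔭²

    private
      ∉-proper : ∀ {n} → (∀ j → 𝔭 (a j) → n ∣ j) → ∀ {k} → 1 ≤ k → k < n → ¬ 𝔭 (a k)
      ∉-proper per {k} 1≤k k<n 𝔭k = ℕ.<⇒≱ k<n (∣⇒≤ {{ℕ.>-nonZero 1≤k}} (per k 𝔭k))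

      -- D times a unit of the local ring at 𝔭 does not lie in 𝔮.
      ∉𝔮 : ∀ {w G U H V y} → ¬ 𝔭 w → ¬ 𝔭 y → ¬ 𝔭 V →
           (∃ λ z → 𝔮 z × H ≈ D * y + z) → G * U ≈ H * V → ¬ 𝔮 (w * G)
      ∉𝔮 {w} {G} {U} {H} {V} {y} ¬w ¬y ¬V (z , 𝔮z , eq) f k = ∉-* (∉-* ¬w ¬y) ¬V
        (𝔮-D* (𝔮-∸ (𝔮-resp (begin
          w * G * U                      ≈⟨ *-assoc _ _ _ ⟩
          w * (G * U)                    ≈⟨ *-congˡ f ⟩
          w * (H * V)                    ≈⟨ *-congˡ (*-congʳ eq) ⟩
          w * ((D * y + z) * V)
            ≈⟨ S.solve 5 (λ w D y z V → w S.:* ((D S.:* y S.:+ z) S.:* V) S.:= D S.:* (w S.:* y S.:* V) S.:+ z S.:* (w S.:* V)) refl w D y z V ⟩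
          D * (w * y * V) + z * (w * V)  ∎) (𝔮-* U k)) (𝔮-* (w * V) 𝔮z)))

      ∉-^ : ∀ {x} n → ¬ 𝔭 x → ¬ 𝔭 (x ^ n)
      ∉-^ n ¬x k = ¬x (𝔭-^⁻ n k)

    module _
      (ε-cancel : ∀ j {k} → 1 ≤ k → E.Cancel (ε k j))
      {n : ℕ} (1≤n : 1 ≤ n) {ys zs L⁻ : List ℕ}
      (L⁺′-proper : All (λ k → 1 ≤ k × k < n) (ys ++ zs))
      (L⁻-proper : All (λ k → 1 ≤ k × k < n) L⁻)
      (𝔭aₙ : 𝔭 (a n)) (per : ∀ j → 𝔭 (a j) → n ∣ j) where

      private
        -- μ(1) = 1 puts n into `L⁺`, exactly once. All other indices are smaller than n, so their
        -- orbit elements avoid 𝔭.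
        L⁺  = ys ++ n ∷ zs
        L⁺′ = ys ++ zs

        ∉aᴬ : ∀ {L} → All (λ k → 1 ≤ k × k < n) L → All (λ k → ¬ 𝔭 (a k)) L
        ∉aᴬ = All.map λ (1≤k , k<n) → ∉-proper per 1≤k k<n

        ∉ΠQ : ∀ j {L} → All (λ k → 1 ≤ k × k < n) L → ¬ 𝔭 (Π (Q j) L)
        ∉ΠQ j pr = ∉-Π (All.map (∉-Q j) (∉aᴬ pr))

      -- Here a_j is a unit at 𝔭, so `h≈D+𝔮` applies with y = a_j. Its second argument `ε n j` lies
      -- in 𝔮 because j ≥ 1 exhibits it as a product of two elements of 𝔭.
      G∉𝔮 : ∀ {G w} i → let j = suc i in ¬ n ∣ j → ¬ 𝔭 w →
             G * Π (Q j) L⁻ ≈ Π (Q j) L⁺ → ¬ 𝔮 (w * G)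
      G∉𝔮 {G} {w} i n∤j ¬w eq = ∉𝔮 ¬w (∉-^ (suc e) (n∤j ∘ per j)) (∉ΠQ j L⁺′-proper)
        (h≈D+𝔮 (a j) (𝔮⇒𝔭 𝔮ε) (𝔮-* _ 𝔮ε))
        (trans eq (Π-extract (Q j) ys n zs))
        where
        j = suc i
        𝔮ε : 𝔮 (ε n j)
        𝔮ε = 𝔭𝔭⇒𝔮 (𝔭-ε i 𝔭aₙ) (𝔭-h (a i) (𝔭-ε i 𝔭aₙ))

      -- Now a_j lies in 𝔭 and `Q j n` is no longer of order one. Writing a_j = a_n t and `ε n j` =
      -- a_n b extracts a_n^{d-1}, which cancels against the share of n in F_{d,1,n}; the remaining
      -- h(t, b) is handled as before, with t a unit at 𝔭.
      G∉𝔮′ : ∀ {G w} i → let j = suc i in n ∣ j → 1 ≤ e ⊎ 1 ≤ i → ¬ 𝔭 w →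
        G * Π (Q j) L⁻ * Π (λ k → a k ^ suc e) L⁺ ≈ Π (Q j) L⁺ * Π (λ k → a k ^ suc e) L⁻ →
        ¬ 𝔮 (w * G)
      G∉𝔮′ {G} {w} i (divides zero ()) large ¬w eq
      G∉𝔮′ {G} {w} i (divides (suc q) j≡) large ¬w eq with a-multiple 1≤n 𝔭aₙ q | ε/a i 𝔭aₙ
      ... | t , aj≈ , ¬t | b , ε≈ , 𝔭b , 𝔮b = ∉𝔮 ¬w (∉-^ (suc e) ¬t)
        (∉-* (∉ΠQ j L⁺′-proper) (∉-Π (All.map (∉-^ (suc e)) (∉aᴬ L⁻-proper))))
        (h≈D+𝔮 t 𝔭b (𝔮b^ large))
        (E.cancel-^ (suc e) (ε-cancel 0 1≤n) (begin
          x ^ suc e * (G * (R⁻ * S⁺′))    ≈⟨ S.solve 4 (λ x G R S → x S.:* (G S.:* (R S.:* S)) S.:= G S.:* R S.:* (x S.:* S)) refl _ _ _ _ ⟩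
          G * R⁻ * (x ^ suc e * S⁺′)      ≈⟨ *-congˡ (Π-extract (λ k → a k ^ suc e) ys n zs) ⟨
          G * R⁻ * Π (λ k → a k ^ suc e) L⁺  ≈⟨ eq ⟩
          Π (Q j) L⁺ * S⁻                 ≈⟨ *-congʳ (Π-extract (Q j) ys n zs) ⟩
          Q j n * R⁺′ * S⁻                ≈⟨ *-congʳ (*-congʳ Qjn≈) ⟩
          x ^ suc e * h t b * R⁺′ * S⁻    ≈⟨ S.solve 4 (λ x h R S → x S.:* h S.:* R S.:* S S.:= x S.:* (h S.:* (R S.:* S))) refl _ _ _ _ ⟩
          x ^ suc e * (h t b * (R⁺′ * S⁻)) ∎))
        where
        j = suc i
        x = a n
        R⁻ = Π (Q j) L⁻
        R⁺′ = Π (Q j) L⁺′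
        S⁺′ = Π (λ k → a k ^ suc e) L⁺′
        S⁻ = Π (λ k → a k ^ suc e) L⁻
        -- Either m ≥ 3, and b itself lies in 𝔮, or d ≥ 3, and the power of b has at least two
        -- factors from 𝔭.
        𝔮b^ : 1 ≤ e ⊎ 1 ≤ i → 𝔮 (b ^ suc e)
        𝔮b^ (inj₂ 1≤i) = 𝔮-* (b ^ e) (𝔮b 1≤i)
        𝔮b^ (inj₁ (s≤s {n = e′} _)) = 𝔭𝔭⇒𝔮 𝔭b (𝔭-* (b ^ e′) 𝔭b)
        aj≈xt : a j ≈ x * t
        aj≈xt = trans (reflexive (≡.cong a j≡)) aj≈
        -- Homogeneity of `h` of degree d - 1, obtained by expanding (x t + x b)^d in two ways and
        -- cancelling, without opening the sum `M`.
        Qjn≈ : Q j n ≈ x ^ suc e * h t b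
        Qjn≈ = ε-cancel j 1≤n (+-cancel {a j ^ d} (begin
          a j ^ d + ε n j * Q j n                ≈⟨ ^-expand (a j) (ε n j) ⟨
          (a j + ε n j) ^ d                      ≈⟨ ^-congˡ d (trans (+-cong aj≈xt ε≈) (sym (distribˡ x t b))) ⟩
          (x * (t + b)) ^ d                      ≈⟨ ^-distrib-* d x (t + b) ⟩
          x ^ d * (t + b) ^ d                    ≈⟨ *-congˡ (^-expand t b) ⟩
          x ^ d * (t ^ d + b * h t b)
            ≈⟨ S.solve 5 (λ x X T b h → x S.:* X S.:* (T S.:+ b S.:* h) S.:= x S.:* X S.:* T S.:+ x S.:* b S.:* (X S.:* h)) refl x (x ^ suc e) (t ^ d) b (h t b) ⟩
          x ^ d * t ^ d + x * b * (x ^ suc e * h t b)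
            ≈⟨ +-cong (trans (^-congˡ d aj≈xt) (^-distrib-* d x t)) (*-congʳ ε≈) ⟨
          a j ^ d + ε n j * (x ^ suc e * h t b)  ∎))

-- The Möbius function

module Möbius where
  open import Data.Nat using (_*_)
  open import Relation.Binary.PropositionalEquality using (refl)

  -- The pigeonhole principle for a relation: choosing a partner for each position gives an
  -- injection of positions. Working with positions lets equal entries count separately.
  length≤ : ∀ {A B : Set} (R : A → B → Set) xs ys →
            (∀ i → Any (R (lookup xs i)) ys) →
            (∀ i j l → R (lookup xs i) (lookup ys l) → R (lookup xs j) (lookup ys l) → i ≡ j) →
            length xs ≤ length ys
  length≤ R xs ys total inj = Fin.injective⇒≤ λ {i} {j} eq → inj i j (Any.index (total i))
    (lookup-index (total i))
    (≡.subst (R (lookup xs j) ∘ lookup ys) (≡.sym eq) (lookup-index (total j)))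

  Unique⇒lookup-injective : ∀ {A : Set} {xs : List A} → Unique xs →
                            ∀ i j → lookup xs i ≡ lookup xs j → i ≡ j
  Unique⇒lookup-injective (_ ∷ _)   Fin.zero    Fin.zero    _  = refl
  Unique⇒lookup-injective (x∉ ∷ _)  Fin.zero    (Fin.suc j) eq = contradiction eq (All.lookup x∉ (∈-lookup j))
  Unique⇒lookup-injective (x∉ ∷ _)  (Fin.suc i) Fin.zero    eq = contradiction (≡.sym eq) (All.lookup x∉ (∈-lookup i))
  Unique⇒lookup-injective (_ ∷ xs!) (Fin.suc i) (Fin.suc j) eq = ≡.cong Fin.suc (Unique⇒lookup-injective xs! i j eq)

  Unique⇒length≤ : ∀ {A B : Set} (R : A → B → Set) {xs ys} → Unique xs →
                   (∀ {x} → x ∈ xs → ∃ λ y → y ∈ ys × R x y) →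
                   (∀ {x x′ y} → R x y → R x′ y → x ≡ x′) →
                   length xs ≤ length ys
  Unique⇒length≤ R {xs} {ys} xs! total inj = length≤ R xs ys
    (λ i → let y , y∈ , r = total (∈-lookup i) in Any.map (λ { refl → r }) y∈)
    (λ i j l r r′ → Unique⇒lookup-injective xs! i j (inj r r′))

  Squarefree : ℕ → Set
  Squarefree n = ∀ k → 2 ≤ k → ¬ k * k ∣ n

  private
    SquarefreeBounded : ℕ → Set
    SquarefreeBounded n = All (λ k → ¬ (k * k ∣ n)) (filter (λ k → 2 ℕ.≤? k) (upTo (suc n)))

    bounded⇒squarefree : ∀ {n} → 1 ≤ n → SquarefreeBounded n → Squarefree n
    bounded⇒squarefree {n} 1≤n sq k@(suc _) 2≤k k²∣n = All.lookup sq
      (∈-filter⁺ (2 ℕ.≤?_) (∈-upTo⁺ (s≤s (ℕ.≤-trans (ℕ.m≤m*n k k) (∣⇒≤ {{ℕ.>-nonZero 1≤n}} k²∣n)))) 2≤k) k²∣n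

    squarefree⇒bounded : ∀ {n} → Squarefree n → SquarefreeBounded n
    squarefree⇒bounded {n} sq = All.tabulate λ k∈ → sq _ (proj₂ (∈-filter⁻ (2 ℕ.≤?_) {xs = upTo (suc n)} k∈))

  μ-squarefree : ∀ {n} → 1 ≤ n → Squarefree n → μ n ≡ (ℤ.- (+ 1)) ℤ.^ numPrimeDivisors n
  μ-squarefree {n@(suc _)} _ sq with squarefree? n
  ... | yes _ = refl
  ... | no ¬b = contradiction (squarefree⇒bounded sq) ¬b

  μ≢0⇒squarefree : ∀ {n} → 1 ≤ n → μ n ≢ + 0 → Squarefree n
  μ≢0⇒squarefree {n@(suc _)} 1≤n μ≢0 with squarefree? n
  ... | yes b = bounded⇒squarefree 1≤n b
  ... | no _  = contradiction refl μ≢0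

  prime≥2 : ∀ {q} → Prime q → 2 ≤ q
  prime≥2 {q} pq = ℕ.nonTrivial⇒n>1 q {{prime⇒nonTrivial pq}}

  private
    primeDivisor? : ∀ n → Decidable (λ p → Prime p × p ∣ n)
    primeDivisor? n p = prime? p ×-dec (p ∣? n)

    primeDivisors : ℕ → List ℕ
    primeDivisors n = filter (primeDivisor? n) (upTo (suc n))

    primeDivisors! : ∀ n → Unique (primeDivisors n)
    primeDivisors! n = Unique.filter⁺ (primeDivisor? n) (Unique.upTo⁺ (suc n))

    ∈-primeDivisors⁺ : ∀ {n p} → 1 ≤ n → Prime p → p ∣ n → p ∈ primeDivisors n
    ∈-primeDivisors⁺ {n} 1≤n pp p∣n =
      ∈-filter⁺ (primeDivisor? n) (∈-upTo⁺ (s≤s (∣⇒≤ {{ℕ.>-nonZero 1≤n}} p∣n))) (pp , p∣n)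

    ∈-primeDivisors⁻ : ∀ n {p} → p ∈ primeDivisors n → Prime p × p ∣ n
    ∈-primeDivisors⁻ n p∈ = proj₂ (∈-filter⁻ (primeDivisor? n) {xs = upTo (suc n)} p∈)

  prime∣prime⇒≡ : ∀ {p q} → Prime p → Prime q → p ∣ q → p ≡ q
  prime∣prime⇒≡ pp pq p∣q with prime⇒irreducible pq p∣q
  ... | inj₁ refl = contradiction (prime≥2 pp) λ { (s≤s ()) }
  ... | inj₂ eq   = eq

  numPrimeDivisors-* : ∀ {j q} → 1 ≤ j → Prime q → ¬ q ∣ j →
                       numPrimeDivisors (j * q) ≡ suc (numPrimeDivisors j)
  numPrimeDivisors-* {j} {q} 1≤j pq q∤j = ℕ.≤-antisym
    (Unique⇒length≤ _≡_ (primeDivisors! (j * q)) (λ {x} x∈ → x , sub x∈ , refl) (λ { refl refl → refl }))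
    (Unique⇒length≤ _≡_ (All.tabulate (λ x∈ → λ { refl → q∤j (proj₂ (∈-primeDivisors⁻ j x∈)) }) ∷ primeDivisors! j)
                    (λ {x} x∈ → x , sup x∈ , refl) (λ { refl refl → refl }))
    where
    1≤jq : 1 ≤ j * q
    1≤jq = ℕ.*-mono-≤ 1≤j (ℕ.<⇒≤ (prime≥2 pq))
    sub : ∀ {x} → x ∈ primeDivisors (j * q) → x ∈ q ∷ primeDivisors j
    sub x∈ with ∈-primeDivisors⁻ (j * q) x∈
    ... | px , x∣jq with euclidsLemma j q px x∣jq
    ...   | inj₁ x∣j = there (∈-primeDivisors⁺ 1≤j px x∣j)
    ...   | inj₂ x∣q = here (prime∣prime⇒≡ px pq x∣q)
    sup : ∀ {x} → x ∈ q ∷ primeDivisors j → x ∈ primeDivisors (j * q)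
    sup (here refl) = ∈-primeDivisors⁺ 1≤jq pq (n∣m*n j)
    sup (there x∈) with ∈-primeDivisors⁻ j x∈
    ... | px , x∣j = ∈-primeDivisors⁺ 1≤jq px (∣m⇒∣m*n q x∣j)

  -- If q divides k, then q² divides j q and q divides j; otherwise k² is coprime to q and already
  -- divides j.
  squarefree-* : ∀ {j q} → Prime q → ¬ q ∣ j → Squarefree j → Squarefree (j * q)
  squarefree-* {j} {q} pq q∤j sq k 2≤k k²∣jq with q ∣? k
  ... | yes q∣k = q∤j (*-cancelʳ-∣ q {{prime⇒nonZero pq}} (∣-trans (*-pres-∣ q∣k q∣k) k²∣jq))
  ... | no  q∤k = sq k 2≤k (coprime-divisor {k * k} {q} coprime (≡.subst (k * k ∣_) (ℕ.*-comm j q) k²∣jq))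
    where
    coprime : ∀ {i} → i ∣ k * k × i ∣ q → i ≡ 1
    coprime (i∣k² , i∣q) with prime⇒irreducible pq i∣q
    ... | inj₁ i≡1 = i≡1
    ... | inj₂ refl with euclidsLemma k k pq i∣k²
    ...   | inj₁ q∣k = contradiction q∣k q∤k
    ...   | inj₂ q∣k = contradiction q∣k q∤k

  squarefree-∣ : ∀ {i j} → i ∣ j → Squarefree j → Squarefree i
  squarefree-∣ i∣j sq k 2≤k k²∣i = sq k 2≤k (∣-trans k²∣i i∣j)

  μ-*-prime : ∀ {j q} → 1 ≤ j → Prime q → ¬ q ∣ j → Squarefree j → μ (j * q) ≡ ℤ.- μ j
  μ-*-prime {j} {q} 1≤j pq q∤j sq = begin
    μ (j * q)                                          ≡⟨ μ-squarefree (ℕ.*-mono-≤ 1≤j (ℕ.<⇒≤ (prime≥2 pq))) (squarefree-* pq q∤j sq) ⟩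
    (ℤ.- (+ 1)) ℤ.^ numPrimeDivisors (j * q)           ≡⟨ ≡.cong ((ℤ.- (+ 1)) ℤ.^_) (numPrimeDivisors-* 1≤j pq q∤j) ⟩
    (ℤ.- (+ 1)) ℤ.* (ℤ.- (+ 1)) ℤ.^ numPrimeDivisors j ≡⟨ ≡.cong ((ℤ.- (+ 1)) ℤ.*_) (≡.sym (μ-squarefree 1≤j sq)) ⟩
    (ℤ.- (+ 1)) ℤ.* μ j                                ≡⟨ ℤ.-1*i≡-i (μ j) ⟩
    ℤ.- μ j                                            ∎
    where open ≡.≡-Reasoning

  -- Divisors of n with their Möbius signs

  private
    pairs : ℕ → List (ℕ × ℕ)
    pairs n = concatMap (λ k → map (λ j → (k , j)) (upTo (suc n))) (upTo (suc n))

    concatMap≡cartesianProduct : ∀ (xs ys : List ℕ) →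
      concatMap (λ k → map (λ j → (k , j)) ys) xs ≡ cartesianProduct xs ys
    concatMap≡cartesianProduct []       ys = refl
    concatMap≡cartesianProduct (x ∷ xs) ys = ≡.cong (map (x ,_) ys ++_) (concatMap≡cartesianProduct xs ys)

    pairs≡ : ∀ n → pairs n ≡ cartesianProduct (upTo (suc n)) (upTo (suc n))
    pairs≡ n = concatMap≡cartesianProduct (upTo (suc n)) (upTo (suc n))

    product? : ∀ n → Decidable (λ (kj : ℕ × ℕ) → proj₁ kj * proj₂ kj ≡ n)
    product? n kj = (proj₁ kj * proj₂ kj) ℕ.≟ n

  divisorPairs! : ∀ n → Unique (divisorPairs n)
  divisorPairs! n = Unique.filter⁺ (product? n) (≡.subst Unique (≡.sym (pairs≡ n))
    (Unique.cartesianProduct⁺ (Unique.upTo⁺ (suc n)) (Unique.upTo⁺ (suc n))))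

  ∈-divisorPairs⁻ : ∀ {n k j} → (k , j) ∈ divisorPairs n → k * j ≡ n
  ∈-divisorPairs⁻ {n} kj∈ = proj₂ (∈-filter⁻ (product? n) {xs = pairs n} kj∈)

  factors≥1 : ∀ {n} k j → 1 ≤ n → k * j ≡ n → 1 ≤ k × 1 ≤ j
  factors≥1 zero    j       () refl
  factors≥1 (suc k) zero    1≤n refl = contradiction (≡.subst (1 ≤_) (ℕ.*-zeroʳ k) 1≤n) λ ()
  factors≥1 (suc k) (suc j) 1≤n eq = s≤s z≤n , s≤s z≤n

  ∈-divisorPairs⁺ : ∀ {n k j} → 1 ≤ n → k * j ≡ n → (k , j) ∈ divisorPairs n
  ∈-divisorPairs⁺ {n} {k} {j} 1≤n eq with factors≥1 k j 1≤n eq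
  ... | 1≤k , 1≤j = ∈-filter⁺ (product? n)
    (≡.subst ((k , j) ∈_) (≡.sym (pairs≡ n)) (∈-cartesianProduct⁺
      (∈-upTo⁺ (s≤s (≡.subst (k ≤_) eq (ℕ.m≤m*n k j {{ℕ.>-nonZero 1≤j}}))))
      (∈-upTo⁺ (s≤s (≡.subst (j ≤_) eq (ℕ.m≤n*m j k {{ℕ.>-nonZero 1≤k}}))))))
    eq

  private
    μ≟ : ∀ s → Decidable (λ (kj : ℕ × ℕ) → μ (proj₂ kj) ≡ s)
    μ≟ s kj = μ (proj₂ kj) ℤ.≟ s

    pairsμ : ℤ → ℕ → List (ℕ × ℕ)
    pairsμ s n = filter (μ≟ s) (divisorPairs n)

    ∈-pairsμ⁻ : ∀ {s n k j} → (k , j) ∈ pairsμ s n → k * j ≡ n × μ j ≡ s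
    ∈-pairsμ⁻ {s} {n} kj∈ with ∈-filter⁻ (μ≟ s) {xs = divisorPairs n} kj∈
    ... | kj∈′ , eq = ∈-divisorPairs⁻ kj∈′ , eq

    ∈-pairsμ⁺ : ∀ {s n k j} → 1 ≤ n → k * j ≡ n → μ j ≡ s → (k , j) ∈ pairsμ s n
    ∈-pairsμ⁺ {s} 1≤n eq = ∈-filter⁺ (μ≟ s) (∈-divisorPairs⁺ 1≤n eq)

    proper : ∀ {n k j} → 1 ≤ n → k * j ≡ n → j ≢ 1 → 1 ≤ k × k < n
    proper {k = k} {zero} 1≤n eq j≢1 = contradiction (proj₂ (factors≥1 k 0 1≤n eq)) λ ()
    proper {j = suc zero} 1≤n eq j≢1 = contradiction refl j≢1
    proper {n} {k} {suc (suc j)} 1≤n eq j≢1 with factors≥1 k (suc (suc j)) 1≤n eq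
    ... | 1≤k , _ = 1≤k , ≡.subst (k <_) eq (ℕ.m<m*n k (suc (suc j)) {{ℕ.>-nonZero 1≤k}} (s≤s (s≤s z≤n)))

  divisorsμ+-∣ : ∀ n → All (_∣ n) (divisorsμ+ n)
  divisorsμ+-∣ n = All.map⁺ (All.tabulate λ {(k , j)} kj∈ →
    divides j (≡.trans (≡.sym (proj₁ (∈-pairsμ⁻ kj∈))) (ℕ.*-comm k j)))

  divisorsμ--proper : ∀ {n} → 1 ≤ n → All (λ k → 1 ≤ k × k < n) (divisorsμ- n)
  divisorsμ--proper {n} 1≤n = All.map⁺ (All.tabulate λ {(k , j)} kj∈ →
    let eq , μj = ∈-pairsμ⁻ kj∈ in proper 1≤n eq λ { refl → contradiction μj λ () })

  -- The pair (n, 1) is listed because μ(1) = 1. The pairs are pairwise distinct, so every other one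
  -- has a cofactor different from 1 and hence a first entry below n.
  divisorsμ+-split : ∀ {n} → 1 ≤ n → ∃₂ λ ys zs →
    divisorsμ+ n ≡ ys ++ n ∷ zs × All (λ k → 1 ≤ k × k < n) (ys ++ zs)
  divisorsμ+-split {n} 1≤n with ∈-∃++ (∈-pairsμ⁺ {+ 1} {n} {n} {1} 1≤n (ℕ.*-identityʳ n) refl)
  ... | ys , zs , eq = map proj₁ ys , map proj₁ zs
    , ≡.trans (≡.cong (map proj₁) eq) (map-++ proj₁ ys ((n , 1) ∷ zs))
    , ≡.subst (All _) (map-++ proj₁ ys zs) (All.map⁺ (All.tabulate all))
    where
    whole : Unique (ys ++ (n , 1) ∷ zs)
    whole = ≡.subst Unique eq (Unique.filter⁺ (μ≟ (+ 1)) (divisorPairs! n))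
    fresh : ∀ ys {zs} {x : ℕ × ℕ} → Unique (ys ++ x ∷ zs) → All (_≢ x) (ys ++ zs)
    fresh []       (x∉ ∷ _)  = All.map (λ ne eq → ne (≡.sym eq)) x∉
    fresh (y ∷ ys) (y∉ ∷ u) = All.lookup y∉ (∈-++⁺ʳ ys (here refl)) ∷ fresh ys u
    ∈whole : ∀ {x : ℕ × ℕ} → x ∈ ys ++ zs → x ∈ pairsμ (+ 1) n
    ∈whole x∈ with ∈-++⁻ ys x∈
    ... | inj₁ x∈ys = ≡.subst (_ ∈_) (≡.sym eq) (∈-++⁺ˡ x∈ys)
    ... | inj₂ x∈zs = ≡.subst (_ ∈_) (≡.sym eq) (∈-++⁺ʳ ys (there x∈zs))
    all : ∀ {x : ℕ × ℕ} → x ∈ ys ++ zs → 1 ≤ proj₁ x × proj₁ x < n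
    all {k , j} x∈ with ∈-pairsμ⁻ (∈whole x∈)
    ... | kj≡n , _ = proper 1≤n kj≡n λ { refl →
      All.lookup (fresh ys whole) x∈ (≡.cong (_, 1) (≡.trans (≡.sym (ℕ.*-identityʳ k)) kj≡n)) }

  private
    length-filter-map : ∀ {A B : Set} {P : Pred B 0ℓ} (P? : Decidable P) (f : A → B) xs →
      length (filter P? (map f xs)) ≡ length (filter (P? ∘ f) xs)
    length-filter-map P? f []       = refl
    length-filter-map P? f (x ∷ xs) with P? (f x)
    ... | yes _ = ≡.cong suc (length-filter-map P? f xs)
    ... | no  _ = length-filter-map P? f xs

  primeDivisor : ∀ {N} → 2 ≤ N → ∃ λ q → Prime q × q ∣ N
  primeDivisor {N@(suc _)} 2≤N with factorise N
  ... | record { factors = [] ; isFactorisation = eq } = contradiction (≡.subst (2 ≤_) eq 2≤N) λ { (s≤s ()) }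
  ... | record { factors = q ∷ qs ; isFactorisation = eq ; factorsPrime = pq ∷ _ } =
    q , pq , ≡.subst (q ∣_) (≡.sym eq) (m∣m*n (product qs))

  private
    proper⇒2≤ : ∀ {n N r} → 1 ≤ n → n ≡ N * r → r < n → 2 ≤ N
    proper⇒2≤ {N = zero}        1≤n refl r<n = contradiction 1≤n λ ()
    proper⇒2≤ {N = suc zero}    1≤n refl r<n = contradiction r<n (ℕ.<-irrefl (≡.sym (ℕ.+-identityʳ _)))
    proper⇒2≤ {N = suc (suc _)} 1≤n _    r<n = s≤s (s≤s z≤n)

  -- Multiplying or dividing j = n / k by a fixed prime divisor q of n / r flips the sign of μ j.
  multiples-balanced : ∀ {n r} → 1 ≤ n → r ∣ n → r < n →
    length (filter (r ∣?_) (divisorsμ+ n)) ≤ length (filter (r ∣?_) (divisorsμ- n))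
  multiples-balanced {n} {r} 1≤n (divides N n≡) r<n with primeDivisor (proper⇒2≤ {N = N} 1≤n n≡ r<n)
  ... | q , pq , q∣N
    = ≡.subst₂ _≤_ (≡.sym (length-filter-map (r ∣?_) proj₁ (pairsμ (+ 1) n)))
                   (≡.sym (length-filter-map (r ∣?_) proj₁ (pairsμ (ℤ.- (+ 1)) n)))
        (Unique⇒length≤ Toggle (Unique.filter⁺ r∣?₁ (Unique.filter⁺ (μ≟ (+ 1)) (divisorPairs! n))) total
          (λ {x} {x′} {y} → injective {x} {x′} {y}))
    where
    r∣?₁ : Decidable (λ (kj : ℕ × ℕ) → r ∣ proj₁ kj)
    r∣?₁ kj = r ∣? proj₁ kj

    -- Whether q divides j′ reveals the direction of the move, which makes j recoverable from j′;
    -- the product n then fixes k.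
    Toggle : ℕ × ℕ → ℕ × ℕ → Set
    Toggle (k , j) (_ , j′) = k * j ≡ n × (j ≡ j′ * q × ¬ q ∣ j′ ⊎ j′ ≡ j * q × ¬ q ∣ j)

    same-j : ∀ {k k′ j} → k * j ≡ n → k′ * j ≡ n → (k , j) ≡ (k′ , j)
    same-j {k} {k′} {j} e e′ = ≡.cong (_, j)
      (ℕ.*-cancelʳ-≡ k k′ j {{ℕ.>-nonZero (proj₂ (factors≥1 k j 1≤n e))}} (≡.trans e (≡.sym e′)))

    injective : ∀ {x x′ y} → Toggle x y → Toggle x′ y → x ≡ x′
    injective (e , inj₁ (refl , _)) (e′ , inj₁ (refl , _)) = same-j e e′
    injective {_ , j} {_ , j′} (e , inj₂ (refl , _)) (e′ , inj₂ (eq , _))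
      with refl ← ℕ.*-cancelʳ-≡ j j′ q {{prime⇒nonZero pq}} eq = same-j e e′
    injective {_} {_ , j} (_ , inj₁ (_ , q∤)) (_ , inj₂ (refl , _)) = contradiction (n∣m*n j) q∤
    injective {_ , j} (_ , inj₂ (refl , _)) (_ , inj₁ (_ , q∤)) = contradiction (n∣m*n j) q∤

    total : ∀ {x} → x ∈ filter r∣?₁ (pairsμ (+ 1) n) →
            ∃ λ y → y ∈ filter r∣?₁ (pairsμ (ℤ.- (+ 1)) n) × Toggle x y
    total {k , j} x∈ with ∈-filter⁻ r∣?₁ {xs = pairsμ (+ 1) n} x∈
    ... | x∈′ , r∣k with ∈-pairsμ⁻ x∈′
    ... | kj≡n , μj≡1 = toggle r∣k (q ∣? j)
      where
      1≤j = proj₂ (factors≥1 k j 1≤n kj≡n)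
      sq : Squarefree j
      sq = μ≢0⇒squarefree 1≤j λ μj≡0 → contradiction (≡.trans (≡.sym μj≡1) μj≡0) λ ()
      -- Moving q from j to k preserves divisibility of k by r. The opposite move needs q to divide
      -- k / r: this is why q was chosen in n / r = (k / r) j, for it does not divide j.
      toggle : r ∣ k → Dec (q ∣ j) → ∃ λ y → y ∈ filter r∣?₁ (pairsμ (ℤ.- (+ 1)) n) × Toggle (k , j) y
      toggle r∣k (yes (divides i refl)) = (k * q , i)
        , ∈-filter⁺ r∣?₁ (∈-pairsμ⁺ 1≤n kqi≡n μi) (∣m⇒∣m*n q r∣k)
        , kj≡n , inj₁ (refl , q∤i)
        where
        q∤i : ¬ q ∣ i
        q∤i q∣i = sq q (prime≥2 pq) (*-pres-∣ q∣i ℕ.∣-refl)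
        kqi≡n : k * q * i ≡ n
        kqi≡n = ≡.trans (ℕ.*-assoc k q i) (≡.trans (≡.cong (k *_) (ℕ.*-comm q i)) kj≡n)
        μi : μ i ≡ ℤ.- (+ 1)
        μi = ℤ.neg-injective (≡.trans (≡.sym (μ-*-prime (proj₂ (factors≥1 (k * q) i 1≤n kqi≡n)) pq q∤i (squarefree-∣ (m∣m*n q) sq))) μj≡1)
      toggle (divides k₁ refl) (no q∤j) with euclidsLemma k₁ j pq (≡.subst (q ∣_) N≡ q∣N)
        where
        1≤r : 1 ≤ r
        1≤r = proj₂ (factors≥1 N r 1≤n (≡.sym n≡))
        N≡ : N ≡ k₁ * j
        N≡ = ℕ.*-cancelʳ-≡ N (k₁ * j) r {{ℕ.>-nonZero 1≤r}}
          (≡.trans (≡.sym n≡) (≡.trans (≡.sym kj≡n) (≡.trans (ℕ.*-assoc k₁ r j)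
            (≡.trans (≡.cong (k₁ *_) (ℕ.*-comm r j)) (≡.sym (ℕ.*-assoc k₁ j r))))))
      ... | inj₂ q∣j = contradiction q∣j q∤j
      ... | inj₁ (divides k₂ refl) = (k₂ * r , j * q)
        , ∈-filter⁺ r∣?₁ (∈-pairsμ⁺ 1≤n eq (≡.trans (μ-*-prime 1≤j pq q∤j sq) (≡.cong ℤ.-_ μj≡1))) (n∣m*n k₂)
        , kj≡n , inj₂ (refl , q∤j)
        where
        open import Data.Nat.Solver using (module +-*-Solver)
        open +-*-Solver
        eq : k₂ * r * (j * q) ≡ n
        eq = ≡.trans (solve 4 (λ k r j q → k :* r :* (j :* q) := k :* q :* r :* j) refl k₂ r j q) kj≡n

-- Polynomials over ℤ and modulo d

module Congruence (d : ℕ) where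
  open import Data.Integer using (_+_; _*_; _-_; -_; ∣_∣)
  open import Data.Integer.Divisibility.Signed using (∣ᵤ⇒∣; ∣⇒∣ᵤ) renaming (divides to dividesℤ)
  open import Data.Integer.Solver using (module +-*-Solver)
  open +-*-Solver

  infix 4 _≈ᵈ_
  _≈ᵈ_ : ℤ → ℤ → Set
  x ≈ᵈ y = + d ℤ.∣ x - y

  ≈ᵈ⇒∃ : ∀ {x y} → x ≈ᵈ y → ∃ λ z → x ≡ y + + d * z
  ≈ᵈ⇒∃ {x} {y} h with ∣ᵤ⇒∣ {+ d} {x - y} h
  ... | dividesℤ z eq = z , (begin
    x              ≡⟨ solve 2 (λ x y → x := y :+ (x :- y)) ≡.refl x y ⟩
    y + (x - y)    ≡⟨ ≡.cong (λ w → y + w) (≡.trans eq (ℤ.*-comm z (+ d))) ⟩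
    y + + d * z    ∎)
    where open ≡.≡-Reasoning

  ∃⇒≈ᵈ : ∀ {x y} z → x ≡ y + + d * z → x ≈ᵈ y
  ∃⇒≈ᵈ {x} {y} z eq = ∣⇒∣ᵤ {+ d} {x - y} (dividesℤ z (begin
    x - y              ≡⟨ ≡.cong (_- y) eq ⟩
    y + + d * z - y    ≡⟨ solve 3 (λ y d z → y :+ d :* z :- y := z :* d) ≡.refl y (+ d) z ⟩
    z * + d            ∎))
    where open ≡.≡-Reasoning

  ≡⇒≈ᵈ : ∀ {x y} → x ≡ y → x ≈ᵈ y
  ≡⇒≈ᵈ {x} {y} eq = ∃⇒≈ᵈ (+ 0) (≡.trans eq (solve 2 (λ y d → y := y :+ d :* con (+ 0)) ≡.refl y (+ d)))

  ≈ᵈ0? : ∀ x → Dec (x ≈ᵈ + 0)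
  ≈ᵈ0? x = d ℕ.∣? ∣ x - + 0 ∣

  private
    ≈ᵈ-sym : ∀ {x y} → x ≈ᵈ y → y ≈ᵈ x
    ≈ᵈ-sym {x} {y} h with ≈ᵈ⇒∃ {x} {y} h
    ... | z , ≡.refl = ∃⇒≈ᵈ (- z) (solve 3 (λ y d z → y := y :+ d :* z :+ d :* (:- z)) ≡.refl y (+ d) z)

    ≈ᵈ-trans : ∀ {x y z} → x ≈ᵈ y → y ≈ᵈ z → x ≈ᵈ z
    ≈ᵈ-trans {x} {y} {z} h k with ≈ᵈ⇒∃ {x} {y} h | ≈ᵈ⇒∃ {y} {z} k
    ... | u , ≡.refl | v , ≡.refl =
      ∃⇒≈ᵈ (v + u) (solve 4 (λ z d u v → z :+ d :* v :+ d :* u := z :+ d :* (v :+ u)) ≡.refl z (+ d) u v)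

    +-cong : ∀ {x y u v} → x ≈ᵈ y → u ≈ᵈ v → x + u ≈ᵈ y + v
    +-cong {x} {y} {u} {v} h k with ≈ᵈ⇒∃ {x} {y} h | ≈ᵈ⇒∃ {u} {v} k
    ... | s , ≡.refl | t , ≡.refl = ∃⇒≈ᵈ (s + t)
      (solve 5 (λ y d s v t → y :+ d :* s :+ (v :+ d :* t) := y :+ v :+ d :* (s :+ t)) ≡.refl y (+ d) s v t)

    *-cong : ∀ {x y u v} → x ≈ᵈ y → u ≈ᵈ v → x * u ≈ᵈ y * v
    *-cong {x} {y} {u} {v} h k with ≈ᵈ⇒∃ {x} {y} h | ≈ᵈ⇒∃ {u} {v} k
    ... | s , ≡.refl | t , ≡.refl = ∃⇒≈ᵈ (y * t + s * v + + d * s * t)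
      (solve 5 (λ y d s v t → (y :+ d :* s) :* (v :+ d :* t) := y :* v :+ d :* (y :* t :+ s :* v :+ d :* s :* t))
        ≡.refl y (+ d) s v t)

    -‿cong : ∀ {x y} → x ≈ᵈ y → - x ≈ᵈ - y
    -‿cong {x} {y} h with ≈ᵈ⇒∃ {x} {y} h
    ... | s , ≡.refl = ∃⇒≈ᵈ (- s) (solve 3 (λ y d s → :- (y :+ d :* s) := :- y :+ d :* (:- s)) ≡.refl y (+ d) s)

  𝔽-commutativeRing : CommutativeRing 0ℓ 0ℓ
  𝔽-commutativeRing = record
    { Carrier = ℤ ; _≈_ = _≈ᵈ_ ; _+_ = _+_ ; _*_ = _*_ ; -_ = -_ ; 0# = + 0 ; 1# = + 1
    ; isCommutativeRing = record
      { isRing = record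
        { +-isAbelianGroup = record
          { isGroup = record
            { isMonoid = record
              { isSemigroup = record
                { isMagma = record
                  { isEquivalence = record
                    { refl  = λ {x} → ≡⇒≈ᵈ {x} ≡.refl
                    ; sym   = λ {x} {y} → ≈ᵈ-sym {x} {y}
                    ; trans = λ {x} {y} {z} → ≈ᵈ-trans {x} {y} {z} }
                  ; ∙-cong = λ {x} {y} {u} {v} → +-cong {x} {y} {u} {v} }
                ; assoc = λ x y z → ≡⇒≈ᵈ (ℤ.+-assoc x y z) }
              ; identity = (λ x → ≡⇒≈ᵈ (ℤ.+-identityˡ x)) , λ x → ≡⇒≈ᵈ (ℤ.+-identityʳ x) }
            ; inverse = (λ x → ≡⇒≈ᵈ (ℤ.+-inverseˡ x)) , λ x → ≡⇒≈ᵈ (ℤ.+-inverseʳ x)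
            ; ⁻¹-cong = λ {x} {y} → -‿cong {x} {y} }
          ; comm = λ x y → ≡⇒≈ᵈ (ℤ.+-comm x y) }
        ; *-cong = λ {x} {y} {u} {v} → *-cong {x} {y} {u} {v}
        ; *-assoc = λ x y z → ≡⇒≈ᵈ (ℤ.*-assoc x y z)
        ; *-identity = (λ x → ≡⇒≈ᵈ (ℤ.*-identityˡ x)) , λ x → ≡⇒≈ᵈ (ℤ.*-identityʳ x)
        ; distrib = (λ x y z → ≡⇒≈ᵈ (ℤ.*-distribˡ-+ x y z)) , λ x y z → ≡⇒≈ᵈ (ℤ.*-distribʳ-+ x y z) }
      ; *-comm = λ x y → ≡⇒≈ᵈ (ℤ.*-comm x y) } }

  module _ (prime : Prime d) where

    1≉0 : ¬ + 1 ≈ᵈ + 0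
    1≉0 d∣1 = ℕ.<⇒≱ (ℕ.nonTrivial⇒n>1 d {{prime⇒nonTrivial prime}}) (ℕ.∣⇒≤ d∣1)

    private
      coprime : ∀ {k} → ¬ d ℕ.∣ k → Coprime.Coprime k d
      coprime d∤k (i∣k , i∣d) with prime⇒irreducible prime i∣d
      ... | inj₁ i≡1 = i≡1
      ... | inj₂ ≡.refl = contradiction i∣k d∤k

      inverseℕ : ∀ {k} → ¬ d ℕ.∣ k → ∃ λ b → b * + k ≈ᵈ + 1
      inverseℕ {k} d∤k with coprime-Bézout (coprime d∤k)
      ... | Bézout.+- x y eq = + x , ∃⇒≈ᵈ (+ y) (begin
        + x * + k            ≡⟨ ℤ.pos-* x k ⟨
        + (x ℕ.* k)          ≡⟨ ≡.cong +_ eq ⟨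
        + (1 ℕ.+ y ℕ.* d)    ≡⟨ ≡.cong (λ z → + 1 + z) (≡.trans (ℤ.pos-* y d) (ℤ.*-comm (+ y) (+ d))) ⟩
        + 1 + + d * + y      ∎)
        where open ≡.≡-Reasoning
      ... | Bézout.-+ x y eq = - + x , ∃⇒≈ᵈ (- + y) (begin
        - + x * + k                         ≡⟨ solve 2 (λ x k → :- x :* k := con (+ 1) :- (con (+ 1) :+ x :* k)) ≡.refl (+ x) (+ k) ⟩
        + 1 - (+ 1 + + x * + k)             ≡⟨ ≡.cong (λ z → + 1 - (+ 1 + z)) (ℤ.pos-* x k) ⟨
        + 1 - + (1 ℕ.+ x ℕ.* k)             ≡⟨ ≡.cong (λ z → + 1 - + z) eq ⟩
        + 1 - + (y ℕ.* d)                   ≡⟨ ≡.cong (λ z → + 1 - z) (ℤ.pos-* y d) ⟩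
        + 1 - + y * + d                     ≡⟨ solve 2 (λ y d → con (+ 1) :- y :* d := con (+ 1) :+ d :* (:- y)) ≡.refl (+ y) (+ d) ⟩
        + 1 + + d * - + y                   ∎)
        where open ≡.≡-Reasoning

    inverse : ∀ x → ¬ x ≈ᵈ + 0 → ∃ λ b → b * x ≈ᵈ + 1
    inverse (+ k) ne = inverseℕ λ d∣k → ne (≡.subst (+ d ℤ.∣_) (≡.sym (ℤ.+-identityʳ (+ k))) d∣k)
    inverse x@(ℤ.-[1+ k ]) ne
      with inverseℕ {suc k} (λ d∣k → ne (≡.subst (+ d ℤ.∣_) (≡.sym (ℤ.+-identityʳ x)) d∣k))
    ... | b , h = - b , ≡.subst (_≈ᵈ + 1) (solve 2 (λ b k → b :* k := :- b :* (:- k)) ≡.refl b (+ suc k)) h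

-- ℤ[c] and 𝔽_d[c] on the same coefficient lists

module Z = PolyRing ℤ.+-*-commutativeRing
module ZD = Z.Domain (λ a → a ℤ.≟ + 0) (λ {a} → ℤ.i*j≡0⇒i≡0∨j≡0 a)

module ModPrime {e : ℕ} (prime : Prime (2 ℕ.+ e)) where
  d : ℕ
  d = 2 ℕ.+ e

  open Congruence d public
  module F = PolyRing 𝔽-commutativeRing
  module FE = F.Euclid ≈ᵈ0? (inverse prime) (1≉0 prime)
  open Orbit Z.polyRing prime Z.X public
  open import Algebra.Properties.Semiring.Exp (CommutativeRing.semiring Z.polyRing) public using (_^_)
  private
    module P = CommutativeRing Z.polyRing

  -- Both coefficient rings have carrier ℤ, but their polynomial operations are separate recursive
  -- functions, which agree only by induction. This and the next two lemmas allow passing between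
  -- them.
  coeffF≡ : ∀ p i → F.coeff p i ≡ Z.coeff p i
  coeffF≡ []      i       = ≡.refl
  coeffF≡ (a ∷ p) zero    = ≡.refl
  coeffF≡ (a ∷ p) (suc i) = coeffF≡ p i

  +F≡ : ∀ p q → p F.+ₚ q ≡ p Z.+ₚ q
  +F≡ []      q       = ≡.refl
  +F≡ (a ∷ p) []      = ≡.refl
  +F≡ (a ∷ p) (b ∷ q) = ≡.cong (a ℤ.+ b ∷_) (+F≡ p q)

  *F≡ : ∀ p q → p F.*ₚ q ≡ p Z.*ₚ q
  *F≡ []      q = ≡.refl
  *F≡ (a ∷ p) q = ≡.trans (+F≡ (Z.scale a q) (+ 0 ∷ (p F.*ₚ q)))
                          (≡.cong (λ r → Z.scale a q Z.+ₚ (+ 0 ∷ r)) (*F≡ p q))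

  D≋ : D Z.≋ Z.const (+ d)
  D≋ = n·1≋ d
    where
    open import Algebra.Properties.Semiring.Mult P.semiring using () renaming (_×_ to _·_)
    n·1≋ : ∀ n → (n · Z.oneₚ) Z.≋ Z.const (+ n)
    n·1≋ zero    = Z.≋-sym (Z.const≋[] ≡.refl)
    n·1≋ (suc n) = Z.+ₚ-cong (Z.≋-refl {Z.oneₚ}) (n·1≋ n)

  coeff-D* : ∀ s i → Z.coeff (D Z.*ₚ s) i ≡ + d ℤ.* Z.coeff s i
  coeff-D* s i = ≡.trans (Z.at (Z.*ₚ-cong D≋ (Z.≋-refl {s})) i) (Z.coeff-const-* (+ d) s i)

  ≡ᴰ⇒≋ : ∀ {p q} → p ≡ᴰ q → p F.≋ q
  ≡ᴰ⇒≋ {p} {q} (mod s eq) = F.mk λ i → ≡.subst₂ _≈ᵈ_ (≡.sym (coeffF≡ p i)) (≡.sym (coeffF≡ q i))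
    (∃⇒≈ᵈ (Z.coeff s i) (≡.trans (Z.at eq i)
      (≡.trans (Z.coeff-+ q (D Z.*ₚ s) i) (≡.cong (λ z → Z.coeff q i ℤ.+ z) (coeff-D* s i)))))

  ≋⇒≋ : ∀ {p q} → p Z.≋ q → p F.≋ q
  ≋⇒≋ eq = ≡ᴰ⇒≋ (≈⇒≡ᴰ eq)

  private
    divideByD : ∀ r → (∀ i → Z.coeff r i ≈ᵈ + 0) → ∃ λ s → r Z.≋ Z.scale (+ d) s
    divideByD []      h = [] , Z.≋-refl
    divideByD (x ∷ r) h with ≈ᵈ⇒∃ {x} {+ 0} (h 0) | divideByD r (λ i → h (suc i))
    ... | z , eq | s , eq′ = z ∷ s , Z.∷-cong (≡.trans eq (ℤ.+-identityˡ (+ d ℤ.* z))) eq′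

  ≋⇒≡ᴰ : ∀ {p q} → p F.≋ q → p ≡ᴰ q
  ≋⇒≡ᴰ {p} {q} h = let s , eq = divideByD (p Z.-ₚ q) small in mod s (begin
    p                            ≈⟨ ≈+[-] p q ⟩
    q Z.+ₚ (p Z.-ₚ q)            ≈⟨ Z.+ₚ-cong Z.≋-refl eq ⟩
    q Z.+ₚ Z.scale (+ d) s       ≈⟨ Z.+ₚ-cong Z.≋-refl (Z.const-*ₚ (+ d) s) ⟨
    q Z.+ₚ Z.const (+ d) Z.*ₚ s  ≈⟨ Z.+ₚ-cong Z.≋-refl (Z.*ₚ-cong D≋ Z.≋-refl) ⟨
    q Z.+ₚ D Z.*ₚ s              ∎)
    where
    open SetoidReasoning Z.≋-setoid
    small : ∀ i → Z.coeff (p Z.-ₚ q) i ≈ᵈ + 0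
    small i = ≡.subst (+ d ℤ.∣_)
      (≡.sym (≡.trans (ℤ.+-identityʳ _) (≡.trans (Z.coeff-+ p (Z.-ₚ q) i)
        (≡.cong (λ z → Z.coeff p i ℤ.+ z) (Z.coeff-neg q i)))))
      (≡.subst₂ _≈ᵈ_ (coeffF≡ p i) (coeffF≡ q i) (F.at h i))

  *⇒F : ∀ {p q r} → p ≡ᴰ q Z.*ₚ r → p F.≋ q F.*ₚ r
  *⇒F {p} {q} {r} h = ≡.subst (p F.≋_) (≡.sym (*F≡ q r)) (≡ᴰ⇒≋ h)

  *⇐F : ∀ {p q r} → p F.≋ q F.*ₚ r → p ≡ᴰ q Z.*ₚ r
  *⇐F {p} {q} {r} h = ≋⇒≡ᴰ (≡.subst (p F.≋_) (*F≡ q r) h)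

  F-domain : ∀ {p q} → p Z.*ₚ q ≡ᴰ [] → p F.≋ [] ⊎ q ≡ᴰ []
  F-domain {p} {q} h = Sum.map₂ ≋⇒≡ᴰ
    (FE.noZeroDivisors {p} {q} (≡.subst (F._≋ []) (≡.sym (*F≡ p q)) (≡ᴰ⇒≋ h)))

  ≉[]⇒cancel : ∀ {x} → ¬ x Z.≋ [] → E.Cancel x
  ≉[]⇒cancel {x} ne {y} {z} h =
    [ (λ x≋[] → contradiction x≋[] ne)
    , (λ k → Z.≋-trans (≈+[-] y z) (Z.≋-trans (Z.+ₚ-cong Z.≋-refl k) (Z.+ₚ-identityʳ z)))
    ]′ (ZD.noZeroDivisors {x} {y Z.-ₚ z} (*-difference {x} {y} {z} (Z.≋-trans h (Z.≋-sym (Z.+ₚ-identityʳ _)))))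

  ≉F[]⇒cancel : ∀ {x} → ¬ x F.≋ [] → D.Cancel x
  ≉F[]⇒cancel {x} ne {y} {z} (mod w h) =
    [ (λ x≋[] → contradiction x≋[] ne)
    , (λ (mod v k) → mod v (Z.≋-trans (≈+[-] y z) (Z.+ₚ-cong Z.≋-refl k)))
    ]′ (F-domain {x} {y Z.-ₚ z} (mod w (*-difference {x} {y} {z} h)))

  Monic⇒≉F[] : ∀ {p n} → Z.Monic p n → ¬ p F.≋ []
  Monic⇒≉F[] {p} {n} l h = 1≉0 prime (≡.subst (_≈ᵈ + 0) (≡.trans (coeffF≡ p n) (Z.top l)) (F.at h n))

  Monic⇒≉[] : ∀ {p n} → Z.Monic p n → ¬ p Z.≋ []
  Monic⇒≉[] l h = Monic⇒≉F[] l (≋⇒≋ h)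

  D≉[] : ¬ D Z.≋ []
  D≉[] h = contradiction (Z.at (Z.≋-trans (Z.≋-sym D≋) h) 0) λ ()

  ^≡^ₚ : ∀ p n → p Z.^ₚ n ≡ p ^ n
  ^≡^ₚ p zero    = ≡.refl
  ^≡^ₚ p (suc n) = ≡.cong (p Z.*ₚ_) (^≡^ₚ p n)

  orbit≡a : ∀ k → orbit d k ≡ a k
  orbit≡a zero    = ≡.refl
  orbit≡a (suc k) = ≡.cong (Z._+ₚ Z.X) (≡.trans (^≡^ₚ (orbit d k) d) (≡.cong (_^ d) (orbit≡a k)))

  Monic-a : ∀ k → Z.Monic (a (suc k)) (d ℕ.^ k)
  Monic-a zero    = Z.Lead-X
  -- The power has degree d · d^k ≥ 2, so adding `X` does not touch its leading term.
  Monic-a (suc k) = Z.Lead-+ (≡.subst (λ p → Z.Monic p (d ℕ.* d ℕ.^ k)) (^≡^ₚ (a (suc k)) d) (Z.Monic-^ d (Monic-a k)))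
    (Z.Deg<-mono {Z.X} (ℕ.*-mono-≤ {2} {d} (s≤s (s≤s z≤n)) (ℕ.m^n>0 d k)) (Z.above Z.Lead-X))

  ε≋ : ∀ k j → a (j ℕ.+ k) Z.-ₚ a j Z.≋ ε k j
  ε≋ k j = +-difference (a-shift k j)

  -- The degree of a_{j+k} exceeds that of a_j, so the difference inherits its leading term. From
  -- this come the cancellations and the monicity of G.
  Monic-ε : ∀ j {k} → 1 ≤ k → Z.Monic (ε k j) (d ℕ.^ ℕ.pred (j ℕ.+ k))
  Monic-ε zero    {suc k} _   = Monic-a k
  Monic-ε (suc j) {k}     1≤k = Z.Lead-resp (ε≋ k (suc j))
    (Z.Lead-+ (Monic-a (j ℕ.+ k)) (Z.Deg<-neg {a (suc j)}
      (Z.Deg<-mono {a (suc j)} (ℕ.^-monoʳ-< d (s≤s (s≤s z≤n)) (ℕ.m<m+n j 1≤k)) (Z.above (Monic-a j)))))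

  ε-cancel : ∀ j {k} → 1 ≤ k → E.Cancel (ε k j)
  ε-cancel j 1≤k = ≉[]⇒cancel (Monic⇒≉[] (Monic-ε j 1≤k))

  a-cancelD : ∀ {k} → 1 ≤ k → D.Cancel (a k)
  a-cancelD {suc k} _ = ≉F[]⇒cancel (Monic⇒≉F[] (Monic-a k))

  NonConstant⇒≉F[] : ∀ {q} → F.NonConstant q → ¬ q F.≋ []
  NonConstant⇒≉F[] (i , _ , ne) z = ne (F.at z i)

  -- Membership in (q, d) is stated as divisibility by q over 𝔽_d, where it is decidable and
  -- Euclid's lemma makes it prime. Membership in the square is stated over ℤ by an explicit
  -- quadratic representation, since it is lost on reducing modulo d.
  primeWithSquare : ∀ q → F.Irreducible q → PrimeWithSquare
  primeWithSquare q irr = record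
    { 𝔭 = 𝔭 ; 𝔮 = 𝔮
    ; 𝔭-resp   = λ eq (s , h) → s , F.≋-trans (F.≋-sym (≋⇒≋ eq)) h
    ; 𝔭-+      = λ {x} {y} (s , h) (t , k) → s F.+ₚ t , ≡.subst (F._≋ q F.*ₚ (s F.+ₚ t)) (+F≡ x y)
                   (F.≋-trans (F.+ₚ-cong h k) (F.≋-sym (F.*ₚ-distribˡ q s t)))
    ; 𝔭-*      = λ {x} y (s , h) → s F.*ₚ y , ≡.subst (F._≋ q F.*ₚ (s F.*ₚ y)) (*F≡ x y)
                   (F.≋-trans (F.*ₚ-cong h F.≋-refl) (F.*ₚ-assoc q s y))
    ; 𝔭-prime  = λ {x} {y} h → FE.Irreducible⇒prime {q} irr {x} {y} (≡.subst 𝔭 (≡.sym (*F≡ x y)) h)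
    ; 𝔭-proper = λ (s , h) → FE.NonConstant⇒¬unit {q} (proj₁ irr) s (F.≋-trans (F.*ₚ-comm s q) (F.≋-sym h))
    ; 𝔭?       = 𝔭?
    ; 𝔭-D      = [] , F.≋-trans (≡ᴰ⇒≋ D≡ᴰ[]) (F.≋-sym (F.*ₚ-zeroʳ q))
    ; 𝔮-resp   = λ eq (α , β , γ , h) → α , β , γ , Z.≋-trans (Z.≋-sym eq) h
    ; 𝔮-+      = λ (α , β , γ , h) (α′ , β′ , γ′ , h′) → _ , _ , _ ,
                   Z.≋-trans (Z.+ₚ-cong h h′) (quadratic-+ α β γ α′ β′ γ′)
    ; 𝔮-*      = λ y (α , β , γ , h) → _ , _ , _ ,
                   Z.≋-trans (Z.*ₚ-cong h Z.≋-refl) (quadratic-* α β γ y)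
    ; 𝔭𝔭⇒𝔮    = 𝔭𝔭⇒𝔮
    ; 𝔮⇒𝔭     = λ (α , β , γ , h) → q Z.*ₚ α , *⇒F {q = q} {r = q Z.*ₚ α} (mod (q Z.*ₚ β Z.+ₚ D Z.*ₚ γ)
                   (Z.≋-trans h (Z.≋-trans (quadratic-modD α β γ) (Z.+ₚ-cong (Z.*ₚ-assoc q q α) Z.≋-refl))))
    ; 𝔮-D*     = 𝔮-D* }
    where
    open Square q

    𝔭 𝔮 : Z.Pol → Set
    𝔭 x = q FE.∣ₚ x
    𝔮 x = ∃ λ α → ∃ λ β → ∃ λ γ → x Z.≋ quadratic α β γ

    D≡ᴰ[] : D ≡ᴰ []
    D≡ᴰ[] = mod Z.oneₚ (Z.≋-sym (P.*-identityʳ D))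

    𝔭? : ∀ x → Dec (𝔭 x)
    𝔭? x = [ yes , (λ c → no λ h → FE.∣⇒¬coprime {q} {x} (proj₁ irr) h c) ]′
             (FE.Irreducible⇒∣⊎coprime {q} irr x)

    𝔭𝔭⇒𝔮 : ∀ {x y} → 𝔭 x → 𝔭 y → 𝔮 (x Z.*ₚ y)
    𝔭𝔭⇒𝔮 {x} {y} (s , h) (t , k) =
      let mod u f = *⇐F {x} {q} {s} h
          mod v g = *⇐F {y} {q} {t} k
      in _ , _ , _ , Z.≋-trans (Z.*ₚ-cong f g) (linear*linear s t u v)

    q≉ : ¬ q F.≋ []
    q≉ = NonConstant⇒≉F[] {q} (proj₁ irr)

    -- If D x = q² α + q D β + D² γ, then q² α vanishes modulo D, hence so does α. With α = D α′,
    -- cancelling D leaves x = q (q α′ + β) + D γ.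
    𝔮-D* : ∀ {x} → 𝔮 (D Z.*ₚ x) → 𝔭 x
    𝔮-D* {x} (α , β , γ , h) =
      let mod α′ k = D.cancel-* {q} {q} (≉F[]⇒cancel q≉) (≉F[]⇒cancel q≉) {α} {[]}
                       (≡ᴰ-trans qqα≡ (≈⇒≡ᴰ (Z.≋-sym (Z.*ₚ-zeroʳ (q Z.*ₚ q)))))
      in q Z.*ₚ α′ Z.+ₚ β , *⇒F {q = q} {r = q Z.*ₚ α′ Z.+ₚ β} (mod γ (≉[]⇒cancel D≉[]
           (Z.≋-trans h (Z.≋-trans (Z.+ₚ-cong (Z.+ₚ-cong (Z.*ₚ-congˡ (q Z.*ₚ q) k) Z.≋-refl) Z.≋-refl)
             (quadratic-D* α′ β γ)))))
      where
      qqα≡ : q Z.*ₚ q Z.*ₚ α ≡ᴰ []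
      qqα≡ = ≡ᴰ-trans (≡ᴰ-sym (mod (q Z.*ₚ β Z.+ₚ D Z.*ₚ γ) (Z.≋-trans h (quadratic-modD α β γ))))
                       (mod x Z.≋-refl)

-- Clearing denominators

module Q = PolyRing ℚ.+-*-commutativeRing

φ : ℤ → ℚ
φ z = z ℚ./ 1

private
  open import Data.Integer.Solver using (module +-*-Solver)
  open +-*-Solver

  -- Passing to unnormalised fractions avoids the gcd hidden in `ℚ./`.
  toℚᵘ-φ : ∀ z → toℚᵘ (φ z) ℚᵘ.≃ mkℚᵘ z 0
  toℚᵘ-φ z = ℚ.toℚᵘ-fromℚᵘ (mkℚᵘ z 0)

φ-+ : ∀ x y → φ (x ℤ.+ y) ≡ φ x ℚ.+ φ y
φ-+ x y = ℚ.toℚᵘ-injective (begin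
  toℚᵘ (φ (x ℤ.+ y))               ≈⟨ toℚᵘ-φ (x ℤ.+ y) ⟩
  mkℚᵘ (x ℤ.+ y) 0                 ≈⟨ *≡* (solve 2 (λ x y → (x :+ y) :* con (+ 1) := (x :* con (+ 1) :+ y :* con (+ 1)) :* con (+ 1)) ≡.refl x y) ⟩
  mkℚᵘ x 0 ℚᵘ.+ mkℚᵘ y 0           ≈⟨ ℚᵘ.+-cong (toℚᵘ-φ x) (toℚᵘ-φ y) ⟨
  toℚᵘ (φ x) ℚᵘ.+ toℚᵘ (φ y)       ≈⟨ ℚ.toℚᵘ-homo-+ (φ x) (φ y) ⟨
  toℚᵘ (φ x ℚ.+ φ y)               ∎)
  where open SetoidReasoning ℚᵘ.≃-setoid

φ-* : ∀ x y → φ (x ℤ.* y) ≡ φ x ℚ.* φ y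
φ-* x y = ℚ.toℚᵘ-injective (begin
  toℚᵘ (φ (x ℤ.* y))               ≈⟨ toℚᵘ-φ (x ℤ.* y) ⟩
  mkℚᵘ x 0 ℚᵘ.* mkℚᵘ y 0           ≈⟨ ℚᵘ.*-cong (toℚᵘ-φ x) (toℚᵘ-φ y) ⟨
  toℚᵘ (φ x) ℚᵘ.* toℚᵘ (φ y)       ≈⟨ ℚ.toℚᵘ-homo-* (φ x) (φ y) ⟨
  toℚᵘ (φ x ℚ.* φ y)               ∎)
  where open SetoidReasoning ℚᵘ.≃-setoid

φ-injective : ∀ {x y} → φ x ≡ φ y → x ≡ y
φ-injective {x} {y} eq with ℚ.fromℚᵘ-injective {mkℚᵘ x 0} {mkℚᵘ y 0} eq
... | *≡* h = ≡.trans (≡.sym (ℤ.*-identityʳ x)) (≡.trans h (ℤ.*-identityʳ y))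

φ-denominator : ∀ x → φ (↧ x) ℚ.* x ≡ φ (↥ x)
φ-denominator x@record{} = ℚ.toℚᵘ-injective (begin
  toℚᵘ (φ (↧ x) ℚ.* x)              ≈⟨ ℚ.toℚᵘ-homo-* (φ (↧ x)) x ⟩
  toℚᵘ (φ (↧ x)) ℚᵘ.* toℚᵘ x        ≈⟨ ℚᵘ.*-cong (toℚᵘ-φ (↧ x)) (ℚᵘ.≃-refl {toℚᵘ x}) ⟩
  mkℚᵘ (↧ x) 0 ℚᵘ.* toℚᵘ x          ≈⟨ *≡* (≡.trans (≡.cong (ℤ._* + 1) (ℤ.*-comm (↧ x) (↥ x)))
                                        (≡.trans (ℤ.*-assoc (↥ x) (↧ x) (+ 1)) (≡.cong (↥ x ℤ.*_) (ℤ.*-comm (↧ x) (+ 1))))) ⟩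
  mkℚᵘ (↥ x) 0                      ≈⟨ toℚᵘ-φ (↥ x) ⟨
  toℚᵘ (φ (↥ x))                    ∎)
  where open SetoidReasoning ℚᵘ.≃-setoid

φ*≡0 : ∀ {N x} → N ≢ + 0 → φ N ℚ.* x ≡ ℚ.0ℚ → x ≡ ℚ.0ℚ
φ*≡0 {N} {x} N≢0 eq with ℤ.i*j≡0⇒i≡0∨j≡0 N (φ-injective {N ℤ.* ↥ x} {+ 0} (begin
  φ (N ℤ.* ↥ x)              ≡⟨ φ-* N (↥ x) ⟩
  φ N ℚ.* φ (↥ x)            ≡⟨ ≡.cong (φ N ℚ.*_) (φ-denominator x) ⟨
  φ N ℚ.* (φ (↧ x) ℚ.* x)    ≡⟨ ≡.cong (φ N ℚ.*_) (ℚ.*-comm (φ (↧ x)) x) ⟩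
  φ N ℚ.* (x ℚ.* φ (↧ x))    ≡⟨ ℚ.*-assoc (φ N) x (φ (↧ x)) ⟨
  φ N ℚ.* x ℚ.* φ (↧ x)      ≡⟨ ≡.cong (ℚ._* φ (↧ x)) eq ⟩
  ℚ.0ℚ ℚ.* φ (↧ x)           ≡⟨ ℚ.*-zeroˡ (φ (↧ x)) ⟩
  ℚ.0ℚ                       ∎))
  where open ≡.≡-Reasoning
... | inj₁ N≡0 = contradiction N≡0 N≢0
... | inj₂ ↥x≡0 = ℚ.↥p≡0⇒p≡0 x ↥x≡0

coeff-φ : ∀ p i → Q.coeff (map φ p) i ≡ φ (Z.coeff p i)
coeff-φ []      i       = ≡.refl
coeff-φ (a ∷ p) zero    = ≡.refl
coeff-φ (a ∷ p) (suc i) = coeff-φ p i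

map-φ-cong : ∀ {p q} → p Z.≋ q → map φ p Q.≋ map φ q
map-φ-cong {p} {q} e = Q.mk λ i → ≡.trans (coeff-φ p i) (≡.trans (≡.cong φ (Z.at e i)) (≡.sym (coeff-φ q i)))

map-φ-injective : ∀ {p q} → map φ p Q.≋ map φ q → p Z.≋ q
map-φ-injective {p} {q} e = Z.mk λ i → φ-injective (≡.trans (≡.sym (coeff-φ p i)) (≡.trans (Q.at e i) (coeff-φ q i)))

map-φ-+ : ∀ p q → map φ (p Z.+ₚ q) ≡ map φ p Q.+ₚ map φ q
map-φ-+ []      q       = ≡.refl
map-φ-+ (a ∷ p) []      = ≡.refl
map-φ-+ (a ∷ p) (b ∷ q) = ≡.cong₂ _∷_ (φ-+ a b) (map-φ-+ p q)

map-φ-scale : ∀ a p → map φ (Z.scale a p) ≡ Q.scale (φ a) (map φ p)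
map-φ-scale a []      = ≡.refl
map-φ-scale a (b ∷ p) = ≡.cong₂ _∷_ (φ-* a b) (map-φ-scale a p)

map-φ-* : ∀ p q → map φ (p Z.*ₚ q) ≡ map φ p Q.*ₚ map φ q
map-φ-* []      q = ≡.refl
map-φ-* (a ∷ p) q = ≡.trans (map-φ-+ (Z.scale a q) (+ 0 ∷ (p Z.*ₚ q)))
  (≡.cong₂ Q._+ₚ_ (map-φ-scale a q) (≡.cong (φ (+ 0) ∷_) (map-φ-* p q)))

clearDenominators : ∀ h → ∃ λ N → ∃ λ H → N ≢ + 0 × Q.const (φ N) Q.*ₚ h Q.≋ map φ H
clearDenominators h with go h
  where
  go : ∀ h → ∃ λ N → ∃ λ H → N ≢ + 0 × Q.scale (φ N) h Q.≋ map φ H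
  go []      = + 1 , [] , (λ ()) , Q.≋-refl
  go (x ∷ h) with go h
  ... | N , H , N≢0 , eq = N ℤ.* ↧ x , N ℤ.* ↥ x ∷ Z.scale (↧ x) H , NM≢0 , Q.∷-cong head tail
    where
    NM≢0 : N ℤ.* ↧ x ≢ + 0
    NM≢0 z with ℤ.i*j≡0⇒i≡0∨j≡0 N z
    ... | inj₁ e = N≢0 e
    ... | inj₂ ()
    open ≡.≡-Reasoning
    head : φ (N ℤ.* ↧ x) ℚ.* x ≡ φ (N ℤ.* ↥ x)
    head = begin
      φ (N ℤ.* ↧ x) ℚ.* x        ≡⟨ ≡.cong (ℚ._* x) (φ-* N (↧ x)) ⟩
      φ N ℚ.* φ (↧ x) ℚ.* x      ≡⟨ ℚ.*-assoc (φ N) (φ (↧ x)) x ⟩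
      φ N ℚ.* (φ (↧ x) ℚ.* x)    ≡⟨ ≡.cong (φ N ℚ.*_) (φ-denominator x) ⟩
      φ N ℚ.* φ (↥ x)            ≡⟨ φ-* N (↥ x) ⟨
      φ (N ℤ.* ↥ x)              ∎
    tail : Q.scale (φ (N ℤ.* ↧ x)) h Q.≋ map φ (Z.scale (↧ x) H)
    tail = Q.≋-trans (Q.scale-cong (≡.trans (≡.cong φ (ℤ.*-comm N (↧ x))) (φ-* (↧ x) N)) Q.≋-refl)
      (Q.≋-trans (Q.scale-scale (φ (↧ x)) (φ N) h) (Q.≋-trans (Q.scale-cong {φ (↧ x)} ≡.refl eq)
        (Q.mk λ i → ≡.cong (λ p → Q.coeff p i) (≡.sym (map-φ-scale (↧ x) H)))))
... | N , H , N≢0 , eq = N , H , N≢0 , Q.≋-trans (Q.const-*ₚ (φ N) h) eq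

-- Comparing rational factors with factors modulo d

module Counting {e : ℕ} (prime : Prime (2 ℕ.+ e)) where
  open ModPrime prime
  open import Data.Integer using (∣_∣)

  -- Primitive at d only: the part must be nonzero modulo d, while other common divisors of its
  -- coefficients may remain.
  record PrimitivePart (H : Z.Pol) : Set where
    field
      content    : ℤ
      part       : Z.Pol
      factors    : H Z.≋ Z.const content Z.*ₚ part
      nonzero    : ¬ part F.≋ []

  private
    const-d* : ∀ S → D Z.*ₚ S Z.≋ Z.const (+ d) Z.*ₚ S
    const-d* S = Z.*ₚ-cong D≋ Z.≋-refl

    ≡ᴰ[]⇒ : ∀ {H} → H ≡ᴰ [] → ∃ λ S → H Z.≋ Z.const (+ d) Z.*ₚ S
    ≡ᴰ[]⇒ (mod S eq) = S , Z.≋-trans eq (const-d* S)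

    smaller : ∀ z {n} → z ≢ + 0 → ∣ + d ℤ.* z ∣ ≤ suc n → ∣ z ∣ ≤ n
    smaller z z≢0 le = ℕ.≤-pred (ℕ.<-≤-trans
      (ℕ.m<m*n ∣ z ∣ d {{ℕ.>-nonZero (ℕ.n≢0⇒n>0 (z≢0 ∘ ℤ.∣i∣≡0⇒i≡0))}} (s≤s (s≤s z≤n)))
      (≡.subst (_≤ _) (≡.trans (ℤ.abs-* (+ d) z) (ℕ.*-comm d ∣ z ∣)) le))

    -- Each division by d shrinks a fixed nonzero coefficient, whose absolute value bounds the
    -- recursion.
    primitivePart′ : ∀ n H i → Z.coeff H i ≢ + 0 → ∣ Z.coeff H i ∣ ≤ n → PrimitivePart H
    primitivePart′ zero    H i ne le = contradiction (ℤ.∣i∣≡0⇒i≡0 (ℕ.n≤0⇒n≡0 le)) ne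
    primitivePart′ (suc n) H i ne le = [ divisible , indivisible ]′ (FE.degree? H)
      where
      indivisible : ∃ (FE.HasDegree H) → PrimitivePart H
      indivisible (_ , deg) = record
        { content = + 1 ; part = H ; factors = Z.≋-sym (Z.*ₚ-identityˡ H) ; nonzero = FE.degree≉[] deg }
      divisible : H F.≋ [] → PrimitivePart H
      divisible z = record
        { content = + d ℤ.* content ; part = part
        ; factors = Z.≋-trans eq (Z.≋-trans (Z.*ₚ-congˡ (Z.const (+ d)) factors) (Z.≋-sym (Z.const-assoc (+ d) content part)))
        ; nonzero = nonzero }
        where
        S  = proj₁ (≡ᴰ[]⇒ (≋⇒≡ᴰ z))
        eq = proj₂ (≡ᴰ[]⇒ (≋⇒≡ᴰ z))
        coeff≡ : Z.coeff H i ≡ + d ℤ.* Z.coeff S i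
        coeff≡ = ≡.trans (Z.at eq i) (Z.coeff-const-* (+ d) S i)
        ne′ : Z.coeff S i ≢ + 0
        ne′ z = ne (≡.trans coeff≡ (≡.trans (≡.cong (+ d ℤ.*_) z) (ℤ.*-zeroʳ (+ d))))
        open PrimitivePart (primitivePart′ n S i ne′
          (smaller (Z.coeff S i) ne′ (≡.subst (λ z → ∣ z ∣ ≤ suc n) coeff≡ le)))

  record IntegralFactor (h : Q.Pol) : Set where
    field
      denominator numerator : ℤ
      factor      : Z.Pol
      denominator≢0 : denominator ≢ + 0
      clears      : Q.const (φ denominator) Q.*ₚ h Q.≋ map φ (Z.const numerator Z.*ₚ factor)
      nonzero     : ¬ factor F.≋ []
      nonConstant : Z.NonConstant factor

  integralFactor : ∀ {h} → Q.NonConstant h → IntegralFactor h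
  integralFactor {h} (i , 1≤i , hᵢ≢0) = record
    { denominator = N ; numerator = content ; factor = part ; denominator≢0 = N≢0
    ; clears = Q.≋-trans eq (map-φ-cong factors) ; nonzero = nonzero
    ; nonConstant = i , 1≤i , λ z → Hᵢ≢0 (≡.trans (Z.at factors i)
        (≡.trans (Z.coeff-const-* content part i) (≡.trans (≡.cong (content ℤ.*_) z) (ℤ.*-zeroʳ content)))) }
    where
    cleared = clearDenominators h
    N   = proj₁ cleared
    H   = proj₁ (proj₂ cleared)
    N≢0 = proj₁ (proj₂ (proj₂ cleared))
    eq  = proj₂ (proj₂ (proj₂ cleared))
    Hᵢ≢0 : Z.coeff H i ≢ + 0
    Hᵢ≢0 z = hᵢ≢0 (φ*≡0 N≢0 (≡.trans (≡.sym (Q.coeff-const-* (φ N) h i))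
      (≡.trans (Q.at eq i) (≡.trans (coeff-φ H i) (≡.cong φ z)))))
    open PrimitivePart (primitivePart′ ∣ Z.coeff H i ∣ H i Hᵢ≢0 ℕ.≤-refl)

  IsFactor : Z.Pol → Set
  IsFactor H = ¬ H F.≋ [] × Z.NonConstant H

  record IntegralFactors (hs : List Q.Pol) : Set where
    field
      denominator numerator : ℤ
      factors       : List Z.Pol
      denominator≢0 : denominator ≢ + 0
      clears        : Q.const (φ denominator) Q.*ₚ Q.prodₚ hs Q.≋ map φ (Z.const numerator Z.*ₚ Z.prodₚ factors)
      areFactors    : All IsFactor factors
      sameLength    : length factors ≡ length hs

  integralFactors : ∀ {hs} → All Q.NonConstant hs → IntegralFactors hs
  integralFactors [] = record
    { denominator = + 1 ; numerator = + 1 ; factors = [] ; denominator≢0 = λ ()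
    ; clears = Q.mk λ { zero → ≡.refl ; (suc i) → ≡.refl } ; areFactors = [] ; sameLength = ≡.refl }
  integralFactors {h ∷ hs} (nc ∷ ncs) = record
    { denominator = s ℤ.* s′ ; numerator = t ℤ.* t′ ; factors = H ∷ Hs
    ; denominator≢0 = λ z → [ f.denominator≢0 , fs.denominator≢0 ]′ (ℤ.i*j≡0⇒i≡0∨j≡0 s z)
    ; clears = begin
        Q.const (φ (s ℤ.* s′)) Q.*ₚ (h Q.*ₚ Q.prodₚ hs)
          ≈⟨ Q.*ₚ-cong (Q.const-cong (φ-* s s′)) Q.≋-refl ⟩
        Q.const (φ s ℚ.* φ s′) Q.*ₚ (h Q.*ₚ Q.prodₚ hs)
          ≈⟨ Q.const-interchange (φ s) (φ s′) h (Q.prodₚ hs) ⟩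
        (Q.const (φ s) Q.*ₚ h) Q.*ₚ (Q.const (φ s′) Q.*ₚ Q.prodₚ hs)
          ≈⟨ Q.*ₚ-cong f.clears fs.clears ⟩
        map φ (Z.const t Z.*ₚ H) Q.*ₚ map φ (Z.const t′ Z.*ₚ Z.prodₚ Hs)
          ≡⟨ map-φ-* (Z.const t Z.*ₚ H) (Z.const t′ Z.*ₚ Z.prodₚ Hs) ⟨
        map φ ((Z.const t Z.*ₚ H) Z.*ₚ (Z.const t′ Z.*ₚ Z.prodₚ Hs))
          ≈⟨ map-φ-cong (Z.const-interchange t t′ H (Z.prodₚ Hs)) ⟨
        map φ (Z.const (t ℤ.* t′) Z.*ₚ (H Z.*ₚ Z.prodₚ Hs)) ∎
    ; areFactors = (f.nonzero , f.nonConstant) ∷ fs.areFactors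
    ; sameLength = ≡.cong suc fs.sameLength }
    where
    module f  = IntegralFactor (integralFactor {h} nc)
    module fs = IntegralFactors (integralFactors ncs)
    s  = f.denominator
    s′ = fs.denominator
    t  = f.numerator
    t′ = fs.numerator
    H  = f.factor
    Hs = fs.factors
    open SetoidReasoning Q.≋-setoid

  integralEquation : ∀ {G hs u} (fs : IntegralFactors hs) → Q.const u Q.*ₚ Q.prodₚ hs Q.≋ map φ G →
    let open IntegralFactors fs in
    ∃ λ W → ∃ λ V → W ≢ + 0 × Z.const W Z.*ₚ G Z.≋ Z.const V Z.*ₚ Z.prodₚ factors
  integralEquation {G} {hs} {u} fs eq = ↧ u ℤ.* s , ↥ u ℤ.* t
    , (λ z → [ (λ ()) , denominator≢0 ]′ (ℤ.i*j≡0⇒i≡0∨j≡0 (↧ u) z))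
    , map-φ-injective (begin
        map φ (Z.const (↧ u ℤ.* s) Z.*ₚ G)
          ≡⟨ map-φ-* (Z.const (↧ u ℤ.* s)) G ⟩
        Q.const (φ (↧ u ℤ.* s)) Q.*ₚ map φ G
          ≈⟨ Q.*ₚ-cong (Q.const-cong (φ-* (↧ u) s)) (Q.≋-sym eq) ⟩
        Q.const (φ (↧ u) ℚ.* φ s) Q.*ₚ (Q.const u Q.*ₚ Q.prodₚ hs)
          ≈⟨ Q.const-interchange (φ (↧ u)) (φ s) (Q.const u) (Q.prodₚ hs) ⟩
        (Q.const (φ (↧ u)) Q.*ₚ Q.const u) Q.*ₚ (Q.const (φ s) Q.*ₚ Q.prodₚ hs)
          ≈⟨ Q.*ₚ-cong (Q.≋-trans (Q.const-*ₚ (φ (↧ u)) (Q.const u)) (Q.const-cong (φ-denominator u))) clears ⟩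
        map φ (Z.const (↥ u)) Q.*ₚ map φ (Z.const t Z.*ₚ Z.prodₚ factors)
          ≡⟨ map-φ-* (Z.const (↥ u)) (Z.const t Z.*ₚ Z.prodₚ factors) ⟨
        map φ (Z.const (↥ u) Z.*ₚ (Z.const t Z.*ₚ Z.prodₚ factors))
          ≈⟨ map-φ-cong (Z.const-assoc (↥ u) t (Z.prodₚ factors)) ⟨
        map φ (Z.const (↥ u ℤ.* t) Z.*ₚ Z.prodₚ factors) ∎)
    where
    open IntegralFactors fs renaming (denominator to s; numerator to t)
    open SetoidReasoning Q.≋-setoid

  private
    prod≢ : ∀ {Hs} → All IsFactor Hs → ¬ Z.prodₚ Hs ≡ᴰ []
    prod≢ []             h = 1≉0 prime (F.at (≡ᴰ⇒≋ h) 0)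
    prod≢ {H ∷ Hs} ((ne , _) ∷ fs) h = [ ne , prod≢ fs ]′ (F-domain {H} {Z.prodₚ Hs} h)

    const≡ᴰ[] : ∀ {w} → w ≈ᵈ + 0 → Z.const w ≡ᴰ []
    const≡ᴰ[] z = ≋⇒≡ᴰ (F.const≋[] z)

    const≡ᴰ[]⁻ : ∀ {w} → Z.const w F.≋ [] → w ≈ᵈ + 0
    const≡ᴰ[]⁻ h = F.at h 0

    multiple : ∀ {w} → w ≈ᵈ + 0 → ∃ λ w′ → w ≡ + d ℤ.* w′
    multiple {w} z = let w′ , eq = ≈ᵈ⇒∃ {w} {+ 0} z in w′ , ≡.trans eq (ℤ.+-identityˡ (+ d ℤ.* w′))

  -- Gauss's lemma at the prime d: the powers of d in W and V cancel.
  cancelPrime : ∀ n {G Hs W V} → All IsFactor Hs → W ≢ + 0 → ∣ W ∣ ≤ n →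
    Z.const W Z.*ₚ G Z.≋ Z.const V Z.*ₚ Z.prodₚ Hs →
    ∃ λ W′ → ∃ λ V′ → ¬ W′ ≈ᵈ + 0 × Z.const W′ Z.*ₚ G Z.≋ Z.const V′ Z.*ₚ Z.prodₚ Hs
  cancelPrime zero    fs W≢0 le eq = contradiction (ℤ.∣i∣≡0⇒i≡0 (ℕ.n≤0⇒n≡0 le)) W≢0
  cancelPrime (suc n) {G} {Hs} {W} {V} fs W≢0 le eq = decide (≈ᵈ0? W)
    where
    Goal = ∃ λ W′ → ∃ λ V′ → ¬ W′ ≈ᵈ + 0 × Z.const W′ Z.*ₚ G Z.≋ Z.const V′ Z.*ₚ Z.prodₚ Hs
    divisible : (∃ λ W′ → W ≡ + d ℤ.* W′) → (∃ λ V′ → V ≡ + d ℤ.* V′) → Goal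
    divisible (W′ , W≡) (V′ , V≡) = cancelPrime n {V = V′} fs W′≢0
      (smaller W′ W′≢0 (≡.subst (λ z → ∣ z ∣ ≤ suc n) W≡ le))
      (≉[]⇒cancel {Z.const (+ d)} (λ z → D≉[] (Z.≋-trans D≋ z)) (begin
        Z.const (+ d) Z.*ₚ (Z.const W′ Z.*ₚ G)            ≈⟨ Z.const-assoc (+ d) W′ G ⟨
        Z.const (+ d ℤ.* W′) Z.*ₚ G                       ≡⟨ ≡.cong (λ z → Z.const z Z.*ₚ G) W≡ ⟨
        Z.const W Z.*ₚ G                                  ≈⟨ eq ⟩
        Z.const V Z.*ₚ Z.prodₚ Hs                         ≡⟨ ≡.cong (λ z → Z.const z Z.*ₚ Z.prodₚ Hs) V≡ ⟩
        Z.const (+ d ℤ.* V′) Z.*ₚ Z.prodₚ Hs              ≈⟨ Z.const-assoc (+ d) V′ (Z.prodₚ Hs) ⟩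
        Z.const (+ d) Z.*ₚ (Z.const V′ Z.*ₚ Z.prodₚ Hs)   ∎))
      where
      open SetoidReasoning Z.≋-setoid
      W′≢0 : W′ ≢ + 0
      W′≢0 z = W≢0 (≡.trans W≡ (≡.trans (≡.cong (+ d ℤ.*_) z) (ℤ.*-zeroʳ (+ d))))
    decide : Dec (W ≈ᵈ + 0) → Goal
    decide (no ¬z) = W , V , ¬z , eq
    decide (yes z) = divisible (multiple z) (multiple V≈0)
      -- If d divides W, then V times the product vanishes modulo d. No factor does, so d divides V
      -- and can be cancelled on both sides.
      where
      V≈0 : V ≈ᵈ + 0
      V≈0 = [ const≡ᴰ[]⁻ , (λ p → contradiction p (prod≢ fs)) ]′
        (F-domain {Z.const V} {Z.prodₚ Hs} (≡ᴰ-trans (≈⇒≡ᴰ (Z.≋-sym eq))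
          (*-cong≡ᴰ {Z.const W} {[]} {G} {G} (const≡ᴰ[] z) ≡ᴰ-refl)))

  -- The leading coefficients of H and K multiply to W because G is monic. As d does not divide W,
  -- the leading coefficient of H survives modulo d.
  nonConstantModD : ∀ {G N W H K} → Z.Monic G N → ¬ W ≈ᵈ + 0 → Z.NonConstant H →
    Z.const W Z.*ₚ G Z.≋ H Z.*ₚ K → F.NonConstant H
  nonConstantModD {G} {N} {W} {H} {K} monic W≉0 nc eq = cofactor (ZD.degree? K)
    where
    W≢0 : W ≢ + 0
    W≢0 z = W≉0 (≡⇒≈ᵈ z)
    leadWG : Z.Lead (Z.const W Z.*ₚ G) N (W ℤ.* + 1)
    leadWG = Z.Lead-* (Z.Lead-const W) monic
    degH = ZD.NonConstant⇒degree {H} nc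
    n = proj₁ degH
    ℓ = proj₁ (proj₂ degH)
    ℓ≢0 = proj₁ (proj₂ (proj₂ degH))
    leadH = proj₂ (proj₂ (proj₂ degH))
    degWG : ZD.HasDegree (Z.const W Z.*ₚ G) N
    degWG = W ℤ.* + 1 , (λ z → W≢0 (≡.trans (≡.sym (ℤ.*-identityʳ W)) z)) , leadWG
    cofactor : K Z.≋ [] ⊎ ∃ (ZD.HasDegree K) → F.NonConstant H
    cofactor (inj₁ z) = contradiction
      (Z.≋-trans eq (Z.≋-trans (Z.*ₚ-congˡ H z) (Z.*ₚ-zeroʳ H))) (ZD.degree≉[] degWG)
    cofactor (inj₂ (m , k , k≢0 , leadK)) = suc n , s≤s z≤n , λ z → W≉0 (≡.subst (_≈ᵈ + 0) W≡
      (𝔽.trans {ℓ ℤ.* k} {+ 0 ℤ.* k} {+ 0} (𝔽.*-congʳ {k} {ℓ} {+ 0} (≡.subst (_≈ᵈ + 0) (≡.trans (coeffF≡ H (suc n)) (Z.top leadH)) z))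
        (≡⇒≈ᵈ {+ 0 ℤ.* k} {+ 0} (ℤ.*-zeroˡ k))))
      where
      module 𝔽 = CommutativeRing 𝔽-commutativeRing
      leadHK = Z.Lead-* leadH leadK
      N≡ : N ≡ suc n ℕ.+ m
      N≡ = ZD.degree-unique degWG (ZD.degree-resp (Z.≋-sym eq)
        (ZD.degree-* {H} {K} (ℓ , ℓ≢0 , leadH) (k , k≢0 , leadK)))
      W≡ : ℓ ℤ.* k ≡ W
      W≡ = ≡.trans (≡.sym (Z.top leadHK)) (≡.trans (≡.sym (Z.at eq (suc n ℕ.+ m)))
        (≡.trans (≡.cong (Z.coeff (Z.const W Z.*ₚ G)) (≡.sym N≡)) (≡.trans (Z.top leadWG) (ℤ.*-identityʳ W))))

  -- `W` is the denominator prime to d left over by clearing. Nonconstancy of `A` and `B` lets a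
  -- mere degree count establish the property for linear G.
  NoSharedFactor : Z.Pol → Set
  NoSharedFactor G = ∀ W A B T q → ¬ W ≈ᵈ + 0 → F.Irreducible q → Z.NonConstant A → Z.NonConstant B →
    Z.const W Z.*ₚ G Z.≋ A Z.*ₚ (B Z.*ₚ T) → q FE.∣ₚ A → q FE.∣ₚ B → ⊥

  ^F≡ : ∀ p n → p F.^ₚ n ≡ p Z.^ₚ n
  ^F≡ p zero    = ≡.refl
  ^F≡ p (suc n) = ≡.trans (≡.cong (p F.*ₚ_) (^F≡ p n)) (*F≡ p (p Z.^ₚ n))

  -- Each position in `hs` is matched with a position in `qs` whose q divides the integral factor
  -- modulo d. Asking only for nonconstant factors over ℚ lets the same bound refute a splitting
  -- into two.
  factorCount≤ : ∀ {G₀ G N f} → Z.Monic G N → G F.≋ G₀ F.^ₚ f → NoSharedFactor G →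
    ∀ {hs u} → All Q.NonConstant hs → Q.const u Q.*ₚ Q.prodₚ hs Q.≋ map φ G →
    ∀ {qs v} → All F.Irreducible qs → ¬ v ≈ᵈ + 0 → F.const v F.*ₚ F.prodₚ qs F.≋ G₀ →
    length hs ≤ length qs
  factorCount≤ {G₀} {G} {N} {f} monic G≡ unshared {hs} {u} ncs eqQ {qs} {v} irrs v≉0 eqF =
    ≡.subst (_≤ length qs) sameLength (Möbius.length≤ (λ H q → q FE.∣ₚ H) Hs qs total injective)
    where
    fs = integralFactors ncs
    open IntegralFactors fs renaming (factors to Hs)
    equation = integralEquation {G} {hs} {u} fs eqQ
    reduced = cancelPrime ∣ proj₁ equation ∣ {V = proj₁ (proj₂ equation)} areFactors (proj₁ (proj₂ (proj₂ equation))) ℕ.≤-refl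
                (proj₂ (proj₂ (proj₂ equation)))
    W   = proj₁ reduced
    V   = proj₁ (proj₂ reduced)
    W≉0 = proj₁ (proj₂ (proj₂ reduced))
    eq  = proj₂ (proj₂ (proj₂ reduced))

    V*-comm : ∀ H R → Z.prodₚ Hs Z.≋ H Z.*ₚ R → Z.const W Z.*ₚ G Z.≋ H Z.*ₚ (Z.const V Z.*ₚ R)
    V*-comm H R e = Z.≋-trans eq (Z.≋-trans (Z.*ₚ-congˡ (Z.const V) e) (Z.P-x∙yz≈y∙xz (Z.const V) H R))

    isFactor : ∀ i → IsFactor (lookup Hs i)
    isFactor i = All.lookup areFactors (∈-lookup i)

    total : ∀ i → Any (FE._∣ₚ lookup Hs i) qs
    total i = [ (λ any → any) , (λ coprime → ⊥-elim (absurd coprime)) ]′ (FE.factor⊎coprime irrs H)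
      where
      H = lookup Hs i
      K = Z.const V Z.*ₚ proj₁ (Z.prodₚ-pick Hs i)
      WG≋ : Z.const W Z.*ₚ G Z.≋ H Z.*ₚ K
      WG≋ = V*-comm H (proj₁ (Z.prodₚ-pick Hs i)) (proj₂ (Z.prodₚ-pick Hs i))
      -- A factor coprime to all of `qs` would be coprime to G₀, hence to W G ≡ W G₀^f, which it
      -- divides; yet it is nonconstant modulo d.
      absurd : FE.Coprimeₚ (F.prodₚ qs) H → ⊥
      absurd c = FE.∣⇒¬coprime {H} (nonConstantModD {G} {N} {W} {H} {K} monic W≉0 (proj₂ (isFactor i)) WG≋)
        (K , *⇒F {q = H} {r = K} (≈⇒≡ᴰ WG≋))
        (FE.coprime-sym (FE.coprime-resp
          (F.≋-trans (F.*ₚ-congˡ (F.const W) (F.≋-sym G≡)) (F.≋-sym (*⇒F {q = Z.const W} {r = G} ≡ᴰ-refl)))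
          (FE.coprime-* {F.const W} {G₀ F.^ₚ f} {H} (FE.const-coprime {W} {H} W≉0)
            (FE.coprime-^ f (FE.coprime-resp eqF (FE.coprime-* {F.const v} {F.prodₚ qs} {H} (FE.const-coprime {v} {H} v≉0) c))))))

    injective : ∀ i j l → lookup qs l FE.∣ₚ lookup Hs i → lookup qs l FE.∣ₚ lookup Hs j → i ≡ j
    injective i j l q∣Hi q∣Hj = decide (i Fin.≟ j)
      where
      decide : Dec (i ≡ j) → i ≡ j
      decide (yes i≡j) = i≡j
      decide (no i≢j) = ⊥-elim (unshared W (lookup Hs i) (lookup Hs j) (Z.const V Z.*ₚ proj₁ pick) (lookup qs l) W≉0 (All.lookup irrs (∈-lookup l))
        (proj₂ (isFactor i)) (proj₂ (isFactor j))
        (Z.≋-trans (V*-comm (lookup Hs i) (lookup Hs j Z.*ₚ proj₁ pick) (proj₂ pick)) (Z.*ₚ-congˡ (lookup Hs i) (Z.P-x∙yz≈y∙xz (Z.const V) (lookup Hs j) (proj₁ pick))))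
        q∣Hi q∣Hj)
        where
        pick = Z.prodₚ-pick₂ Hs i j i≢j

-- The Misiurewicz polynomials

module Misiurewicz {e : ℕ} (prime : Prime (2 ℕ.+ e)) where
  open ModPrime prime
  open Counting prime
  open Möbius

  Conclusion : Z.Pol → Z.Pol → Set
  Conclusion G₀ G =
    ((k l : ℕ) → ℚ[c].HasIrreducibleFactorCount (toℚ[c] G) k →
       𝔽[c].HasIrreducibleFactorCount d (reduce d G₀) l → k ≤ l)
    × (𝔽[c].Irreducible d (reduce d G₀) → ℚ[c].Irreducible (toℚ[c] G))

  conclude : ∀ {G₀ G N} → Z.Monic G N → (∃ λ f → G ≡ᴰ G₀ ^ suc f) → NoSharedFactor G → Conclusion G₀ G
  conclude {G₀} {G} {N} monic (f , G≡ᴰ) unshared = count , irreducible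
    where
    G≡ : G F.≋ G₀ F.^ₚ suc f
    G≡ = ≡.subst (G F.≋_) (≡.sym (≡.trans (^F≡ G₀ (suc f)) (^≡^ₚ G₀ (suc f)))) (≡ᴰ⇒≋ G≡ᴰ)

    count : (k l : ℕ) → ℚ[c].HasIrreducibleFactorCount (toℚ[c] G) k →
            𝔽[c].HasIrreducibleFactorCount d (reduce d G₀) l → k ≤ l
    count k l (u , hs , _ , irr , len , eq) (v , qs , v≉0 , irr′ , len′ , eq′) = ≡.subst₂ _≤_ len len′
      (factorCount≤ {G₀} {G} {N} {suc f} monic G≡ unshared {hs} {u} (All.map proj₁ irr) (Q.mk eq) {qs} {v} irr′ v≉0 (F.mk eq′))

    nonConstant : ∀ N → Z.Monic G N → F.NonConstant G₀ → ℚ[c].NonConstant (toℚ[c] G)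
    nonConstant (suc N) monic _ = suc N , s≤s z≤n , λ z →
      contradiction (φ-injective {+ 1} {+ 0} (≡.trans (≡.sym (≡.trans (coeff-φ G (suc N)) (≡.cong φ (Z.top monic)))) z)) λ ()
    -- A monic G of degree 0 is 1, and the positive exponent would make G₀ a unit modulo d.
    nonConstant zero monic nc = ⊥-elim (FE.NonConstant⇒¬unit {G₀} nc (G₀ F.^ₚ f)
      (F.≋-trans (F.*ₚ-comm (G₀ F.^ₚ f) G₀) (F.≋-trans (F.≋-sym G≡)
        (≋⇒≋ (Z.≋-trans (Z.Deg<1⇒≋const (Z.above monic)) (Z.const-cong (Z.top monic)))))))

    irreducible : 𝔽[c].Irreducible d (reduce d G₀) → ℚ[c].Irreducible (toℚ[c] G)
    -- A splitting x y would be two nonconstant factors against the one-element list consisting of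
    -- G₀, that is 2 ≤ 1.
    irreducible irr = nonConstant N monic (proj₁ irr) , λ x y eq (ncx , ncy) → contradiction
      (factorCount≤ {G₀} {G} {N} {suc f} monic G≡ unshared {x ∷ y ∷ []} {ℚ.1ℚ} (ncx ∷ ncy ∷ [])
        (Q.≋-trans (Q.*ₚ-identityˡ (x Q.*ₚ (y Q.*ₚ Q.oneₚ))) (Q.≋-trans
          (Q.*ₚ-congˡ x (CommutativeRing.*-identityʳ Q.polyRing y)) (Q.mk eq)))
        {G₀ ∷ []} {+ 1} (irr ∷ []) (1≉0 prime)
        (F.≋-trans (F.*ₚ-identityˡ (G₀ F.*ₚ F.oneₚ)) (CommutativeRing.*-identityʳ F.polyRing G₀)))
      λ { (s≤s ()) }

  const∉ : ∀ {W q} → F.Irreducible q → ¬ W ≈ᵈ + 0 → ¬ q FE.∣ₚ Z.const W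
  const∉ {W} {q} irr W≉0 h = FE.∣⇒¬coprime {q} {Z.const W} (proj₁ irr) h
    (FE.coprime-sym {Z.const W} {q} (FE.const-coprime {W} {q} W≉0))

  IsMonic : Z.Pol → Set
  IsMonic p = ∃ (Z.Monic p)

  monic-Π : ∀ {f L} → All (λ k → IsMonic (f k)) L → IsMonic (Π f L)
  monic-Π []             = _ , Z.Lead-const (+ 1)
  monic-Π ((_ , m) ∷ ms) = _ , Z.Monic-* m (proj₂ (monic-Π ms))

  monic-* : ∀ {p q} → IsMonic p → IsMonic q → IsMonic (p Z.*ₚ q)
  monic-* (_ , m) (_ , m′) = _ , Z.Monic-* m m′

  monic-quotient : ∀ {G K L} → IsMonic K → IsMonic L → G Z.*ₚ K Z.≋ L → IsMonic G
  monic-quotient {G} {K} {L} (k , mK) (l , mL) eq = degree (ZD.degree? G)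
    where
    degree : G Z.≋ [] ⊎ ∃ (ZD.HasDegree G) → IsMonic G
    degree (inj₁ z) = contradiction (Z.≋-trans (Z.≋-sym eq) (Z.*ₚ-cong z Z.≋-refl)) (Monic⇒≉[] mL)
    degree (inj₂ (n , g , g≢0 , lG)) = n , Z.lead (≡.trans (Z.top lG) g≡1) (Z.above lG)
      where
      lGK : Z.Lead L (n ℕ.+ k) (g ℤ.* + 1)
      lGK = Z.Lead-resp eq (Z.Lead-* lG mK)
      g*1≡g : g ℤ.* + 1 ≡ g
      g*1≡g = ℤ.*-identityʳ g
      l≡ : n ℕ.+ k ≡ l
      l≡ = ZD.degree-unique {L} (g ℤ.* + 1 , (λ z → g≢0 (≡.trans (≡.sym g*1≡g) z)) , lGK) (+ 1 , (λ ()) , mL)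
      g≡1 : g ≡ + 1
      g≡1 = ≡.trans (≡.sym g*1≡g) (≡.trans (≡.sym (Z.top lGK)) (≡.trans (≡.cong (Z.coeff L) l≡) (Z.top mL)))

  -- Two nonconstant factors already have total degree at least 2, so the assumed factorisation
  -- cannot exist.
  degree1⇒unshared : ∀ {G} → Z.Monic G 1 → NoSharedFactor G
  degree1⇒unshared {G} monic W A B T _ W≉0 _ ncA ncB eq _ _ = absurd (ZD.degree? T)
    where
    degA = ZD.NonConstant⇒degree {A} ncA
    degB = ZD.NonConstant⇒degree {B} ncB
    degWG : ZD.HasDegree (Z.const W Z.*ₚ G) 1
    degWG = ZD.degree-* {Z.const W} {G} {0} {1} (W , W≉0 ∘ ≡⇒≈ᵈ , Z.Lead-const W) (+ 1 , (λ ()) , monic)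
    absurd : T Z.≋ [] ⊎ ∃ (ZD.HasDegree T) → ⊥
    absurd (inj₁ z) = ZD.degree≉[] degWG (Z.≋-trans eq (Z.≋-trans
      (Z.*ₚ-congˡ A (Z.≋-trans (Z.*ₚ-congˡ B z) (Z.*ₚ-zeroʳ B))) (Z.*ₚ-zeroʳ A)))
    absurd (inj₂ (n , degC)) = contradiction
      (ZD.degree-unique degWG (ZD.degree-resp (Z.≋-sym eq)
        (ZD.degree-* (proj₂ degA) (ZD.degree-* (proj₂ degB) degC))))
      (λ 1≡ → contradiction (ℕ.suc-injective (≡.trans 1≡ (≡.cong suc (ℕ.+-suc (proj₁ degA) (proj₁ degB ℕ.+ n))))) λ ())

  prodₚ≋Π : ∀ {f g} → (∀ k → f k Z.≋ g k) → ∀ L → Z.prodₚ (map f L) Z.≋ Π g L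
  prodₚ≋Π h []      = Z.≋-refl
  prodₚ≋Π h (k ∷ L) = Z.*ₚ-cong (h k) (prodₚ≋Π h L)

  A≋ε : ∀ j k → Aₖ d j k Z.≋ ε k j
  A≋ε j k = ≡.subst (Z._≋ ε k j) (≡.sym (≡.cong₂ Z._-ₚ_ (orbit≡a (j ℕ.+ k)) (orbit≡a j))) (ε≋ k j)

  module _ {n : ℕ} (1≤n : 1 ≤ n) {G₀ : Z.Pol} (isG₀ : IsG d 0 n G₀) where
    L⁺ L⁻ : List ℕ
    L⁺ = divisorsμ+ n
    L⁻ = divisorsμ- n

    pos⁺ : All (1 ≤_) L⁺
    pos⁺ = All.map (λ { {zero} 0∣n → contradiction (≡.subst (1 ≤_) (0∣⇒≡0 0∣n) 1≤n) (λ ()) ; {suc k} _ → s≤s z≤n })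
             (divisorsμ+-∣ n)

    pos⁻ : All (1 ≤_) L⁻
    pos⁻ = All.map proj₁ (divisorsμ--proper 1≤n)

    orbit≋a : ∀ k → orbit d k Z.≋ a k
    orbit≋a k = ≡.subst (orbit d k Z.≋_) (orbit≡a k) Z.≋-refl

    G₀-eq : G₀ Z.*ₚ Π a L⁻ Z.≋ Π a L⁺
    G₀-eq = Z.≋-trans (Z.*ₚ-congˡ G₀ (Z.≋-sym (prodₚ≋Π orbit≋a L⁻))) (Z.≋-trans (Z.mk isG₀) (prodₚ≋Π orbit≋a L⁺))

    open Quotients ε-cancel a-cancelD pos⁺ pos⁻ {G₀} G₀-eq public

    num≋ : ∀ j → numF d (suc j) n Z.≋ num j
    num≋ j = Z.*ₚ-cong (prodₚ≋Π (A≋ε (suc j)) L⁺) (prodₚ≋Π (A≋ε j) L⁻)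

    den≋ : ∀ j → denF d (suc j) n Z.≋ den j
    den≋ j = Z.*ₚ-cong (prodₚ≋Π (A≋ε j) L⁺) (prodₚ≋Π (A≋ε (suc j)) L⁻)

    monic-ε : ∀ j {L} → All (1 ≤_) L → IsMonic (Π (λ k → ε k j) L)
    monic-ε j pos = monic-Π (All.map (λ 1≤k → _ , Monic-ε j 1≤k) pos)

    monic-num : ∀ j → IsMonic (num j)
    monic-num j = monic-* (monic-ε (suc j) pos⁺) (monic-ε j pos⁻)

    monic-den : ∀ j → IsMonic (den j)
    monic-den j = monic-* (monic-ε j pos⁺) (monic-ε (suc j) pos⁻)

    module _ {G f} (G≡ : G ≡ᴰ G₀ ^ f) {q} (irr : F.Irreducible q) where
      open AtPrime (primeWithSquare q irr)
      open PrimeWithSquare (primeWithSquare q irr)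

      -- With A and B in 𝔭 the product W G lies in 𝔮, in particular in 𝔭. As W is a unit at 𝔭, this
      -- puts G and then G₀ into 𝔭, which is what supplies the period n demanded by the hypothesis.
      ∉𝔮⇒unshared : (𝔭 (a n) → (∀ j → 𝔭 (a j) → n ∣ j) → ∀ {w} → ¬ 𝔭 w → ¬ 𝔮 (w Z.*ₚ G)) →
        ∀ {W A B T} → ¬ W ≈ᵈ + 0 → Z.const W Z.*ₚ G Z.≋ A Z.*ₚ (B Z.*ₚ T) → 𝔭 A → 𝔭 B → ⊥
      ∉𝔮⇒unshared ∉𝔮 {W} {A} {B} {T} W≉0 eq 𝔭A 𝔭B = ∉𝔮
        (𝔭-aₙ ε-cancel 1≤n pos⁺ pos⁻ (divisorsμ+-∣ n) (multiples-balanced 1≤n) G₀-eq 𝔭G₀)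
        (period-n ε-cancel 1≤n pos⁺ pos⁻ (divisorsμ+-∣ n) (multiples-balanced 1≤n) G₀-eq 𝔭G₀)
        W∉ 𝔮WG
        where
        W∉ : ¬ 𝔭 (Z.const W)
        W∉ = const∉ {W} {q} irr W≉0
        𝔮WG : 𝔮 (Z.const W Z.*ₚ G)
        𝔮WG = 𝔮-resp (Z.≋-trans (Z.*ₚ-assoc A B T) (Z.≋-sym eq)) (𝔮-* T (𝔭𝔭⇒𝔮 𝔭A 𝔭B))
        𝔭G₀ : 𝔭 G₀
        𝔭G₀ = [ (λ 𝔭W → contradiction 𝔭W W∉) , (λ 𝔭G → 𝔭-^⁻ f (𝔭-≡ᴰ G≡ 𝔭G)) ]′
          (𝔭-prime {Z.const W} {G} (𝔮⇒𝔭 𝔮WG))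

    misiurewicz₁ : ∀ {G} i → ¬ n ∣ suc i → G Z.*ₚ denF d (suc (suc i)) n Z.≋ numF d (suc (suc i)) n → Conclusion G₀ G
    misiurewicz₁ {G} i n∤j eq = conclude {G₀} {G} (proj₂ monic) G≡ unshared
      where
      j = suc i
      split = divisorsμ+-split 1≤n
      G-eq : G Z.*ₚ den j Z.≋ num j
      G-eq = Z.≋-trans (Z.*ₚ-congˡ G (Z.≋-sym (den≋ j))) (Z.≋-trans eq (num≋ j))
      monic : IsMonic G
      monic = monic-quotient (monic-den j) (monic-num j) G-eq
      Q-eq : G Z.*ₚ Π (Q j) L⁻ Z.≋ Π (Q j) L⁺
      Q-eq = cancel-ε {G} j G-eq
      G≡ = G≡G₀^ j Q-eq
      unshared : NoSharedFactor G
      unshared W A B T q W≉0 irr _ _ = ∉𝔮⇒unshared {G} {suc (proj₁ G≡)} (proj₂ G≡) {q} irr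
        (λ 𝔭aₙ per {w} ¬w → AtPrime.G∉𝔮 (primeWithSquare q irr) ε-cancel 1≤n
          {proj₁ split} {proj₁ (proj₂ split)} {L⁻}
          (proj₂ (proj₂ (proj₂ split))) (divisorsμ--proper 1≤n) 𝔭aₙ per {G} {w} i n∤j ¬w
          (≡.subst (λ L → G Z.*ₚ Π (Q j) L⁻ Z.≋ Π (Q j) L) (proj₁ (proj₂ (proj₂ split))) Q-eq)) {W} {A} {B} {T} W≉0

    module _ {G} i (n∣j : n ∣ suc i)
      (eq : G Z.*ₚ denF d (suc (suc i)) n Z.*ₚ numF d 1 n Z.≋ numF d (suc (suc i)) n Z.*ₚ denF d 1 n) where
      private
        j = suc i
        split = divisorsμ+-split 1≤n

      G-eq : G Z.*ₚ den j Z.*ₚ num 0 Z.≋ num j Z.*ₚ den 0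
      G-eq = Z.≋-trans (Z.≋-sym (Z.*ₚ-cong (Z.*ₚ-congˡ G (den≋ j)) (num≋ 0)))
        (Z.≋-trans eq (Z.*ₚ-cong (num≋ j) (den≋ 0)))

      private
        monic : IsMonic G
        monic = monic-quotient (monic-* (monic-den j) (monic-num 0)) (monic-* (monic-num j) (monic-den 0))
          (Z.≋-trans (Z.≋-sym (Z.*ₚ-assoc G (den j) (num 0))) G-eq)

        Q-eq : G Z.*ₚ Π (Q j) L⁻ Z.*ₚ Π (λ k → a k ^ suc e) L⁺ Z.≋ Π (Q j) L⁺ Z.*ₚ Π (λ k → a k ^ suc e) L⁻
        Q-eq = cancel-ε² {G} j G-eq

        G≡ : ∃ λ f → G ≡ᴰ G₀ ^ suc f
        G≡ = G≡G₀^′ i Q-eq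

      -- The alternatives mean d ≥ 3 and m ≥ 3.
      misiurewicz₂ : 1 ≤ e ⊎ 1 ≤ i → Conclusion G₀ G
      misiurewicz₂ large = conclude {G₀} {G} (proj₂ monic) G≡ unshared
        where
        unshared : NoSharedFactor G
        unshared W A B T q W≉0 irr _ _ = ∉𝔮⇒unshared {G} {suc (proj₁ G≡)} (proj₂ G≡) {q} irr
          (λ 𝔭aₙ per {w} ¬w → AtPrime.G∉𝔮′ (primeWithSquare q irr) ε-cancel 1≤n
            {proj₁ split} {proj₁ (proj₂ split)} {L⁻}
            (proj₂ (proj₂ (proj₂ split))) (divisorsμ--proper 1≤n) 𝔭aₙ per {G} {w} i n∣j large ¬w
            (≡.subst (λ L → G Z.*ₚ Π (Q j) L⁻ Z.*ₚ Π (λ k → a k ^ suc e) L Z.≋ Π (Q j) L Z.*ₚ Π (λ k → a k ^ suc e) L⁻)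
              (proj₁ (proj₂ (proj₂ split))) Q-eq)) {W} {A} {B} {T} W≉0

      misiurewicz₃ : (∀ {N} → Z.Monic G N → N ≡ 1) → Conclusion G₀ G
      misiurewicz₃ N≡1 = conclude {G₀} {G} (proj₂ monic) G≡
        (degree1⇒unshared (≡.subst (Z.Monic G) (N≡1 (proj₂ monic)) (proj₂ monic)))

-- Here the summand b^{d-1} of h need not lie in 𝔮, but G = c + 2 is linear.
module Exceptional (prime : Prime 2) {G₀ : Z.Pol} (isG₀ : IsG 2 0 1 G₀) {G : Z.Pol}
  (eq : G Z.*ₚ denF 2 2 1 Z.*ₚ numF 2 1 1 Z.≋ numF 2 2 1 Z.*ₚ denF 2 1 1) where
  open ModPrime prime
  open Misiurewicz prime

  conclusion : Conclusion G₀ G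
  -- For n = 1 the lists are [1] and [], so the defining equation reads G · `ε 1 1` · `ε 1 1` =
  -- `ε 1 2` · `ε 1 0`. Comparing degrees, N + 2 + 2 = 4 + 1.
  conclusion = misiurewicz₃ {1} (s≤s z≤n) {G₀} isG₀ {G} 0 ℕ.∣-refl eq λ {N} monic →
    ℕ.+-cancelʳ-≡ 4 N 1 (≡.trans (≡.sym (ℕ.+-assoc N 2 2)) (ZD.degree-unique
      (ZD.degree-resp (G-eq {1} (s≤s z≤n) {G₀} isG₀ {G} 0 ℕ.∣-refl eq)
        (+ 1 , (λ ()) , Z.Monic-* (Z.Monic-* monic (single {ε 1 1} {2} (Monic-ε 1 {1} (s≤s z≤n)))) (single {ε 1 1} {2} (Monic-ε 1 {1} (s≤s z≤n)))))
      (+ 1 , (λ ()) , Z.Monic-* (single {ε 1 2} {4} (Monic-ε 2 {1} (s≤s z≤n))) (single {ε 1 0} {1} (Monic-ε 0 {1} (s≤s z≤n))))))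
    where
    single : ∀ {p n} → Z.Monic p n → Z.Monic ((p Z.*ₚ Z.oneₚ) Z.*ₚ Z.oneₚ) n
    single {p} = Z.Lead-resp (Z.≋-sym (Z.≋-trans (CommutativeRing.*-identityʳ Z.polyRing (p Z.*ₚ Z.oneₚ))
      (CommutativeRing.*-identityʳ Z.polyRing p)))

theorem1p4 : (d m n : ℕ) → Prime d → 2 ≤ m → 1 ≤ n →
    (G₀ Gₘ : ℤ[c].Pol) → IsG d 0 n G₀ → IsG d m n Gₘ →
    ((k l : ℕ) → ℚ[c].HasIrreducibleFactorCount (toℚ[c] Gₘ) k →
       𝔽[c].HasIrreducibleFactorCount d (reduce d G₀) l → k ≤ l)
    × (𝔽[c].Irreducible d (reduce d G₀) → ℚ[c].Irreducible (toℚ[c] Gₘ))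
theorem1p4 zero          _ _ pr = contradiction pr ¬prime[0]
theorem1p4 (suc zero)    _ _ pr = contradiction pr ¬prime[1]
theorem1p4 (suc (suc e)) (suc (suc i)) n pr (s≤s (s≤s z≤n)) 1≤n G₀ G isG₀ isG with n ∣? suc i
... | no  n∤j = Misiurewicz.misiurewicz₁ pr 1≤n {G₀} isG₀ {G} i n∤j (Z.mk isG)
... | yes n∣j = divisible e i pr isG₀ (Z.mk isG) n∣j
  where
  divisible : ∀ e i (pr : Prime (2 ℕ.+ e)) → IsG (2 ℕ.+ e) 0 n G₀ →
    G Z.*ₚ denF (2 ℕ.+ e) (suc (suc i)) n Z.*ₚ numF (2 ℕ.+ e) 1 n Z.≋ numF (2 ℕ.+ e) (suc (suc i)) n Z.*ₚ denF (2 ℕ.+ e) 1 n →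
    n ∣ suc i → Misiurewicz.Conclusion pr G₀ G
  -- The three cases are d ≥ 3; d = 2 with m ≥ 3; and d = m = 2, where n divides 1.
  divisible (suc e) i       pr isG₀ eq n∣j = Misiurewicz.misiurewicz₂ pr 1≤n {G₀} isG₀ {G} i n∣j eq (inj₁ (s≤s z≤n))
  divisible zero    (suc i) pr isG₀ eq n∣j = Misiurewicz.misiurewicz₂ pr 1≤n {G₀} isG₀ {G} (suc i) n∣j eq (inj₂ (s≤s z≤n))
  divisible zero    zero    pr isG₀ eq n∣1 = exceptional (∣1⇒≡1 n∣1) isG₀ eq
    where
    exceptional : ∀ {n} → n ≡ 1 → IsG 2 0 n G₀ →
      G Z.*ₚ denF 2 2 n Z.*ₚ numF 2 1 n Z.≋ numF 2 2 n Z.*ₚ denF 2 1 n → Misiurewicz.Conclusion pr G₀ G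
    exceptional ≡.refl = λ isG₀ eq → Exceptional.conclusion pr {G₀} isG₀ {G} eq
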